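{- For all integers $n,r,d\ge 1$, \[ g(n;d)=\sum_{\pi\in S_d}\operatorname{sgn}(\pi)\,\bigl|W'(d,2rn;T(\pi))\bigr| , \] where the sum runs over all permutations $\pi$ of $[d]$.
   Context: Fix integers $n,r\ge 1$ and let $m=rn$. Let $U=\{u_1,\dots,u_n\}$ and $V=\{v_1,\dots,v_n\}$ be disjoint sets, totally ordered by $u_1\prec\cdots\prec u_n$ and $v_1\prec\cdots\prec v_n$. An $r$-regular bipartite multigraph on $(U,V)$ is a multiset of edges $uv$ ($u\in U$, $v\in V$) in which every vertex has degree $r$ (equivalently, an $n\times n$ matrix of nonnegative integers, the multiplicities, with all row and column sums equal to $r$). Two edges $uv,u'v'$ are noncrossing if ($u\prec u'$ and $v\prec v'$) or ($u'\prec u$ and $v'\prec v$). A planar matching is a set of pairwise noncrossing edges; $L(G)$ is the maximum number of edges of a planar matching of $G$. $g(n;d)$ is the number of $r$-regular bipartite multigraphs $G$ on $(U,V)$ with $L(G)\le d$. Walks: a walk of length $2m$ in $\mathbb Z^d$ starting at the origin whose first $m$ steps are positive unit steps and last $m$ steps are negative unit steps is written $a_1\cdots a_m\,|\,b_1\cdots b_m$ with $a_i,b_i\in[d]$, meaning the steps are $e_{a_1},\dots,e_{a_m},-e_{b_1},\dots,-e_{b_m}$ ($e_j$ the standard basis vectors). For $P\subseteq\mathbb Z^d$ (or a point), $W^*(d,2m;P)$ is the set of such walks ending in $P$. Positive steps are indexed by $U\times[r]$ and negative steps by $V\times[r]$ via $a_{u_i^s}=a_{r(i-1)+s}$, $b_{v_i^s}=b_{r(i-1)+s}$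 ($i\in[n]$, $s\in[r]$). For a permutation $\pi$ of $[d]$, the Toeplitz point is $T(\pi)=(1-\pi(1),2-\pi(2),\dots,d-\pi(d))$. $W'(d,2m;P)$ is the set of walks in $W^*(d,2m;P)$ with $a_{u^s}\ge a_{u^{s+1}}$ and $b_{v^s}\ge b_{v^{s+1}}$ for all $u\in U$, $v\in V$, $1\le s<r$. -}

module Defs where

open import Data.Nat.Base using (ℕ; zero; suc; _*_; _≤_; s≤s)
import Data.Nat.Properties as ℕ
open import Data.Integer.Base as ℤ using (ℤ; 0ℤ; 1ℤ; -1ℤ)
import Data.Integer.Properties as ℤ
open import Data.Fin.Base as Fin using (Fin; zero; suc; toℕ; combine; punchIn)
import Data.Fin.Properties as Fin
open import Data.Fin.Permutation as Perm
  using (Permutation′; _⟨$⟩ʳ_; insert; remove; insert-remove)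
open import Data.List.Base
  using (List; []; _∷_; _++_; length; filter; foldr; map; replicate; concatMap;
         cartesianProduct; cartesianProductWith; allFin; upTo)
open import Data.List.Extrema.Nat using (max; v≤max⁺; argmax-sel)
open import Data.List.Membership.Propositional using (_∈_)
open import Data.List.Membership.Propositional.Properties
  using (∈-map⁺; ∈-map⁻; ∈-++⁺ˡ; ∈-++⁺ʳ; ∈-++⁻; ∈-filter⁺; ∈-filter⁻; ∈-allFin; ∈-upTo⁺;
         ∈-cartesianProduct⁺; ∈-cartesianProductWith⁺)
import Data.List.Membership.Setoid as SetoidMembership
import Data.List.Membership.Setoid.Properties as SetoidMembership
open import Data.List.Relation.Binary.Sublist.Propositional using (_⊆_; []; _∷ʳ_; _∷_)
open import Data.List.Relation.Unary.All as All using (All; []; _∷_)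
import Data.List.Relation.Unary.All.Properties as All
open import Data.List.Relation.Unary.AllPairs using (AllPairs; []; _∷_; allPairs?)
open import Data.List.Relation.Unary.Any as Any using (here; there)
import Data.List.Relation.Unary.Unique.Propositional.Properties as Unique
import Data.List.Relation.Unary.Unique.Setoid as SetoidUnique
import Data.List.Relation.Unary.Unique.Setoid.Properties as SetoidUnique
open import Data.Product.Base using (_×_; _,_; proj₁; proj₂; ∃-syntax)
open import Data.Sum.Base using (_⊎_; inj₁; inj₂)
open import Data.Unit.Base using (⊤; tt)
open import Data.Vec.Base as Vec using (Vec; []; _∷_; lookup; tabulate; sum)
import Data.Vec.Properties as Vec
open import Data.Vec.Functional using (Vector)
open import Data.Vec.Relation.Unary.All as VecAll using ([]; _∷_)
import Data.Vec.Relation.Unary.All.Properties as VecAll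
open import Function.Base using (_∘_)
open import Level using (0ℓ)
open import Relation.Binary.Bundles using (Setoid)
open import Relation.Binary.PropositionalEquality
  using (_≡_; refl; sym; trans; cong; subst; setoid)
open import Relation.Nullary.Decidable using (Dec; does; _×-dec_; _⊎-dec_; _→-dec_)
open import Data.Bool.Base using (if_then_else_)
open import Relation.Unary using (Pred; Decidable)

-- A subset P of a setoid S is finite when its elements can be listed without
-- repetition, up to the equality of S.  Any two such lists have the same length,
-- and the same sums of functions respecting that equality.
record Enumeration (S : Setoid 0ℓ 0ℓ) (P : Pred (Setoid.Carrier S) 0ℓ) : Set where
  open Setoid S using (Carrier)
  field
    elements : List Carrier
    unique   : SetoidUnique.Unique S elements
    sound    : All P elements
    complete : ∀ {x} → P x → SetoidMembership._∈_ S x elements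

open Enumeration public

∣_∣ : ∀ {S P} → Enumeration S P → ℕ
∣ E ∣ = length (elements E)

∑ : ∀ {S P} → Enumeration S P → (Setoid.Carrier S → ℤ) → ℤ
∑ E f = foldr (λ x s → f x ℤ.+ s) 0ℤ (elements E)

enumerate-⊆ : ∀ {A : Set} {P Q : Pred A 0ℓ} → Decidable P → (∀ {x} → P x → Q x) →
              Enumeration (setoid A) Q → Enumeration (setoid A) P
enumerate-⊆ P? P⊆Q E = record
  { elements = filter P? (elements E)
  ; unique   = Unique.filter⁺ P? (unique E)
  ; sound    = All.all-filter P? (elements E)
  ; complete = λ px → ∈-filter⁺ P? (complete E (P⊆Q px)) px
  }

enumerate-Fin : ∀ n → Enumeration (setoid (Fin n)) (λ _ → ⊤)
enumerate-Fin n = record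
  { elements = allFin n
  ; unique   = Unique.allFin⁺ n
  ; sound    = All.universal (λ _ → tt) (allFin n)
  ; complete = λ {i} _ → ∈-allFin i
  }

enumerate-≤ : ∀ n → Enumeration (setoid ℕ) (_≤ n)
enumerate-≤ n = record
  { elements = upTo (suc n)
  ; unique   = Unique.upTo⁺ (suc n)
  ; sound    = All.applyUpTo⁺₁ (λ i → i) (suc n) ℕ.≤-pred
  ; complete = λ i≤n → ∈-upTo⁺ (s≤s i≤n)
  }

enumerate-× : ∀ {A B : Set} {P : Pred A 0ℓ} {Q : Pred B 0ℓ} →
              Enumeration (setoid A) P → Enumeration (setoid B) Q →
              Enumeration (setoid (A × B)) (λ (a , b) → P a × Q b)
enumerate-× E F = record
  { elements = cartesianProduct (elements E) (elements F)
  ; unique   = Unique.cartesianProduct⁺ (unique E) (unique F)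
  ; sound    = All.cartesianProduct⁺ (setoid _) (setoid _) (elements E) (elements F)
                 (λ a∈ b∈ → All.lookup (sound E) a∈ , All.lookup (sound F) b∈)
  ; complete = λ (pa , qb) → ∈-cartesianProduct⁺ (complete E pa) (complete F qb)
  }

enumerate-Vec : ∀ {A : Set} {P : Pred A 0ℓ} → Enumeration (setoid A) P →
                ∀ n → Enumeration (setoid (Vec A n)) (VecAll.All P)
enumerate-Vec E zero = record
  { elements = [] ∷ []
  ; unique   = [] ∷ []
  ; sound    = [] ∷ []
  ; complete = λ { [] → here refl }
  }
enumerate-Vec {A} E (suc n) = record
  { elements = cartesianProductWith _∷_ (elements E) (elements F)
  ; unique   = Unique.cartesianProductWith⁺ _∷_ Vec.∷-injective (unique E) (unique F)
  ; sound    = All.cartesianProductWith⁺ (setoid A) (setoid (Vec A n)) _∷_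
                 (elements E) (elements F)
                 (λ a∈ v∈ → All.lookup (sound E) a∈ ∷ All.lookup (sound F) v∈)
  ; complete = λ { (pa ∷ pv) →
                 ∈-cartesianProductWith⁺ _∷_ (complete E pa) (complete F pv) }
  }
  where F = enumerate-Vec E n

-- The vertices uᵢ and vᵢ are the elements of two copies of Fin n, and a
-- multigraph is its matrix of edge multiplicities.
Multigraph : ℕ → Set
Multigraph n = Vec (Vec ℕ n) n

mult : ∀ {n} → Multigraph n → Fin n → Fin n → ℕ
mult G u v = lookup (lookup G u) v

degᵁ degⱽ : ∀ {n} → Multigraph n → Fin n → ℕ
degᵁ G u = sum (tabulate λ v → mult G u v)
degⱽ G v = sum (tabulate λ u → mult G u v)

Regular : ∀ {n} → ℕ → Multigraph n → Set
Regular r G = (∀ u → degᵁ G u ≡ r) × (∀ v → degⱽ G v ≡ r)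

Edge : ℕ → Set
Edge n = Fin n × Fin n

edges : ∀ {n} → Multigraph n → List (Edge n)
edges {n} G = concatMap (λ (u , v) → replicate (mult G u v) (u , v))
                        (cartesianProduct (allFin n) (allFin n))

Noncrossing : ∀ {n} → Edge n → Edge n → Set
Noncrossing (u , v) (u′ , v′) =
  (u Fin.< u′ × v Fin.< v′) ⊎ (u′ Fin.< u × v′ Fin.< v)

noncrossing? : ∀ {n} (e e′ : Edge n) → Dec (Noncrossing e e′)
noncrossing? (u , v) (u′ , v′) =
  (u Fin.<? u′ ×-dec v Fin.<? v′) ⊎-dec (u′ Fin.<? u ×-dec v′ Fin.<? v)

-- A set of edges of G is a sublist of edges G, i.e. a choice of positions;
-- parallel edges cross, so a planar matching never repeats a pair.
PlanarMatching : ∀ {n} → Multigraph n → List (Edge n) → Set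
PlanarMatching G M = M ⊆ edges G × AllPairs Noncrossing M

sublists : ∀ {A : Set} → List A → List (List A)
sublists []       = [] ∷ []
sublists (x ∷ xs) = map (x ∷_) (sublists xs) ++ sublists xs

planarMatchings : ∀ {n} → Multigraph n → List (List (Edge n))
planarMatchings G = filter (allPairs? noncrossing?) (sublists (edges G))

-- The empty matching is always planar, so 0 is a harmless base value.
L : ∀ {n} → Multigraph n → ℕ
L G = max 0 (map length (planarMatchings G))

∈-sublists⁺ : ∀ {A : Set} {xs ys : List A} → xs ⊆ ys → xs ∈ sublists ys
∈-sublists⁺ []          = here refl
∈-sublists⁺ (y ∷ʳ p)    = ∈-++⁺ʳ (map (y ∷_) _) (∈-sublists⁺ p)
∈-sublists⁺ (refl ∷ p)  = ∈-++⁺ˡ (∈-map⁺ (_ ∷_) (∈-sublists⁺ p))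

∈-sublists⁻ : ∀ {A : Set} {xs : List A} ys → xs ∈ sublists ys → xs ⊆ ys
∈-sublists⁻ []       (here refl) = []
∈-sublists⁻ (y ∷ ys) xs∈ with ∈-++⁻ (map (y ∷_) (sublists ys)) xs∈
... | inj₂ xs∈ʳ = y ∷ʳ ∈-sublists⁻ ys xs∈ʳ
... | inj₁ xs∈ˡ with ∈-map⁻ (y ∷_) xs∈ˡ
...   | _ , zs∈ , refl = refl ∷ ∈-sublists⁻ ys zs∈

L-upper : ∀ {n} (G : Multigraph n) {M} → PlanarMatching G M → length M ≤ L G
L-upper G {M} (M⊆ , nc) =
  v≤max⁺ 0 (map length (planarMatchings G))
    (inj₂ (Any.map ℕ.≤-reflexive
      (∈-map⁺ length (∈-filter⁺ (allPairs? noncrossing?) (∈-sublists⁺ M⊆) nc))))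

L-attained : ∀ {n} (G : Multigraph n) → ∃[ M ] PlanarMatching G M × length M ≡ L G
L-attained G with argmax-sel (λ k → k) 0 (map length (planarMatchings G))
... | inj₁ L≡0 = [] , (∈-sublists⁻ (edges G) ([]∈ (edges G)) , []) , sym L≡0
  where
  []∈ : ∀ {A : Set} (xs : List A) → [] ∈ sublists xs
  []∈ []       = here refl
  []∈ (x ∷ xs) = ∈-++⁺ʳ (map (x ∷_) (sublists xs)) ([]∈ xs)
... | inj₂ L∈ with ∈-map⁻ length L∈
...   | M , M∈ , L≡ with ∈-filter⁻ (allPairs? noncrossing?) {xs = sublists (edges G)} M∈
...     | M∈′ , nc = M , (∈-sublists⁻ (edges G) M∈′ , nc) , sym L≡

GraphsWithL≤ : ∀ n r d → Pred (Multigraph n) 0ℓ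
GraphsWithL≤ n r d G = Regular r G × L G ≤ d

graphsWithL≤ : ∀ n r d → Enumeration (setoid (Multigraph n)) (GraphsWithL≤ n r d)
graphsWithL≤ n r d =
  enumerate-⊆ graph? (entries≤r ∘ proj₁) (enumerate-Vec (enumerate-Vec (enumerate-≤ r) n) n)
  where
  graph? : Decidable (GraphsWithL≤ n r d)
  graph? G = ((Fin.all? λ u → degᵁ G u ℕ.≟ r) ×-dec (Fin.all? λ v → degⱽ G v ℕ.≟ r))
             ×-dec (L G ℕ.≤? d)

  summand≤sum : ∀ {k} (f : Fin k → ℕ) i → f i ≤ sum (tabulate f)
  summand≤sum f zero    = ℕ.m≤m+n _ _
  summand≤sum f (suc i) = ℕ.≤-trans (summand≤sum (f ∘ suc) i) (ℕ.m≤n+m _ _)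

  entries≤r : ∀ {G} → Regular r G → VecAll.All (VecAll.All (_≤ r)) G
  entries≤r {G} (deg≡r , _) =
    VecAll.lookup⁻ λ u → VecAll.lookup⁻ λ v →
      subst (mult G u v ≤_) (deg≡r u) (summand≤sum (mult G u) v)

-- g r n d is the number written g(n;d), the degree r being fixed there.
g : ℕ → ℕ → ℕ → ℕ
g r n d = ∣ graphsWithL≤ n r d ∣

Point : ℕ → Set
Point d = Vector ℤ d

unit : ∀ {d} → Fin d → Point d
unit j k = if does (j Fin.≟ k) then 1ℤ else 0ℤ

-- (a , b) is the walk a₁⋯aₘ|b₁⋯bₘ.
Walk : ℕ → ℕ → Set
Walk d m = Vec (Fin d) m × Vec (Fin d) m

steps : ∀ {d m} → Walk d m → List (Point d)
steps (a , b) = map unit (Vec.toList a) ++ map (λ j k → ℤ.- unit j k) (Vec.toList b)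

endpoint : ∀ {d m} → Walk d m → Point d
endpoint w = foldr (λ s p k → s k ℤ.+ p k) (λ _ → 0ℤ) (steps w)

W* : ∀ d m → Point d → Pred (Walk d m) 0ℓ
W* d m P w = ∀ k → endpoint w k ≡ P k

-- combine i s is, counting from 1, the position r(i-1)+s.
BlockwiseDecreasing : ∀ n r {d} → Vec (Fin d) (n * r) → Set
BlockwiseDecreasing n r a =
  ∀ (i : Fin n) (s s⁺ : Fin r) → toℕ s⁺ ≡ suc (toℕ s) →
  lookup a (combine i s) Fin.≥ lookup a (combine i s⁺)

W′ : ∀ n r d → Point d → Pred (Walk d (n * r)) 0ℓ
W′ n r d P w@(a , b) =
  W* d (n * r) P w × BlockwiseDecreasing n r a × BlockwiseDecreasing n r b

enumerate-W′ : ∀ n r d P → Enumeration (setoid (Walk d (n * r))) (W′ n r d P)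
enumerate-W′ n r d P =
  enumerate-⊆ w′? (λ _ → all⊤ _ , all⊤ _) (enumerate-× words words)
  where
  words = enumerate-Vec (enumerate-Fin d) (n * r)

  all⊤ : (a : Vec (Fin d) (n * r)) → VecAll.All (λ _ → ⊤) a
  all⊤ = VecAll.universal (λ _ → tt)

  decreasing? : (a : Vec (Fin d) (n * r)) → Dec (BlockwiseDecreasing n r a)
  decreasing? a = Fin.all? λ i → Fin.all? λ s → Fin.all? λ s⁺ →
    (toℕ s⁺ ℕ.≟ suc (toℕ s)) →-dec (lookup a (combine i s⁺) Fin.≤? lookup a (combine i s))

  w′? : Decidable (W′ n r d P)
  w′? w@(a , b) =
    (Fin.all? λ k → endpoint w k ℤ.≟ P k) ×-dec decreasing? a ×-dec decreasing? b

permutationSetoid : ℕ → Setoid 0ℓ 0ℓ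
permutationSetoid d = record
  { Carrier       = Permutation′ d
  ; _≈_           = Perm._≈_
  ; isEquivalence = record
    { refl  = λ _ → refl
    ; sym   = λ p i → sym (p i)
    ; trans = λ p q i → trans (p i) (q i)
    }
  }

-- The permutations of Fin (suc d) arise from those of Fin d by choosing the
-- image of zero.
S : ∀ d → Enumeration (permutationSetoid d) (λ _ → ⊤)
S zero = record
  { elements = Perm.id ∷ []
  ; unique   = [] ∷ []
  ; sound    = tt ∷ []
  ; complete = λ _ → here λ ()
  }
S (suc d) = record
  { elements = cartesianProductWith (insert zero) (allFin (suc d)) (elements (S d))
  ; unique   = SetoidUnique.cartesianProductWith⁺ (setoid (Fin (suc d))) Sd Sd⁺
                 (insert zero) (λ {w} {x} {y} {z} → insert-injective {w} {x} {y} {z})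
                 (Unique.allFin⁺ (suc d)) (unique (S d))
  ; sound    = All.universal (λ _ → tt) _
  ; complete = λ {π} _ → SetoidMembership.∈-resp-≈ Sd⁺ {x = insert zero (π ⟨$⟩ʳ zero) (remove zero π)} {y = π} (insert-remove zero π)
                 (SetoidMembership.∈-cartesianProductWith⁺ (setoid (Fin (suc d))) Sd Sd⁺
                   (λ {w} {x} {y} {z} → insert-cong {w} {x} {y} {z})
                   (∈-allFin (π ⟨$⟩ʳ zero)) (complete (S d) {remove zero π} tt))
  }
  where
  Sd  = permutationSetoid d
  Sd⁺ = permutationSetoid (suc d)

  insert-cong : ∀ {j k} {π ρ : Permutation′ d} → j ≡ k → π Perm.≈ ρ →
                insert zero j π Perm.≈ insert zero k ρ
  insert-cong refl π≈ρ zero    = refl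
  insert-cong {j} refl π≈ρ (suc i) = cong (punchIn j) (π≈ρ i)

  insert-injective : ∀ {j k} {π ρ : Permutation′ d} →
                     insert zero j π Perm.≈ insert zero k ρ → j ≡ k × π Perm.≈ ρ
  insert-injective {j} {k} {π} {ρ} eq with eq zero
  ... | refl = refl , λ i → Fin.punchIn-injective j _ _ (eq (suc i))

inversions : ∀ {d} → Permutation′ d → List (Fin d × Fin d)
inversions {d} π =
  filter (λ (i , j) → (i Fin.<? j) ×-dec ((π ⟨$⟩ʳ j) Fin.<? (π ⟨$⟩ʳ i)))
         (cartesianProduct (allFin d) (allFin d))

sgn : ∀ {d} → Permutation′ d → ℤ
sgn π = -1ℤ ℤ.^ length (inversions π)

-- Counting from 0 instead of 1 leaves the differences j - π(j) unchanged.
toeplitz : ∀ {d} → Permutation′ d → Point d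
toeplitz π j = ℤ.+ toℕ j ℤ.- ℤ.+ toℕ (π ⟨$⟩ʳ j)

-- Recording the number of letters of each kind, a block of a walk in W′ is a
-- composition of r into d parts, so the right-hand side is the sum of
-- N(Σxs − Σys) over all pairs of sequences xs, ys of n compositions, where
-- N(c) = Σ_π sgn π [c = π − id] is antisymmetric under the reflections of ℤ^d that
-- transpose adjacent coordinates of c + (0,1,…,d-1).  Starting from a point c of
-- the Weyl chamber, reflecting in the first (or last) wall that is crossed cancels
-- all steps c ± x that are not horizontal strips.  Hence the sum counts the pairs of
-- chains of horizontal strips of size r from the empty partition to a common
-- partition with at most d rows.  Burge's variant of the RSK correspondence, in
-- the form of a growth diagram, turns these pairs into r-regular matrices, and the
-- number of rows of each shape in the diagram is the length of the longest
-- strictly increasing chain of nonzero entries, that is, L of the corresponding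
-- submatrix.

module Submission where

open import Data.Nat.Base using (ℕ; zero; suc; _≤_; _<_; z≤n; s≤s; _+_; _∸_; _⊔_; _⊓_; z<s; s<s)
import Data.Nat.Base as ℕ
import Data.Nat.Properties as ℕ
import Data.Nat.Tactic.RingSolver as ℕSolver
open import Data.Integer.Base as ℤ using (ℤ; +_; _*_; 0ℤ; 1ℤ; -1ℤ; -[1+_])
import Data.Integer.Properties as ℤ
import Data.Integer.Tactic.RingSolver as ℤSolver
open import Data.Bool.Base using (if_then_else_)
open import Data.Empty using (⊥)
open import Data.Unit.Base using (⊤; tt)
open import Data.Fin.Base as Fin using (Fin; zero; suc; toℕ; combine)
import Data.Fin.Properties as Fin
open import Data.Fin.Permutation as Perm using (Permutation′; _⟨$⟩ʳ_; _⟨$⟩ˡ_; _∘ₚ_)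
open import Data.List.Base as List using (List; []; _∷_; _++_; length; filter; foldr; map; replicate; concatMap; cartesianProduct; cartesianProductWith; allFin)
import Data.List.Properties as List
open import Data.List.Membership.Propositional using (_∈_)
import Data.List.Membership.Propositional.Properties as ∈
open import Data.List.Relation.Binary.Sublist.Propositional using (_⊆_; []; _∷ʳ_; _∷_)
import Data.List.Relation.Binary.Sublist.Propositional.Properties as Sublist
open import Data.List.Relation.Unary.All as All using (All; []; _∷_)
import Data.List.Relation.Unary.All.Properties as All
open import Data.List.Relation.Unary.AllPairs as AllPairs using (AllPairs; []; _∷_)
import Data.List.Relation.Unary.AllPairs.Properties as AllPairs
open import Data.List.Relation.Unary.Any as Any using (Any; here; there)
open import Data.List.Relation.Unary.Unique.Propositional using (Unique)
import Data.List.Relation.Unary.Unique.Propositional.Properties as Unique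
open import Data.Product.Base using (_×_; _,_; proj₁; proj₂; ∃; ∃-syntax; map₁)
open import Data.Sum.Base using (_⊎_; inj₁; inj₂)
open import Data.Vec.Base as Vec using (Vec; []; _∷_; lookup; tabulate; sum; zipWith)
import Data.Vec.Properties as Vec
open import Data.Vec.Relation.Unary.All as VecAll using ([]; _∷_)
import Data.Vec.Relation.Unary.All.Properties as VecAll
open import Function.Base using (_∘_; id; flip; case_of_)
open import Relation.Binary.Definitions using (tri<; tri≈; tri>)
open import Level using (0ℓ)
open import Relation.Binary.PropositionalEquality using (_≡_; refl; sym; trans; cong; cong₂; subst; subst₂; setoid; module ≡-Reasoning)
open import Relation.Nullary.Decidable using (Dec; yes; no; does; _×-dec_; dec-true; dec-false)
open import Relation.Nullary.Negation using (¬_; contradiction)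
open import Relation.Unary using (Pred; Decidable)
open import Defs

-- The bound `d` is built into the representation: a partition is a vector of `d` parts, and the
-- local rule gets one extra entry for the cells that would enter row `d + 1`. This overflow
-- vanishes in every cell of the diagram exactly when `L` is at most `d`. Its vanishing is also what
-- allows the rule to be inverted, so the single condition `AllFit` serves the bijection and the
-- bound alike. Listing the parts from smallest to largest puts the overflow at the head and makes
-- the Weyl chamber the set of increasing vectors.
--
-- The cancellation is carried out on sums, without an involution on walks. Antisymmetry survives
-- summation over a whole step, because adjacent parts of a composition may be exchanged. At each
-- wall only the two amounts added to the adjacent coordinates matter: past the wall, their sum
-- equals its own negative. What remains is the value of `N` on the chamber, where it is the
-- indicator of the origin; this forces the downward chain to end at the empty partition.

-- Finite sums, indicators and counting by bijection.

∑ₗ : ∀ {A : Set} → List A → (A → ℤ) → ℤ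
∑ₗ []       f = 0ℤ
∑ₗ (x ∷ xs) f = f x ℤ.+ ∑ₗ xs f

foldr≡∑ₗ : ∀ {A : Set} (xs : List A) (f : A → ℤ) → foldr (λ x s → f x ℤ.+ s) 0ℤ xs ≡ ∑ₗ xs f
foldr≡∑ₗ []       f = refl
foldr≡∑ₗ (x ∷ xs) f = cong (λ s → f x ℤ.+ s) (foldr≡∑ₗ xs f)

⟦_⟧ : ∀ {P : Set} → Dec P → ℤ
⟦ P? ⟧ = if does P? then 1ℤ else 0ℤ

private variable
  A B : Set

⟦⟧-cong : {P Q : Set} (P? : Dec P) (Q? : Dec Q) → (P → Q) → (Q → P) → ⟦ P? ⟧ ≡ ⟦ Q? ⟧
⟦⟧-cong (yes p) (yes q) _ _ = refl
⟦⟧-cong (yes p) (no ¬q) f _ = contradiction (f p) ¬q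
⟦⟧-cong (no ¬p) (yes q) _ g = contradiction (g q) ¬p
⟦⟧-cong (no ¬p) (no ¬q) _ _ = refl

⟦⟧-× : {P Q : Set} (P? : Dec P) (Q? : Dec Q) → ⟦ P? ×-dec Q? ⟧ ≡ ⟦ P? ⟧ * ⟦ Q? ⟧
⟦⟧-× (yes _) (yes _) = refl
⟦⟧-× (yes _) (no _)  = refl
⟦⟧-× (no _)  (yes _) = refl
⟦⟧-× (no _)  (no _)  = refl

⟦⟧-*-cong : {P : Set} (P? : Dec P) {x y : ℤ} → (P → x ≡ y) → ⟦ P? ⟧ * x ≡ ⟦ P? ⟧ * y
⟦⟧-*-cong (yes p) x≡y = cong (1ℤ *_) (x≡y p)
⟦⟧-*-cong (no _)  _   = refl

∑ₗ-cong : ∀ (xs : List A) {f h : A → ℤ} → (∀ x → f x ≡ h x) → ∑ₗ xs f ≡ ∑ₗ xs h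
∑ₗ-cong []       eq = refl
∑ₗ-cong (x ∷ xs) eq = cong₂ ℤ._+_ (eq x) (∑ₗ-cong xs eq)

∑ₗ-zero : ∀ (xs : List A) → ∑ₗ xs (λ _ → 0ℤ) ≡ 0ℤ
∑ₗ-zero []       = refl
∑ₗ-zero (x ∷ xs) = trans (ℤ.+-identityˡ _) (∑ₗ-zero xs)

+-interchange : ∀ a b c d → (a ℤ.+ b) ℤ.+ (c ℤ.+ d) ≡ (a ℤ.+ c) ℤ.+ (b ℤ.+ d)
+-interchange = ℤSolver.solve-∀

∑ₗ-+ : ∀ (xs : List A) (f h : A → ℤ) → ∑ₗ xs (λ x → f x ℤ.+ h x) ≡ ∑ₗ xs f ℤ.+ ∑ₗ xs h
∑ₗ-+ []       f h = refl
∑ₗ-+ (x ∷ xs) f h rewrite ∑ₗ-+ xs f h = +-interchange (f x) (h x) (∑ₗ xs f) (∑ₗ xs h)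

∑ₗ-*ˡ : ∀ (xs : List A) (k : ℤ) (f : A → ℤ) → ∑ₗ xs (λ x → k * f x) ≡ k * ∑ₗ xs f
∑ₗ-*ˡ []       k f = sym (ℤ.*-zeroʳ k)
∑ₗ-*ˡ (x ∷ xs) k f rewrite ∑ₗ-*ˡ xs k f = sym (ℤ.*-distribˡ-+ k (f x) _)

∑ₗ-neg : ∀ (xs : List A) (f : A → ℤ) → ∑ₗ xs (λ x → ℤ.- f x) ≡ ℤ.- ∑ₗ xs f
∑ₗ-neg []       f = refl
∑ₗ-neg (x ∷ xs) f rewrite ∑ₗ-neg xs f = sym (ℤ.neg-distrib-+ (f x) _)

∑ₗ-swap : ∀ (xs : List A) (ys : List B) (f : A → B → ℤ) →
          ∑ₗ xs (λ x → ∑ₗ ys (f x)) ≡ ∑ₗ ys (λ y → ∑ₗ xs (λ x → f x y))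
∑ₗ-swap []       ys f = sym (∑ₗ-zero ys)
∑ₗ-swap (x ∷ xs) ys f rewrite ∑ₗ-swap xs ys f = sym (∑ₗ-+ ys (f x) _)

∑ₗ-++ : ∀ (xs ys : List A) (f : A → ℤ) → ∑ₗ (xs ++ ys) f ≡ ∑ₗ xs f ℤ.+ ∑ₗ ys f
∑ₗ-++ []       ys f = sym (ℤ.+-identityˡ _)
∑ₗ-++ (x ∷ xs) ys f rewrite ∑ₗ-++ xs ys f = sym (ℤ.+-assoc (f x) _ _)

∑ₗ-map : ∀ (h : A → B) (xs : List A) (f : B → ℤ) → ∑ₗ (map h xs) f ≡ ∑ₗ xs (f ∘ h)
∑ₗ-map h []       f = refl
∑ₗ-map h (x ∷ xs) f = cong (λ s → f (h x) ℤ.+ s) (∑ₗ-map h xs f)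

∑ₗ-cartesianProductWith : ∀ {C : Set} (_⊗_ : A → B → C) xs ys (f : C → ℤ) →
  ∑ₗ (cartesianProductWith _⊗_ xs ys) f ≡ ∑ₗ xs (λ x → ∑ₗ ys (λ y → f (x ⊗ y)))
∑ₗ-cartesianProductWith _⊗_ []       ys f = refl
∑ₗ-cartesianProductWith _⊗_ (x ∷ xs) ys f
  rewrite ∑ₗ-++ (map (x ⊗_) ys) (cartesianProductWith _⊗_ xs ys) f
        | ∑ₗ-map (x ⊗_) ys f
        | ∑ₗ-cartesianProductWith _⊗_ xs ys f = refl

length-filter : ∀ {P : Pred A 0ℓ} (P? : Decidable P) xs →
                + length (filter P? xs) ≡ ∑ₗ xs (λ x → ⟦ P? x ⟧)
length-filter P? [] = refl
length-filter P? (x ∷ xs) with P? x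
... | yes _ = trans (ℤ.pos-+ 1 _) (cong (λ s → 1ℤ ℤ.+ s) (length-filter P? xs))
... | no _  = trans (length-filter P? xs) (sym (ℤ.+-identityˡ _))

-- Pigeonhole without deciding equality: the membership proof locates the head of `xs` in `ys`,
-- where it is cut out, and uniqueness keeps the rest of `xs` inside what remains.
unique⊆⇒length≤ : ∀ {xs ys : List A} → Unique xs → (∀ {x} → x ∈ xs → x ∈ ys) → length xs ≤ length ys
unique⊆⇒length≤ [] _ = z≤n
unique⊆⇒length≤ {xs = x ∷ xs} (x∉ ∷ u) xs⊆ with ∈.∈-∃++ (xs⊆ (here refl))
... | ps , qs , refl = subst (suc (length xs) ≤_) (sym (lengthʳ ps))
                             (s≤s (unique⊆⇒length≤ u xs⊆′))
  where
  lengthʳ : ∀ ps → length (ps ++ x ∷ qs) ≡ suc (length (ps ++ qs))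
  lengthʳ []       = refl
  lengthʳ (_ ∷ ps) = cong suc (lengthʳ ps)

  xs⊆′ : ∀ {y} → y ∈ xs → y ∈ ps ++ qs
  xs⊆′ y∈ with ∈.∈-++⁻ ps (xs⊆ (there y∈))
  ... | inj₁ y∈ps         = ∈.∈-++⁺ˡ y∈ps
  ... | inj₂ (here refl)  = contradiction refl (All.lookup x∉ y∈)
  ... | inj₂ (there y∈qs) = ∈.∈-++⁺ʳ ps y∈qs

∣∣-bijection : ∀ {P : Pred A 0ℓ} {Q : Pred B 0ℓ}
  (E : Enumeration (setoid A) P) (F : Enumeration (setoid B) Q) (f : A → B) →
  (∀ {x} → P x → Q (f x)) →
  (∀ {x y} → P x → P y → f x ≡ f y → x ≡ y) →
  (∀ {y} → Q y → ∃[ x ] P x × f x ≡ y) →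
  ∣ E ∣ ≡ ∣ F ∣
∣∣-bijection {P = P} E F f P⇒Q inj surj = trans (sym (List.length-map f (elements E))) (ℕ.≤-antisym
  (unique⊆⇒length≤ (unique-map (unique E) (sound E)) (λ y∈ → image⊆F (∈.∈-map⁻ f y∈)))
  (unique⊆⇒length≤ (unique F) (λ y∈ → F⊆image (surj (All.lookup (sound F) y∈)))))
  where
  unique-map : ∀ {xs} → Unique xs → All P xs → Unique (map f xs)
  unique-map []       []        = []
  unique-map {x ∷ xs} (x∉ ∷ u) (px ∷ pxs) =
    All.map⁺ (All.tabulate λ y∈ eq → All.lookup x∉ y∈ (inj px (All.lookup pxs y∈) eq)) ∷ unique-map u pxs

  image⊆F : ∀ {y} → ∃ (λ x → x ∈ elements E × y ≡ f x) → y ∈ elements F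
  image⊆F (x , x∈ , refl) = complete F (P⇒Q (All.lookup (sound E) x∈))

  F⊆image : ∀ {y} → ∃ (λ x → P x × f x ≡ y) → y ∈ map f (elements E)
  F⊆image (x , px , refl) = ∈.∈-map⁺ f (complete E px)

-- Sums over antidiagonals and compositions

∑ᵃ : ℕ → (ℕ → ℕ → ℤ) → ℤ
∑ᵃ zero    f = f 0 0
∑ᵃ (suc r) f = f 0 (suc r) ℤ.+ ∑ᵃ r (λ x y → f (suc x) y)

∑ᵃ-cong : ∀ r {f h : ℕ → ℕ → ℤ} → (∀ x y → f x y ≡ h x y) → ∑ᵃ r f ≡ ∑ᵃ r h
∑ᵃ-cong zero    eq = eq 0 0
∑ᵃ-cong (suc r) eq = cong₂ ℤ._+_ (eq 0 (suc r)) (∑ᵃ-cong r (λ x y → eq (suc x) y))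

∑ᵃ-+ : ∀ r (f h : ℕ → ℕ → ℤ) → ∑ᵃ r (λ x y → f x y ℤ.+ h x y) ≡ ∑ᵃ r f ℤ.+ ∑ᵃ r h
∑ᵃ-+ zero    f h = refl
∑ᵃ-+ (suc r) f h rewrite ∑ᵃ-+ r (λ x y → f (suc x) y) (λ x y → h (suc x) y) = +-interchange (f 0 (suc r)) _ _ _

∑ᵃ-neg : ∀ r (f : ℕ → ℕ → ℤ) → ∑ᵃ r (λ x y → ℤ.- f x y) ≡ ℤ.- ∑ᵃ r f
∑ᵃ-neg zero    f = refl
∑ᵃ-neg (suc r) f rewrite ∑ᵃ-neg r (λ x y → f (suc x) y) = sym (ℤ.neg-distrib-+ (f 0 (suc r)) _)

∑ᵃ-last : ∀ r (f : ℕ → ℕ → ℤ) → ∑ᵃ (suc r) f ≡ ∑ᵃ r (λ x y → f x (suc y)) ℤ.+ f (suc r) 0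
∑ᵃ-last zero    f = refl
∑ᵃ-last (suc r) f rewrite ∑ᵃ-last r (λ x y → f (suc x) y) = sym (ℤ.+-assoc (f 0 (suc (suc r))) _ _)

∑ᵃ-flip : ∀ r (f : ℕ → ℕ → ℤ) → ∑ᵃ r f ≡ ∑ᵃ r (flip f)
∑ᵃ-flip zero    f = refl
∑ᵃ-flip (suc r) f = begin
  f 0 (suc r) ℤ.+ ∑ᵃ r (λ x y → f (suc x) y)   ≡⟨ cong (λ s → f 0 (suc r) ℤ.+ s) (∑ᵃ-flip r (λ x y → f (suc x) y)) ⟩
  f 0 (suc r) ℤ.+ ∑ᵃ r (λ x y → f (suc y) x)   ≡⟨ ℤ.+-comm (f 0 (suc r)) _ ⟩
  ∑ᵃ r (λ x y → f (suc y) x) ℤ.+ f 0 (suc r)   ≡⟨ ∑ᵃ-last r (flip f) ⟨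
  ∑ᵃ (suc r) (flip f)                          ∎
  where open ≡-Reasoning

-- Both sides run over `x + y + z ≡ r`. Regrouping isolates the two parts that a reflection
-- exchanges.
∑ᵃ-assoc : ∀ r (f : ℕ → ℕ → ℕ → ℤ) →
           ∑ᵃ r (λ x s → ∑ᵃ s (f x)) ≡ ∑ᵃ r (λ s z → ∑ᵃ s (λ x y → f x y z))
∑ᵃ-assoc zero    f = refl
∑ᵃ-assoc (suc r) f = begin
  ∑ᵃ (suc r) (f 0) ℤ.+ ∑ᵃ r (λ x s → ∑ᵃ s (f (suc x)))
    ≡⟨ cong (λ s → ∑ᵃ (suc r) (f 0) ℤ.+ s) (∑ᵃ-assoc r (f ∘ suc)) ⟩
  (f 0 0 (suc r) ℤ.+ ∑ᵃ r (λ y z → f 0 (suc y) z)) ℤ.+ ∑ᵃ r (λ s z → ∑ᵃ s (λ x y → f (suc x) y z))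
    ≡⟨ ℤ.+-assoc (f 0 0 (suc r)) _ _ ⟩
  f 0 0 (suc r) ℤ.+ (∑ᵃ r (λ y z → f 0 (suc y) z) ℤ.+ ∑ᵃ r (λ s z → ∑ᵃ s (λ x y → f (suc x) y z)))
    ≡⟨ cong (λ s → f 0 0 (suc r) ℤ.+ s) (∑ᵃ-+ r (λ y z → f 0 (suc y) z) _) ⟨
  ∑ᵃ (suc r) (λ s z → ∑ᵃ s (λ x y → f x y z)) ∎
  where open ≡-Reasoning

x≡-x⇒x≡0 : ∀ (x : ℤ) → x ≡ ℤ.- x → x ≡ 0ℤ
x≡-x⇒x≡0 (+ zero)   _  = refl
x≡-x⇒x≡0 (+ suc n)  ()
x≡-x⇒x≡0 (-[1+ n ]) ()

∑ᵃ-antisymmetric : ∀ r (f : ℕ → ℕ → ℤ) → (∀ x y → f x y ≡ ℤ.- f y x) → ∑ᵃ r f ≡ 0ℤ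
∑ᵃ-antisymmetric r f anti = x≡-x⇒x≡0 _ (trans (∑ᵃ-flip r f)
  (trans (∑ᵃ-cong r (λ x y → anti y x)) (∑ᵃ-neg r f)))

-- Taking the threshold `k` off the first part leaves a full antidiagonal sum, antisymmetric in the
-- two remaining amounts, hence equal to its own negative. This is the cancellation across a wall,
-- with no pairing of individual walks.
∑ᵃ-cancel : ∀ k r (f : ℕ → ℕ → ℤ) → (∀ x y → f (k + x) y ≡ ℤ.- f (k + y) x) →
            ∑ᵃ r (λ x y → ⟦ k ℕ.≤? x ⟧ * f x y) ≡ 0ℤ
∑ᵃ-cancel zero    r       f anti =
  ∑ᵃ-antisymmetric r (λ x y → 1ℤ * f x y)
    (λ x y → trans (cong (1ℤ *_) (anti x y)) (sym (ℤ.neg-distribʳ-* 1ℤ (f y x))))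
∑ᵃ-cancel (suc k) zero    f anti = refl
∑ᵃ-cancel (suc k) (suc r) f anti =
  trans (ℤ.+-identityˡ _)
    (trans (∑ᵃ-cong r (λ x y → cong (_* f (suc x) y) (⟦⟧-cong (suc k ℕ.≤? suc x) (k ℕ.≤? x) ℕ.≤-pred s≤s)))
      (∑ᵃ-cancel k r (λ x y → f (suc x) y) anti))

sucHead : ∀ {d} → Vec ℕ (suc d) → Vec ℕ (suc d)
sucHead (x ∷ xs) = suc x ∷ xs

-- The split by whether the first part is zero or positive follows the recursion of `∑ᵃ`, so that
-- `∑-compositions-∷` is a plain induction.
compositions : ∀ d → ℕ → List (Vec ℕ d)
compositions zero    zero    = [] ∷ []
compositions zero    (suc r) = []
compositions (suc d) zero    = map (0 ∷_) (compositions d 0)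
compositions (suc d) (suc r) = map (0 ∷_) (compositions d (suc r)) ++ map sucHead (compositions (suc d) r)

∑-compositions-∷ : ∀ d r (f : Vec ℕ (suc d) → ℤ) →
  ∑ₗ (compositions (suc d) r) f ≡ ∑ᵃ r (λ x s → ∑ₗ (compositions d s) (λ xs → f (x ∷ xs)))
∑-compositions-∷ d zero    f = ∑ₗ-map (0 ∷_) (compositions d 0) f
∑-compositions-∷ d (suc r) f = begin
  ∑ₗ (map (0 ∷_) C ++ map sucHead C′) f
    ≡⟨ ∑ₗ-++ (map (0 ∷_) C) (map sucHead C′) f ⟩
  ∑ₗ (map (0 ∷_) C) f ℤ.+ ∑ₗ (map sucHead C′) f
    ≡⟨ cong₂ ℤ._+_ (∑ₗ-map (0 ∷_) C f) (∑ₗ-map sucHead C′ f) ⟩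
  ∑ₗ C (f ∘ (0 ∷_)) ℤ.+ ∑ₗ C′ (f ∘ sucHead)
    ≡⟨ cong (λ s → ∑ₗ C (f ∘ (0 ∷_)) ℤ.+ s) (∑-compositions-∷ d r (f ∘ sucHead)) ⟩
  ∑ᵃ (suc r) (λ x s → ∑ₗ (compositions d s) (λ xs → f (x ∷ xs))) ∎
  where
  open ≡-Reasoning
  C  = compositions d (suc r)
  C′ = compositions (suc d) r

∑-compositions-∷∷ : ∀ d r (f : Vec ℕ (suc (suc d)) → ℤ) →
  ∑ₗ (compositions (suc (suc d)) r) f ≡
  ∑ᵃ r (λ s t → ∑ᵃ s (λ x y → ∑ₗ (compositions d t) (λ zs → f (x ∷ y ∷ zs))))
∑-compositions-∷∷ d r f =
  trans (∑-compositions-∷ (suc d) r f)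
    (trans (∑ᵃ-cong r (λ x s → ∑-compositions-∷ d s (f ∘ (x ∷_))))
      (∑ᵃ-assoc r (λ x y t → ∑ₗ (compositions d t) (λ zs → f (x ∷ y ∷ zs)))))

sound-compositions : ∀ d r → All (λ x → sum x ≡ r) (compositions d r)
sound-compositions zero    zero    = refl ∷ []
sound-compositions zero    (suc r) = []
sound-compositions (suc d) zero    = All.map⁺ (sound-compositions d 0)
sound-compositions (suc d) (suc r) = All.++⁺ (All.map⁺ (sound-compositions d (suc r)))
  (All.map⁺ (All.map (λ { {x ∷ xs} eq → cong suc eq }) (sound-compositions (suc d) r)))

complete-compositions : ∀ d {r} (x : Vec ℕ d) → sum x ≡ r → x ∈ compositions d r
complete-compositions zero    []           refl = here refl
complete-compositions (suc d) {zero}  (zero ∷ xs)  eq = ∈.∈-map⁺ (0 ∷_) (complete-compositions d xs eq)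
complete-compositions (suc d) {suc r} (zero ∷ xs)  eq =
  ∈.∈-++⁺ˡ (∈.∈-map⁺ (0 ∷_) (complete-compositions d xs eq))
complete-compositions (suc d) {suc r} (suc x ∷ xs) eq =
  ∈.∈-++⁺ʳ (map (0 ∷_) (compositions d (suc r)))
    (∈.∈-map⁺ sucHead (complete-compositions (suc d) (x ∷ xs) (ℕ.suc-injective eq)))

unique-compositions : ∀ d r → Unique (compositions d r)
unique-compositions zero    zero    = [] ∷ []
unique-compositions zero    (suc r) = []
unique-compositions (suc d) zero    = Unique.map⁺ Vec.∷-injectiveʳ (unique-compositions d 0)
unique-compositions (suc d) (suc r) = Unique.++⁺
  (Unique.map⁺ Vec.∷-injectiveʳ (unique-compositions d (suc r)))
  (Unique.map⁺ sucHead-injective (unique-compositions (suc d) r))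
  disjoint
  where
  sucHead-injective : ∀ {x y : Vec ℕ (suc d)} → sucHead x ≡ sucHead y → x ≡ y
  sucHead-injective {x ∷ xs} {.x ∷ .xs} refl = refl

  disjoint : ∀ {v} → v ∈ map (0 ∷_) (compositions d (suc r)) × v ∈ map sucHead (compositions (suc d) r) → ⊥
  disjoint (v∈ˡ , v∈ʳ) with ∈.∈-map⁻ (0 ∷_) v∈ˡ | ∈.∈-map⁻ sucHead v∈ʳ
  ... | xs , _ , refl | (y ∷ ys) , _ , ()

enumerate-compositions : ∀ d r → Enumeration (setoid (Vec ℕ d)) (λ x → sum x ≡ r)
enumerate-compositions d r = record
  { elements = compositions d r
  ; unique   = unique-compositions d r
  ; sound    = sound-compositions d r
  ; complete = λ {x} eq → complete-compositions d x eq
  }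

-- The reflection of (a , b) is the transposition of the coordinates of c + (0,1,…,d-1).
Antisymmetric : ∀ {d} → (Vec ℤ d → ℤ) → Set
Antisymmetric {zero}        N = ⊤
Antisymmetric {suc zero}    N = ⊤
Antisymmetric {suc (suc d)} N =
  (∀ a b c → N (a ∷ b ∷ c) ≡ ℤ.- N ((b ℤ.+ 1ℤ) ∷ (a ℤ.- 1ℤ) ∷ c)) ×
  (∀ a → Antisymmetric (λ c → N (a ∷ c)))

antisymmetric-cong : ∀ {d} {N N′ : Vec ℤ d → ℤ} → (∀ c → N c ≡ N′ c) → Antisymmetric N → Antisymmetric N′
antisymmetric-cong {zero}        eq _ = tt
antisymmetric-cong {suc zero}    eq _ = tt
antisymmetric-cong {suc (suc d)} eq (sw , tl) =
  (λ a b c → trans (sym (eq _)) (trans (sw a b c) (cong ℤ.-_ (eq _)))) ,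
  (λ a → antisymmetric-cong (λ c → eq (a ∷ c)) (tl a))

antisymmetric-∑ᵃ : ∀ {d} r {N : ℕ → ℕ → Vec ℤ d → ℤ} → (∀ x y → Antisymmetric (N x y)) →
                   Antisymmetric (λ c → ∑ᵃ r (λ x y → N x y c))
antisymmetric-∑ᵃ {zero}        r anti = tt
antisymmetric-∑ᵃ {suc zero}    r anti = tt
antisymmetric-∑ᵃ {suc (suc d)} r anti =
  (λ a b c → trans (∑ᵃ-cong r (λ x y → proj₁ (anti x y) a b c)) (∑ᵃ-neg r _)) ,
  (λ a → antisymmetric-∑ᵃ r (λ x y → proj₂ (anti x y) a))

infixl 6 _⊕_ _⊖_
_⊕_ _⊖_ : ∀ {d} → Vec ℤ d → Vec ℕ d → Vec ℤ d
_⊕_ = zipWith (λ a x → a ℤ.+ + x)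
_⊖_ = zipWith (λ a x → a ℤ.- + x)

-- Exchanging two adjacent parts permutes the compositions, so summing over all steps of size `r`
-- commutes with every reflection. The function `e` is the inclusion for upward steps and its
-- negative for downward ones.
antisymmetric-shift : ∀ (e : ℕ → ℤ) {d} r {N : Vec ℤ d → ℤ} → Antisymmetric N →
  Antisymmetric (λ c → ∑ₗ (compositions d r) (λ x → N (zipWith (λ a x → a ℤ.+ e x) c x)))
antisymmetric-shift e {zero}        r anti = tt
antisymmetric-shift e {suc zero}    r anti = tt
antisymmetric-shift e {suc (suc d)} r {N} (sw , tl) = swap , λ a →
  antisymmetric-cong (λ c → sym (∑-compositions-∷ (suc d) r (λ x → N (shift (a ∷ c) x))))
    (antisymmetric-∑ᵃ r (λ x s → antisymmetric-shift e s (tl (a ℤ.+ e x))))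
  where
  open ≡-Reasoning

  shift : ∀ {k} → Vec ℤ k → Vec ℕ k → Vec ℤ k
  shift = zipWith (λ a x → a ℤ.+ e x)

  commute₁ : ∀ b z → (b ℤ.+ z) ℤ.+ 1ℤ ≡ (b ℤ.+ 1ℤ) ℤ.+ z
  commute₁ = ℤSolver.solve-∀
  commute₂ : ∀ a z → (a ℤ.+ z) ℤ.- 1ℤ ≡ (a ℤ.- 1ℤ) ℤ.+ z
  commute₂ = ℤSolver.solve-∀

  W : ℤ → ℤ → Vec ℤ d → ℕ → ℕ → ℕ → ℤ
  W a b c t x y = ∑ₗ (compositions d t) (λ zs → N ((a ℤ.+ e x) ∷ (b ℤ.+ e y) ∷ shift c zs))

  swapˢ : ∀ a b c t x y → W a b c t x y ≡ ℤ.- W (b ℤ.+ 1ℤ) (a ℤ.- 1ℤ) c t y x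
  swapˢ a b c t x y = trans (∑ₗ-cong (compositions d t) (λ zs → trans (sw _ _ _)
      (cong ℤ.-_ (cong₂ (λ u v → N (u ∷ v ∷ shift c zs)) (commute₁ b (e y)) (commute₂ a (e x))))))
    (∑ₗ-neg (compositions d t) _)

  swap : ∀ a b c → ∑ₗ (compositions (2 + d) r) (λ x → N (shift (a ∷ b ∷ c) x)) ≡
         ℤ.- ∑ₗ (compositions (2 + d) r) (λ x → N (shift ((b ℤ.+ 1ℤ) ∷ (a ℤ.- 1ℤ) ∷ c) x))
  swap a b c = begin
    ∑ₗ (compositions (2 + d) r) (λ x → N (shift (a ∷ b ∷ c) x))
      ≡⟨ ∑-compositions-∷∷ d r _ ⟩
    ∑ᵃ r (λ s t → ∑ᵃ s (W a b c t))
      ≡⟨ ∑ᵃ-cong r (λ s t → trans (∑ᵃ-cong s (swapˢ a b c t)) (trans (∑ᵃ-neg s _) (cong ℤ.-_ (sym (∑ᵃ-flip s _))))) ⟩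
    ∑ᵃ r (λ s t → ℤ.- ∑ᵃ s (W (b ℤ.+ 1ℤ) (a ℤ.- 1ℤ) c t))
      ≡⟨ ∑ᵃ-neg r _ ⟩
    ℤ.- ∑ᵃ r (λ s t → ∑ᵃ s (W (b ℤ.+ 1ℤ) (a ℤ.- 1ℤ) c t))
      ≡⟨ cong ℤ.-_ (∑-compositions-∷∷ d r _) ⟨
    ℤ.- ∑ₗ (compositions (2 + d) r) (λ x → N (shift ((b ℤ.+ 1ℤ) ∷ (a ℤ.- 1ℤ) ∷ c) x)) ∎

-- Cancellation of the steps that are not horizontal strips.

Increasing : ∀ {d} → Vec ℤ d → Set
Increasing []          = ⊤
Increasing (a ∷ [])    = ⊤
Increasing (a ∷ b ∷ c) = a ℤ.≤ b × Increasing (b ∷ c)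

-- For increasing c, c ⊕ x / c and c / (c ⊖ x) are horizontal strips, the bottom
-- row being listed first.
StripUp : ∀ {d} → Vec ℤ d → Vec ℕ d → Set
StripUp []          []       = ⊤
StripUp (a ∷ [])    (x ∷ []) = ⊤
StripUp (a ∷ b ∷ c) (x ∷ xs) = (a ℤ.+ + x) ℤ.≤ b × StripUp (b ∷ c) xs

stripUp? : ∀ {d} (c : Vec ℤ d) x → Dec (StripUp c x)
stripUp? []          []       = yes tt
stripUp? (a ∷ [])    (x ∷ []) = yes tt
stripUp? (a ∷ b ∷ c) (x ∷ xs) = ((a ℤ.+ + x) ℤ.≤? b) ×-dec stripUp? (b ∷ c) xs

StripDownFrom : ∀ {d} → ℤ → Vec ℤ d → Vec ℕ d → Set
StripDownFrom a []      []       = ⊤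
StripDownFrom a (b ∷ c) (y ∷ ys) = (a ℤ.+ + y) ℤ.≤ b × StripDownFrom b c ys

stripDownFrom? : ∀ {d} a (c : Vec ℤ d) x → Dec (StripDownFrom a c x)
stripDownFrom? a []      []       = yes tt
stripDownFrom? a (b ∷ c) (y ∷ ys) = ((a ℤ.+ + y) ℤ.≤? b) ×-dec stripDownFrom? b c ys

StripDown : ∀ {d} → Vec ℤ d → Vec ℕ d → Set
StripDown []      []       = ⊤
StripDown (a ∷ c) (x ∷ xs) = StripDownFrom a c xs

stripDown? : ∀ {d} (c : Vec ℤ d) x → Dec (StripDown c x)
stripDown? []      []       = yes tt
stripDown? (a ∷ c) (x ∷ xs) = stripDownFrom? a c xs

⟦⟧-split : {P Q : Set} (P? : Dec P) (Q? : Dec Q) → (¬ P → Q) → (P → ¬ Q) →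
           ∀ t → t ≡ ⟦ P? ⟧ * t ℤ.+ ⟦ Q? ⟧ * t
⟦⟧-split (yes p) (yes q) _ f t = contradiction q (f p)
⟦⟧-split (yes p) (no ¬q) _ _ t = sym (trans (ℤ.+-identityʳ _) (ℤ.*-identityˡ t))
⟦⟧-split (no ¬p) (yes q) _ _ t = sym (trans (ℤ.+-identityˡ _) (ℤ.*-identityˡ t))
⟦⟧-split (no ¬p) (no ¬q) f _ t = contradiction (f ¬p) ¬q

private
  gap : ∀ {a b} → a ℤ.≤ b → ∃[ k ] b ≡ a ℤ.+ + k
  gap {a} {b} a≤b = ℤ.∣ b ℤ.- a ∣ ,
    trans (sym (lemma a b)) (cong (λ z → a ℤ.+ z) (sym (ℤ.0≤i⇒+∣i∣≡i (ℤ.i≤j⇒0≤j-i a≤b))))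
    where
    lemma : ∀ a b → a ℤ.+ (b ℤ.- a) ≡ b
    lemma = ℤSolver.solve-∀

-- If `b` is `a + k`, the amounts past the wall are those from `k + 1` on, and the hypothesis on `f`
-- is what `∑ᵃ-cancel` asks for at that threshold.
∑ᵃ-cut : ∀ a b → a ℤ.≤ b → ∀ s (f : ℕ → ℕ → ℤ) →
  (∀ k → b ≡ a ℤ.+ + k → ∀ x y → f (suc k + x) y ≡ ℤ.- f (suc k + y) x) →
  ∑ᵃ s f ≡ ∑ᵃ s (λ x y → ⟦ (a ℤ.+ + x) ℤ.≤? b ⟧ * f x y)
∑ᵃ-cut a b a≤b s f reflect with gap a≤b
... | k , refl = begin
  ∑ᵃ s f
    ≡⟨ ∑ᵃ-cong s (λ x y → ⟦⟧-split ((a ℤ.+ + x) ℤ.≤? (a ℤ.+ + k)) (suc k ℕ.≤? x) (high x) (low x) (f x y)) ⟩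
  ∑ᵃ s (λ x y → ⟦ (a ℤ.+ + x) ℤ.≤? (a ℤ.+ + k) ⟧ * f x y ℤ.+ ⟦ suc k ℕ.≤? x ⟧ * f x y)
    ≡⟨ ∑ᵃ-+ s (λ x y → ⟦ (a ℤ.+ + x) ℤ.≤? (a ℤ.+ + k) ⟧ * f x y) (λ x y → ⟦ suc k ℕ.≤? x ⟧ * f x y) ⟩
  ∑ᵃ s (λ x y → ⟦ (a ℤ.+ + x) ℤ.≤? (a ℤ.+ + k) ⟧ * f x y) ℤ.+ ∑ᵃ s (λ x y → ⟦ suc k ℕ.≤? x ⟧ * f x y)
    ≡⟨ cong (λ z → ∑ᵃ s (λ x y → ⟦ (a ℤ.+ + x) ℤ.≤? (a ℤ.+ + k) ⟧ * f x y) ℤ.+ z) (∑ᵃ-cancel (suc k) s f (reflect k refl)) ⟩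
  ∑ᵃ s (λ x y → ⟦ (a ℤ.+ + x) ℤ.≤? (a ℤ.+ + k) ⟧ * f x y) ℤ.+ 0ℤ
    ≡⟨ ℤ.+-identityʳ _ ⟩
  ∑ᵃ s (λ x y → ⟦ (a ℤ.+ + x) ℤ.≤? (a ℤ.+ + k) ⟧ * f x y) ∎
  where
  open ≡-Reasoning

  high : ∀ x → ¬ ((a ℤ.+ + x) ℤ.≤ (a ℤ.+ + k)) → suc k ≤ x
  high x ¬low = ℕ.≰⇒> (λ x≤k → ¬low (ℤ.+-monoʳ-≤ a (ℤ.+≤+ x≤k)))

  low : ∀ x → (a ℤ.+ + x) ℤ.≤ (a ℤ.+ + k) → ¬ (suc k ≤ x)
  low x a+x≤b k<x = ℤ.<⇒≱ (ℤ.+-monoʳ-< a (ℤ.+<+ k<x)) a+x≤b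

-- The reflection of the first two coordinates cancels the terms with a + x > b.
stripUp-sum : ∀ {d} r {N : Vec ℤ d → ℤ} → Antisymmetric N → ∀ c → Increasing c →
  ∑ₗ (compositions d r) (λ x → N (c ⊕ x)) ≡ ∑ₗ (compositions d r) (λ x → ⟦ stripUp? c x ⟧ * N (c ⊕ x))
stripUp-sum {zero}     r anti [] _ = ∑ₗ-cong (compositions 0 r) (λ { [] → sym (ℤ.*-identityˡ _) })
stripUp-sum {suc zero} r anti (a ∷ []) _ = ∑ₗ-cong (compositions 1 r) (λ { (x ∷ []) → sym (ℤ.*-identityˡ _) })
stripUp-sum {suc (suc d)} r {N} anti@(swap , tail) (a ∷ b ∷ c) (a≤b , inc) = begin
  ∑ₗ (compositions (2 + d) r) (λ x → N ((a ∷ b ∷ c) ⊕ x))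
    ≡⟨ ∑-compositions-∷∷ d r _ ⟩
  ∑ᵃ r (λ s t → ∑ᵃ s (W t))
    -- The lowest wall is treated first. Its condition leaves `y` free, whereas the next wall
    -- restricts `y` and would destroy the symmetry between the two amounts.
    ≡⟨ ∑ᵃ-cong r (λ s t → ∑ᵃ-cut a b a≤b s (W t) (reflect t)) ⟩
  ∑ᵃ r (λ s t → ∑ᵃ s (λ x y → ⟦ low? x ⟧ * W t x y))
    ≡⟨ ∑ᵃ-cong r (λ s t → ∑ᵃ-cong s (λ x y → ∑ₗ-*ˡ (compositions d t) ⟦ low? x ⟧ _)) ⟨
  ∑ᵃ r (λ s t → ∑ᵃ s (λ x y → ∑ₗ (compositions d t) (λ zs → ⟦ low? x ⟧ * N ((a ∷ b ∷ c) ⊕ (x ∷ y ∷ zs)))))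
    ≡⟨ ∑ᵃ-assoc r (λ x y t → ∑ₗ (compositions d t) (λ zs → ⟦ low? x ⟧ * N ((a ∷ b ∷ c) ⊕ (x ∷ y ∷ zs)))) ⟨
  ∑ᵃ r (λ x s → ∑ᵃ s (λ y t → ∑ₗ (compositions d t) (λ zs → ⟦ low? x ⟧ * N ((a ∷ b ∷ c) ⊕ (x ∷ y ∷ zs)))))
    ≡⟨ ∑ᵃ-cong r (λ x s → ∑-compositions-∷ d s _) ⟨
  ∑ᵃ r (λ x s → ∑ₗ (compositions (suc d) s) (λ xs → ⟦ low? x ⟧ * N ((a ∷ b ∷ c) ⊕ (x ∷ xs))))
    ≡⟨ ∑ᵃ-cong r (λ x s → trans (∑ₗ-*ˡ (compositions (suc d) s) ⟦ low? x ⟧ _)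
         (trans (cong (⟦ low? x ⟧ *_) (stripUp-sum s (tail (a ℤ.+ + x)) (b ∷ c) inc))
         (trans (sym (∑ₗ-*ˡ (compositions (suc d) s) ⟦ low? x ⟧ _))
         (∑ₗ-cong (compositions (suc d) s) (λ xs → trans (sym (ℤ.*-assoc ⟦ low? x ⟧ _ _))
           (cong (_* N ((a ∷ b ∷ c) ⊕ (x ∷ xs))) (sym (⟦⟧-× (low? x) (stripUp? (b ∷ c) xs)))))))))  ⟩
  ∑ᵃ r (λ x s → ∑ₗ (compositions (suc d) s) (λ xs → ⟦ stripUp? (a ∷ b ∷ c) (x ∷ xs) ⟧ * N ((a ∷ b ∷ c) ⊕ (x ∷ xs))))
    ≡⟨ ∑-compositions-∷ (suc d) r _ ⟨
  ∑ₗ (compositions (2 + d) r) (λ x → ⟦ stripUp? (a ∷ b ∷ c) x ⟧ * N ((a ∷ b ∷ c) ⊕ x)) ∎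
  where
  open ≡-Reasoning

  W : ℕ → ℕ → ℕ → ℤ
  W t x y = ∑ₗ (compositions d t) (λ zs → N ((a ∷ b ∷ c) ⊕ (x ∷ y ∷ zs)))

  low? : ∀ x → Dec ((a ℤ.+ + x) ℤ.≤ b)
  low? x = (a ℤ.+ + x) ℤ.≤? b

  -- Since `b` is `a + k`, the reflection takes the pair `a + (k + 1 + x)`, `b + y` to
  -- `a + (k + 1 + y)`, `b + x`: the excess over the wall and the second amount trade places.
  reflect : ∀ t k → b ≡ a ℤ.+ + k → ∀ x y → W t (suc k + x) y ≡ ℤ.- W t (suc k + y) x
  reflect t k b≡ x y = trans (∑ₗ-cong (compositions d t) (λ zs → trans (swap _ _ _)
      (cong ℤ.-_ (cong₂ (λ u v → N (u ∷ v ∷ (c ⊕ zs))) (e₁ a b (+ k) (+ y) b≡) (e₂ a b (+ k) (+ x) b≡)))))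
    (∑ₗ-neg (compositions d t) _)
    where
    e₁ : ∀ a b k y → b ≡ a ℤ.+ k → b ℤ.+ y ℤ.+ 1ℤ ≡ a ℤ.+ (1ℤ ℤ.+ (k ℤ.+ y))
    e₁ a _ k y refl = lemma a k y
      where
      lemma : ∀ a k y → a ℤ.+ k ℤ.+ y ℤ.+ 1ℤ ≡ a ℤ.+ (1ℤ ℤ.+ (k ℤ.+ y))
      lemma = ℤSolver.solve-∀
    e₂ : ∀ a b k x → b ≡ a ℤ.+ k → a ℤ.+ (1ℤ ℤ.+ (k ℤ.+ x)) ℤ.- 1ℤ ≡ b ℤ.+ x
    e₂ a _ k x refl = lemma a k x
      where
      lemma : ∀ a k x → a ℤ.+ (1ℤ ℤ.+ (k ℤ.+ x)) ℤ.- 1ℤ ≡ a ℤ.+ k ℤ.+ x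
      lemma = ℤSolver.solve-∀

-- The walls are taken in the opposite order to `stripUp-sum`. The conditions at the higher walls
-- involve `b` but not the amount `y` removed from it, so they can be imposed first by recursion,
-- and `x` and `y` may still be exchanged at the lowest wall.
stripDown-sum : ∀ {d} r {N : Vec ℤ d → ℤ} → Antisymmetric N → ∀ c → Increasing c →
  ∑ₗ (compositions d r) (λ x → N (c ⊖ x)) ≡ ∑ₗ (compositions d r) (λ x → ⟦ stripDown? c x ⟧ * N (c ⊖ x))
stripDown-sum {zero}     r anti [] _ = ∑ₗ-cong (compositions 0 r) (λ { [] → sym (ℤ.*-identityˡ _) })
stripDown-sum {suc zero} r anti (a ∷ []) _ = ∑ₗ-cong (compositions 1 r) (λ { (x ∷ []) → sym (ℤ.*-identityˡ _) })
stripDown-sum {suc (suc d)} r {N} anti@(swap , tail) (a ∷ b ∷ c) (a≤b , inc) = begin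
  ∑ₗ (compositions (2 + d) r) (λ x → N ((a ∷ b ∷ c) ⊖ x))
    ≡⟨ ∑-compositions-∷ (suc d) r _ ⟩
  ∑ᵃ r (λ x s → ∑ₗ (compositions (suc d) s) (λ xs → N ((a ∷ b ∷ c) ⊖ (x ∷ xs))))
    ≡⟨ ∑ᵃ-cong r (λ x s → stripDown-sum s (tail (a ℤ.- + x)) (b ∷ c) inc) ⟩
  ∑ᵃ r (λ x s → ∑ₗ (compositions (suc d) s) (λ xs → ⟦ stripDown? (b ∷ c) xs ⟧ * N ((a ∷ b ∷ c) ⊖ (x ∷ xs))))
    ≡⟨ ∑ᵃ-cong r (λ x s → ∑-compositions-∷ d s _) ⟩
  ∑ᵃ r (λ x s → ∑ᵃ s (λ y t → W t x y))
    ≡⟨ ∑ᵃ-assoc r (λ x y t → W t x y) ⟩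
  ∑ᵃ r (λ s t → ∑ᵃ s (W t))
    -- In a downward step it is the second amount that causes the crossing, so the antidiagonal is
    -- read backwards for the cut.
    ≡⟨ ∑ᵃ-cong r (λ s t → trans (∑ᵃ-flip s (W t)) (trans (∑ᵃ-cut a b a≤b s (flip (W t)) (reflect t)) (∑ᵃ-flip s _))) ⟩
  ∑ᵃ r (λ s t → ∑ᵃ s (λ x y → ⟦ low? y ⟧ * W t x y))
    ≡⟨ ∑ᵃ-cong r (λ s t → ∑ᵃ-cong s (λ x y → trans (sym (∑ₗ-*ˡ (compositions d t) ⟦ low? y ⟧ _))
         (∑ₗ-cong (compositions d t) (λ zs → trans (sym (ℤ.*-assoc ⟦ low? y ⟧ _ _))
           (cong (_* N ((a ∷ b ∷ c) ⊖ (x ∷ y ∷ zs))) (sym (⟦⟧-× (low? y) (stripDownFrom? b c zs)))))))) ⟩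
  ∑ᵃ r (λ s t → ∑ᵃ s (λ x y → ∑ₗ (compositions d t)
    (λ zs → ⟦ stripDown? (a ∷ b ∷ c) (x ∷ y ∷ zs) ⟧ * N ((a ∷ b ∷ c) ⊖ (x ∷ y ∷ zs)))))
    ≡⟨ ∑-compositions-∷∷ d r _ ⟨
  ∑ₗ (compositions (2 + d) r) (λ x → ⟦ stripDown? (a ∷ b ∷ c) x ⟧ * N ((a ∷ b ∷ c) ⊖ x)) ∎
  where
  open ≡-Reasoning

  W : ℕ → ℕ → ℕ → ℤ
  W t x y = ∑ₗ (compositions d t) (λ zs → ⟦ stripDownFrom? b c zs ⟧ * N ((a ∷ b ∷ c) ⊖ (x ∷ y ∷ zs)))

  low? : ∀ y → Dec ((a ℤ.+ + y) ℤ.≤ b)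
  low? y = (a ℤ.+ + y) ℤ.≤? b

  reflect : ∀ t k → b ≡ a ℤ.+ + k → ∀ x y → W t y (suc k + x) ≡ ℤ.- W t x (suc k + y)
  reflect t k b≡ x y = trans (∑ₗ-cong (compositions d t) (λ zs → trans
      (cong (⟦ stripDownFrom? b c zs ⟧ *_) (trans (swap _ _ _)
        (cong ℤ.-_ (cong₂ (λ u v → N (u ∷ v ∷ (c ⊖ zs))) (e₁ a b (+ k) (+ x) b≡) (e₂ a b (+ k) (+ y) b≡)))))
      (sym (ℤ.neg-distribʳ-* ⟦ stripDownFrom? b c zs ⟧ _))))
    (∑ₗ-neg (compositions d t) _)
    where
    e₁ : ∀ a b k x → b ≡ a ℤ.+ k → b ℤ.- (1ℤ ℤ.+ (k ℤ.+ x)) ℤ.+ 1ℤ ≡ a ℤ.- x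
    e₁ a _ k x refl = lemma a k x
      where
      lemma : ∀ a k x → a ℤ.+ k ℤ.- (1ℤ ℤ.+ (k ℤ.+ x)) ℤ.+ 1ℤ ≡ a ℤ.- x
      lemma = ℤSolver.solve-∀
    e₂ : ∀ a b k y → b ≡ a ℤ.+ k → a ℤ.- y ℤ.- 1ℤ ≡ b ℤ.- (1ℤ ℤ.+ (k ℤ.+ y))
    e₂ a _ k y refl = lemma a k y
      where
      lemma : ∀ a k y → a ℤ.- y ℤ.- 1ℤ ≡ a ℤ.+ k ℤ.- (1ℤ ℤ.+ (k ℤ.+ y))
      lemma = ℤSolver.solve-∀

-- The alternating sum over permutations

reflectAt : ∀ {d} → Fin d → Vec ℤ (suc d) → Vec ℤ (suc d)
reflectAt zero    (a ∷ b ∷ c) = (b ℤ.+ 1ℤ) ∷ (a ℤ.- 1ℤ) ∷ c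
reflectAt (suc i) (a ∷ c)     = a ∷ reflectAt i c

reflectAt⇒antisymmetric : ∀ {d} {N : Vec ℤ (suc d) → ℤ} → (∀ i c → N c ≡ ℤ.- N (reflectAt i c)) → Antisymmetric N
reflectAt⇒antisymmetric {zero}  anti = tt
reflectAt⇒antisymmetric {suc d} anti =
  (λ a b c → anti zero (a ∷ b ∷ c)) , (λ a → reflectAt⇒antisymmetric (λ i c → anti (suc i) (a ∷ c)))

swapAt : ∀ {d} → Fin d → Fin (suc d) → Fin (suc d)
swapAt zero    zero          = suc zero
swapAt zero    (suc zero)    = zero
swapAt zero    (suc (suc k)) = suc (suc k)
swapAt (suc i) zero          = zero
swapAt (suc i) (suc k)       = suc (swapAt i k)

swapAt-involutive : ∀ {d} (i : Fin d) k → swapAt i (swapAt i k) ≡ k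
swapAt-involutive zero    zero          = refl
swapAt-involutive zero    (suc zero)    = refl
swapAt-involutive zero    (suc (suc k)) = refl
swapAt-involutive (suc i) zero          = refl
swapAt-involutive (suc i) (suc k)       = cong suc (swapAt-involutive i k)

swapₚ : ∀ {d} → Fin d → Permutation′ (suc d)
swapₚ i = Perm.permutation (swapAt i) (swapAt i) (swapAt-involutive i) (swapAt-involutive i)

lookup-reflectAt : ∀ {d} (i : Fin d) c k →
  lookup (reflectAt i c) k ℤ.+ + toℕ k ≡ lookup c (swapAt i k) ℤ.+ + toℕ (swapAt i k)
lookup-reflectAt zero    (a ∷ b ∷ c) zero          = trans (ℤ.+-identityʳ _) refl
lookup-reflectAt zero    (a ∷ b ∷ c) (suc zero)    = lemma a
  where
  lemma : ∀ a → a ℤ.- 1ℤ ℤ.+ 1ℤ ≡ a ℤ.+ 0ℤ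
  lemma = ℤSolver.solve-∀
lookup-reflectAt zero    (a ∷ b ∷ c) (suc (suc k)) = refl
lookup-reflectAt (suc i) (a ∷ c)     zero          = refl
lookup-reflectAt (suc i) (a ∷ c)     (suc k)       =
  trans (shift (lookup (reflectAt i c) k) (+ toℕ k))
    (trans (cong (λ z → 1ℤ ℤ.+ z) (lookup-reflectAt i c k)) (sym (shift (lookup c (swapAt i k)) (+ toℕ (swapAt i k)))))
  where
  shift : ∀ x k → x ℤ.+ (1ℤ ℤ.+ k) ≡ 1ℤ ℤ.+ (x ℤ.+ k)
  shift = ℤSolver.solve-∀

iverson : ∀ {P : Set} → Dec P → ℕ
iverson P? = if does P? then 1 else 0

+iverson : ∀ {P : Set} (P? : Dec P) → + iverson P? ≡ ⟦ P? ⟧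
+iverson (yes _) = refl
+iverson (no _)  = refl

iverson-true : ∀ {P : Set} (P? : Dec P) → P → iverson P? ≡ 1
iverson-true P? p rewrite dec-true P? p = refl

iverson-false : ∀ {P : Set} (P? : Dec P) → ¬ P → iverson P? ≡ 0
iverson-false P? ¬p rewrite dec-false P? ¬p = refl

countBelow : ∀ {d} → ℕ → (Fin d → ℕ) → ℕ
countBelow {zero}  x p = 0
countBelow {suc d} x p = iverson (p zero ℕ.<? x) + countBelow x (p ∘ suc)

-- Inversions grouped by their left end, in place of the filtered list of pairs behind `sgn`. In
-- this form an adjacent exchange can be followed by recursion on the position.
inv : ∀ {d} → (Fin d → ℕ) → ℕ
inv {zero}  p = 0
inv {suc d} p = countBelow (p zero) (p ∘ suc) + inv (p ∘ suc)

countBelow-cong : ∀ {d} x {p q : Fin d → ℕ} → (∀ i → p i ≡ q i) → countBelow x p ≡ countBelow x q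
countBelow-cong {zero}  x eq = refl
countBelow-cong {suc d} x eq =
  cong₂ _+_ (cong (λ z → iverson (z ℕ.<? x)) (eq zero)) (countBelow-cong x (eq ∘ suc))

inv-cong : ∀ {d} {p q : Fin d → ℕ} → (∀ i → p i ≡ q i) → inv p ≡ inv q
inv-cong {zero}  eq = refl
inv-cong {suc d} {p} {q} eq = cong₂ _+_
  (trans (countBelow-cong (p zero) (eq ∘ suc)) (cong (λ x → countBelow x (q ∘ suc)) (eq zero)))
  (inv-cong (eq ∘ suc))

countBelow-swapAt : ∀ {d} x (p : Fin (suc d) → ℕ) i → countBelow x (p ∘ swapAt i) ≡ countBelow x p
countBelow-swapAt x p zero    = lemma (iverson (p (suc zero) ℕ.<? x)) (iverson (p zero ℕ.<? x)) _
  where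
  lemma : ∀ a b c → a + (b + c) ≡ b + (a + c)
  lemma = ℕSolver.solve-∀
countBelow-swapAt x p (suc i) = cong (λ z → iverson (p zero ℕ.<? x) + z) (countBelow-swapAt x (p ∘ suc) i)

sign : ℕ → ℤ
sign k = -1ℤ ℤ.^ k

sign-suc : ∀ k → sign (suc k) ≡ ℤ.- sign k
sign-suc k = ℤ.-1*i≡-i (sign k)

-- For the first two positions, the counts against all later positions merely trade places, and the
-- comparison of the two values themselves is the one that changes; injectivity excludes a tie.
-- Deeper exchanges leave the count of the first value alone, by `countBelow-swapAt`.
inv-swapAt : ∀ {d} (p : Fin (suc d) → ℕ) (i : Fin d) → (∀ {j k} → p j ≡ p k → j ≡ k) →
             sign (inv (p ∘ swapAt i)) ≡ ℤ.- sign (inv p)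
inv-swapAt {suc d} p zero inj with ℕ.<-cmp (p zero) (p (suc zero))
... | tri< lt _ gt = begin
  sign (inv (p ∘ swapAt zero))
    ≡⟨ cong sign (trans (cong (λ z → (z + X) + (Y + Z)) (iverson-true (p zero ℕ.<? p (suc zero)) lt)) (cong suc (trans (lemma X Y Z)
         (cong (λ z → (z + Y) + (X + Z)) (sym (iverson-false (p (suc zero) ℕ.<? p zero) gt)))))) ⟩
  sign (suc (inv p))
    ≡⟨ sign-suc (inv p) ⟩
  ℤ.- sign (inv p) ∎
  where
  open ≡-Reasoning
  q : Fin d → ℕ
  q k = p (suc (suc k))
  X = countBelow (p (suc zero)) q
  Y = countBelow (p zero) q
  Z = inv q
  lemma : ∀ x y z → x + (y + z) ≡ (0 + y) + (x + z)
  lemma = ℕSolver.solve-∀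
... | tri≈ _ eq _ = case inj eq of λ ()
... | tri> lt _ gt = begin
  sign (inv (p ∘ swapAt zero))
    ≡⟨ cong sign (trans (cong (λ z → (z + X) + (Y + Z)) (iverson-false (p zero ℕ.<? p (suc zero)) lt)) (lemma X Y Z)) ⟩
  sign (Y + (X + Z))
    ≡⟨ ℤ.neg-involutive _ ⟨
  ℤ.- (ℤ.- sign (Y + (X + Z)))
    ≡⟨ cong ℤ.-_ (sign-suc (Y + (X + Z))) ⟨
  ℤ.- sign ((1 + Y) + (X + Z))
    ≡⟨ cong (λ z → ℤ.- sign ((z + Y) + (X + Z))) (iverson-true (p (suc zero) ℕ.<? p zero) gt) ⟨
  ℤ.- sign (inv p) ∎
  where
  open ≡-Reasoning
  q : Fin d → ℕ
  q k = p (suc (suc k))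
  X = countBelow (p (suc zero)) q
  Y = countBelow (p zero) q
  Z = inv q
  lemma : ∀ x y z → (0 + x) + (y + z) ≡ y + (x + z)
  lemma = ℕSolver.solve-∀
inv-swapAt {suc d} p (suc i) inj = begin
  sign (countBelow (p zero) (p ∘ suc ∘ swapAt i) + inv (p ∘ suc ∘ swapAt i))
    ≡⟨ cong (λ z → sign (z + inv (p ∘ suc ∘ swapAt i))) (countBelow-swapAt (p zero) (p ∘ suc) i) ⟩
  sign (X + inv (p ∘ suc ∘ swapAt i))
    ≡⟨ ℤ.^-distribˡ-+-* -1ℤ X _ ⟩
  sign X * sign (inv (p ∘ suc ∘ swapAt i))
    ≡⟨ cong (sign X *_) (inv-swapAt (p ∘ suc) i (λ eq → Fin.suc-injective (inj eq))) ⟩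
  sign X * (ℤ.- sign (inv (p ∘ suc)))
    ≡⟨ ℤ.neg-distribʳ-* (sign X) _ ⟨
  ℤ.- (sign X * sign (inv (p ∘ suc)))
    ≡⟨ cong ℤ.-_ (ℤ.^-distribˡ-+-* -1ℤ X _) ⟨
  ℤ.- sign (inv p) ∎
  where
  open ≡-Reasoning
  X = countBelow (p zero) (p ∘ suc)

inv-monotone : ∀ {d} (p : Fin d → ℕ) → (∀ {i j} → i Fin.< j → p i ≤ p j) → inv p ≡ 0
inv-monotone {zero}  p mono = refl
inv-monotone {suc d} p mono =
  cong₂ _+_ (none (p ∘ suc) (λ j → mono {zero} {suc j} z<s)) (inv-monotone (p ∘ suc) (λ i<j → mono (s<s i<j)))
  where
  none : ∀ {d x} (q : Fin d → ℕ) → (∀ j → x ≤ q j) → countBelow x q ≡ 0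
  none {zero}      q x≤ = refl
  none {suc d} {x} q x≤ rewrite dec-false (q zero ℕ.<? x) (ℕ.≤⇒≯ (x≤ zero)) = none (q ∘ suc) (x≤ ∘ suc)

∑-allFin : ∀ {d} (f : Fin (suc d) → ℤ) → ∑ₗ (allFin (suc d)) f ≡ f zero ℤ.+ ∑ₗ (allFin d) (f ∘ suc)
∑-allFin {d} f = cong (λ s → f zero ℤ.+ s)
  (trans (cong (λ xs → ∑ₗ xs f) (sym (List.map-tabulate id suc))) (∑ₗ-map suc (allFin d) f))

+countBelow : ∀ {d} x (p : Fin d → ℕ) → + countBelow x p ≡ ∑ₗ (allFin d) (λ j → ⟦ p j ℕ.<? x ⟧)
+countBelow {zero}  x p = refl
+countBelow {suc d} x p = trans (ℤ.pos-+ (iverson (p zero ℕ.<? x)) _)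
  (trans (cong₂ ℤ._+_ (+iverson (p zero ℕ.<? x)) (+countBelow x (p ∘ suc)))
    (sym (∑-allFin (λ j → ⟦ p j ℕ.<? x ⟧))))

+inv : ∀ {d} (p : Fin d → ℕ) →
  + inv p ≡ ∑ₗ (allFin d) (λ i → ∑ₗ (allFin d) (λ j → ⟦ (i Fin.<? j) ×-dec (p j ℕ.<? p i) ⟧))
+inv {zero}  p = refl
+inv {suc d} p = begin
  + (countBelow (p zero) (p ∘ suc) + inv (p ∘ suc))
    ≡⟨ ℤ.pos-+ (countBelow (p zero) (p ∘ suc)) _ ⟩
  + countBelow (p zero) (p ∘ suc) ℤ.+ + inv (p ∘ suc)
    ≡⟨ cong₂ ℤ._+_ row₀ (trans (+inv (p ∘ suc)) (∑ₗ-cong (allFin d) row)) ⟩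
  ∑ₗ (allFin (suc d)) (entry zero) ℤ.+ ∑ₗ (allFin d) (λ i → ∑ₗ (allFin (suc d)) (entry (suc i)))
    ≡⟨ ∑-allFin (λ i → ∑ₗ (allFin (suc d)) (entry i)) ⟨
  ∑ₗ (allFin (suc d)) (λ i → ∑ₗ (allFin (suc d)) (entry i)) ∎
  where
  open ≡-Reasoning
  inverted? : ∀ {k} (q : Fin k → ℕ) (i j : Fin k) → Dec (i Fin.< j × q j < q i)
  inverted? q i j = (i Fin.<? j) ×-dec (q j ℕ.<? q i)

  entry : Fin (suc d) → Fin (suc d) → ℤ
  entry i j = ⟦ inverted? p i j ⟧

  never : ∀ i → entry i zero ≡ 0ℤ
  never i rewrite dec-false (inverted? p i zero) (λ { (() , _) }) = refl

  row₀ : + countBelow (p zero) (p ∘ suc) ≡ ∑ₗ (allFin (suc d)) (entry zero)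
  row₀ = trans (+countBelow (p zero) (p ∘ suc)) (trans
    (∑ₗ-cong (allFin d) (λ j → ⟦⟧-cong (p (suc j) ℕ.<? p zero) (inverted? p zero (suc j)) (λ lt → z<s , lt) proj₂))
    (sym (trans (∑-allFin (entry zero)) (trans (cong (ℤ._+ ∑ₗ (allFin d) (entry zero ∘ suc)) (never zero)) (ℤ.+-identityˡ _)))))

  row : ∀ i → ∑ₗ (allFin d) (λ j → ⟦ inverted? (p ∘ suc) i j ⟧) ≡ ∑ₗ (allFin (suc d)) (entry (suc i))
  row i = trans
    (∑ₗ-cong (allFin d) (λ j → ⟦⟧-cong (inverted? (p ∘ suc) i j) (inverted? p (suc i) (suc j))
      (map₁ s<s) (map₁ ℕ.≤-pred)))
    (sym (trans (∑-allFin (entry (suc i))) (trans (cong (ℤ._+ ∑ₗ (allFin d) (entry (suc i) ∘ suc)) (never (suc i))) (ℤ.+-identityˡ _))))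

values : ∀ {d} → Permutation′ d → Fin d → ℕ
values π i = toℕ (π ⟨$⟩ʳ i)

values-injective : ∀ {d} (π : Permutation′ d) {i j} → values π i ≡ values π j → i ≡ j
values-injective π {i} {j} eq =
  trans (sym (Perm.inverseˡ π)) (trans (cong (π ⟨$⟩ˡ_) (Fin.toℕ-injective eq)) (Perm.inverseˡ π))

sgn≡sign-inv : ∀ {d} (π : Permutation′ d) → sgn π ≡ sign (inv (values π))
sgn≡sign-inv {d} π = cong sign (ℤ.+-injective (begin
  + length (inversions π)
    ≡⟨ length-filter _ (cartesianProduct (allFin d) (allFin d)) ⟩
  ∑ₗ (cartesianProduct (allFin d) (allFin d)) (λ (i , j) → ⟦ (i Fin.<? j) ×-dec (values π j ℕ.<? values π i) ⟧)
    ≡⟨ ∑ₗ-cartesianProductWith _,_ (allFin d) (allFin d) _ ⟩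
  ∑ₗ (allFin d) (λ i → ∑ₗ (allFin d) (λ j → ⟦ (i Fin.<? j) ×-dec (values π j ℕ.<? values π i) ⟧))
    ≡⟨ +inv (values π) ⟨
  + inv (values π) ∎))
  where open ≡-Reasoning

sgn-cong : ∀ {d} {π ρ : Permutation′ d} → π Perm.≈ ρ → sgn π ≡ sgn ρ
sgn-cong {_} {π} {ρ} π≈ρ =
  trans (sgn≡sign-inv π) (trans (cong sign (inv-cong (λ i → cong toℕ (π≈ρ i)))) (sym (sgn≡sign-inv ρ)))

sgn-swapₚ : ∀ {d} (i : Fin d) (π : Permutation′ (suc d)) → sgn (swapₚ i ∘ₚ π) ≡ ℤ.- sgn π
sgn-swapₚ i π = trans (sgn≡sign-inv (swapₚ i ∘ₚ π))
  (trans (inv-swapAt (values π) i (values-injective π)) (cong ℤ.-_ (sym (sgn≡sign-inv π))))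

sgn-id : ∀ {d} → sgn (Perm.id {d}) ≡ 1ℤ
sgn-id {d} = trans (sgn≡sign-inv (Perm.id {d})) (cong sign (inv-monotone {d} toℕ ℕ.<⇒≤))

Matches : ∀ {d} → Vec ℤ d → Permutation′ d → Set
Matches c π = ∀ k → lookup c k ℤ.+ + toℕ k ≡ + values π k

matches? : ∀ {d} (c : Vec ℤ d) (π : Permutation′ d) → Dec (Matches c π)
matches? c π = Fin.all? λ k → (lookup c k ℤ.+ + toℕ k) ℤ.≟ + values π k

-- The function `N` of the overview. Matching prescribes every value of `π`, so up to equality of
-- permutations at most one term is nonzero.
alternant : ∀ {d} → Vec ℤ d → ℤ
alternant {d} c = ∑ₗ (elements (S d)) (λ π → sgn π * ⟦ matches? c π ⟧)

module _ {d} (c : Vec ℤ d) where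

  private
    term : Permutation′ d → ℤ
    term π = sgn π * ⟦ matches? c π ⟧

    matches-≈ : ∀ {π ρ : Permutation′ d} → π Perm.≈ ρ → Matches c π → Matches c ρ
    matches-≈ π≈ρ m k = trans (m k) (cong (λ i → + toℕ i) (π≈ρ k))

    term-unmatched : ∀ {π} → ¬ Matches c π → term π ≡ 0ℤ
    term-unmatched {π} ¬m rewrite dec-false (matches? c π) ¬m = ℤ.*-zeroʳ (sgn π)

    term-matched : ∀ {π} → Matches c π → term π ≡ sgn π
    term-matched {π} m rewrite dec-true (matches? c π) m = ℤ.*-identityʳ (sgn π)

    ∑-unmatched : ∀ {πs} → All (λ π → ¬ Matches c π) πs → ∑ₗ πs term ≡ 0ℤ
    ∑-unmatched []                = refl
    ∑-unmatched (_∷_ {π} ¬m ¬ms) = cong₂ ℤ._+_ (term-unmatched {π} ¬m) (∑-unmatched ¬ms)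

    same : ∀ {π ρ : Permutation′ d} → Matches c π → Matches c ρ → π Perm.≈ ρ
    same mπ mρ k = Fin.toℕ-injective (ℤ.+-injective (trans (sym (mπ k)) (mρ k)))

    ∑-matched : ∀ {πs} {ρ : Permutation′ d} → AllPairs (λ π π′ → ¬ (π Perm.≈ π′)) πs → Any (ρ Perm.≈_) πs →
                Matches c ρ → ∑ₗ πs term ≡ sgn ρ
    ∑-matched {π ∷ πs} {ρ} (π∉ ∷ u) (here ρ≈π) mρ = trans
      (cong₂ ℤ._+_ (trans (term-matched {π} mπ) (sym (sgn-cong {_} {ρ} {π} ρ≈π)))
        (∑-unmatched (All.map (λ {π′} π≉ m → π≉ (same {π} {π′} mπ m)) π∉)))
      (ℤ.+-identityʳ _)
      where mπ = matches-≈ {ρ} {π} ρ≈π mρ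
    ∑-matched {π ∷ πs} {ρ} (π∉ ∷ u) (there ρ∈) mρ = trans
      (cong₂ ℤ._+_ (term-unmatched {π} (λ mπ → All.lookupAny π∉ ρ∈ .proj₁
          (same {π} {Any.lookup ρ∈} mπ (matches-≈ {ρ} {Any.lookup ρ∈} (All.lookupAny π∉ ρ∈ .proj₂) mρ))))
        (∑-matched {ρ = ρ} u ρ∈ mρ))
      (ℤ.+-identityˡ _)

  alternant-matched : ∀ (ρ : Permutation′ d) → Matches c ρ → alternant c ≡ sgn ρ
  alternant-matched ρ = ∑-matched {ρ = ρ} (unique (S d)) (complete (S d) {ρ} tt)

  alternant-unmatched : (∀ π → ¬ Matches c π) → alternant c ≡ 0ℤ
  alternant-unmatched ¬m = ∑-unmatched (All.universal ¬m (elements (S d)))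

  match : (∃[ π ] Matches c π) ⊎ (∀ π → ¬ Matches c π)
  match with Any.any? (matches? c) (elements (S d))
  ... | yes m = inj₁ (Any.satisfied m)
  ... | no ¬m = inj₂ (λ π mπ → ¬m (Any.map (λ {ρ} π≈ρ → matches-≈ {π} {ρ} π≈ρ mπ) (complete (S d) {π} tt)))

matches-reflectAt : ∀ {d} (i : Fin d) c π → Matches c π → Matches (reflectAt i c) (swapₚ i ∘ₚ π)
matches-reflectAt i c π m k = trans (lookup-reflectAt i c k) (m (swapAt i k))

matches-reflectAt⁻ : ∀ {d} (i : Fin d) c π → Matches (reflectAt i c) π → Matches c (swapₚ i ∘ₚ π)
matches-reflectAt⁻ i c π m k = trans
  (cong (λ j → lookup c j ℤ.+ + toℕ j) (sym (swapAt-involutive i k)))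
  (trans (sym (lookup-reflectAt i c (swapAt i k))) (m (swapAt i k)))

-- A permutation matching `c`, precomposed with the adjacent transposition, matches the reflected
-- point and has the opposite sign. The same passage in the other direction shows that an unmatched
-- point has an unmatched reflection.
alternant-antisymmetric : ∀ {d} → Antisymmetric (alternant {d})
alternant-antisymmetric {zero}  = tt
alternant-antisymmetric {suc d} = reflectAt⇒antisymmetric anti
  where
  anti : ∀ i c → alternant c ≡ ℤ.- alternant (reflectAt i c)
  anti i c with match c
  ... | inj₁ (π , m) = trans (alternant-matched c π m) (trans (sym (ℤ.neg-involutive (sgn π)))
      (cong ℤ.-_ (sym (trans (alternant-matched (reflectAt i c) (swapₚ i ∘ₚ π) (matches-reflectAt i c π m)) (sgn-swapₚ i π)))))
  ... | inj₂ ¬m = trans (alternant-unmatched c ¬m) (sym (cong ℤ.-_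
      (alternant-unmatched (reflectAt i c) (λ π m → ¬m (swapₚ i ∘ₚ π) (matches-reflectAt⁻ i c π m)))))

zeros : ∀ {d} → Vec ℤ d
zeros = Vec.replicate _ 0ℤ

increasing-zeros : ∀ {d} (c : Vec ℤ (suc d)) → Increasing c →
  0ℤ ℤ.≤ lookup c zero → lookup c (Fin.fromℕ d) ℤ.≤ 0ℤ → c ≡ zeros
increasing-zeros (a ∷ [])    _           0≤a a≤0 = cong (_∷ []) (ℤ.≤-antisym a≤0 0≤a)
increasing-zeros (a ∷ b ∷ c) (a≤b , inc) 0≤a ≤0 with increasing-zeros (b ∷ c) inc (ℤ.≤-trans 0≤a a≤b) ≤0
... | refl = cong (_∷ zeros) (ℤ.≤-antisym a≤b 0≤a)

-- The two end coordinates suffice: the first value of `π` is at least `0`, which makes the first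
-- coordinate nonnegative, and the last value is at most `d`, which makes the last one nonpositive.
-- Monotonicity squeezes the rest.
matches-increasing : ∀ {d} (c : Vec ℤ d) π → Increasing c → Matches c π → c ≡ zeros
matches-increasing {zero}  []  π inc m = refl
matches-increasing {suc d} c π inc m = increasing-zeros c inc
  (subst (0ℤ ℤ.≤_) (trans (sym (m zero)) (ℤ.+-identityʳ _)) (ℤ.+≤+ z≤n))
  (subst (ℤ._≤ 0ℤ) (cancel (lookup c last) (+ d)) (ℤ.i≤j⇒i-j≤0 (begin
    lookup c last ℤ.+ + d        ≡⟨ cong (λ x → lookup c last ℤ.+ + x) (Fin.toℕ-fromℕ d) ⟨
    lookup c last ℤ.+ + toℕ last ≡⟨ m last ⟩
    + values π last              ≤⟨ ℤ.+≤+ (Fin.toℕ≤pred[n] (π ⟨$⟩ʳ last)) ⟩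
    + d                          ∎)))
  where
  open ℤ.≤-Reasoning
  last = Fin.fromℕ d

  cancel : ∀ i j → i ℤ.+ j ℤ.- j ≡ i
  cancel = ℤSolver.solve-∀

matches-zeros : ∀ {d} → Matches zeros (Perm.id {d})
matches-zeros k = trans (cong (ℤ._+ + toℕ k) (Vec.lookup-replicate k 0ℤ)) (ℤ.+-identityˡ _)

alternant-increasing : ∀ {d} (c : Vec ℤ d) → Increasing c → alternant c ≡ ⟦ Vec.≡-dec ℤ._≟_ c zeros ⟧
alternant-increasing {d} c inc with Vec.≡-dec ℤ._≟_ c zeros
... | yes refl = trans (alternant-matched zeros (Perm.id {d}) (matches-zeros {d})) (sgn-id {d})
... | no c≢0   = alternant-unmatched c (λ π m → c≢0 (matches-increasing c π inc m))

-- Reflection of walks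

-- The argument `a` carries the preceding part of the larger partition, so the inequalities form one
-- chain `a ≤ l₁ ≤ n₁ ≤ l₂ ≤ n₂` and so on.
Interlaced : ∀ {d} → ℕ → Vec ℕ d → Vec ℕ d → Set
Interlaced a []       []       = ⊤
Interlaced a (l ∷ ls) (n ∷ ns) = a ≤ l × l ≤ n × Interlaced n ls ns

interlaced? : ∀ {d} a (ls ns : Vec ℕ d) → Dec (Interlaced a ls ns)
interlaced? a []       []       = yes tt
interlaced? a (l ∷ ls) (n ∷ ns) = (a ℕ.≤? l) ×-dec (l ℕ.≤? n) ×-dec interlaced? n ls ns

-- Partitions with at most d parts are listed from the smallest part to the
-- largest; μ ≺ ν says that ν / μ is a horizontal strip.
infix 4 _≺_ _≺?_
_≺_ : ∀ {d} → Vec ℕ d → Vec ℕ d → Set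
μ ≺ ν = Interlaced 0 μ ν

_≺?_ : ∀ {d} (μ ν : Vec ℕ d) → Dec (μ ≺ ν)
μ ≺? ν = interlaced? 0 μ ν

infixl 6 _⊞_
_⊞_ : ∀ {d} → Vec ℕ d → Vec ℕ d → Vec ℕ d
_⊞_ = zipWith _+_

∅ : ∀ {d} → Vec ℕ d
∅ = Vec.replicate _ 0

-- The latest step stands at the head, so partial sums are totals of tails and `Tower` is built up
-- from the right end.
total : ∀ {d n} → Vec (Vec ℕ d) n → Vec ℕ d
total []       = ∅
total (x ∷ xs) = total xs ⊞ x

Tower : ∀ {d n} → Vec (Vec ℕ d) n → Set
Tower []       = ⊤
Tower (x ∷ xs) = total xs ≺ total xs ⊞ x × Tower xs

tower? : ∀ {d n} (xs : Vec (Vec ℕ d) n) → Dec (Tower xs)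
tower? []       = yes tt
tower? (x ∷ xs) = (total xs ≺? total xs ⊞ x) ×-dec tower? xs

infix 8 ↑_
↑_ : ∀ {d} → Vec ℕ d → Vec ℤ d
↑_ = Vec.map (λ i → + i)

stripUp⇒interlaced : ∀ {d} a (μ x : Vec ℕ (suc d)) → a ≤ Vec.head μ → StripUp (↑ μ) x → Interlaced a μ (μ ⊞ x)
stripUp⇒interlaced a (l ∷ [])      (x ∷ [])     a≤l _           = a≤l , ℕ.m≤m+n l x , tt
stripUp⇒interlaced a (l ∷ l′ ∷ ls) (x ∷ y ∷ xs) a≤l (l+x≤l′ , s) =
  a≤l , ℕ.m≤m+n l x , stripUp⇒interlaced (l + x) (l′ ∷ ls) (y ∷ xs) (ℤ.drop‿+≤+ l+x≤l′) s

interlaced⇒stripUp : ∀ {d} a (μ x : Vec ℕ d) → Interlaced a μ (μ ⊞ x) → StripUp (↑ μ) x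
interlaced⇒stripUp a []            []           _ = tt
interlaced⇒stripUp a (l ∷ [])      (x ∷ [])     _ = tt
interlaced⇒stripUp a (l ∷ l′ ∷ ls) (x ∷ y ∷ xs) (_ , _ , i@(l+x≤l′ , _)) =
  ℤ.+≤+ l+x≤l′ , interlaced⇒stripUp (l + x) (l′ ∷ ls) (y ∷ xs) i

⟦stripUp⟧ : ∀ {d} (μ x : Vec ℕ d) → ⟦ stripUp? (↑ μ) x ⟧ ≡ ⟦ μ ≺? μ ⊞ x ⟧
⟦stripUp⟧ []       []       = refl
⟦stripUp⟧ (l ∷ ls) (x ∷ xs) = ⟦⟧-cong (stripUp? (↑ (l ∷ ls)) (x ∷ xs)) ((l ∷ ls) ≺? (l ∷ ls) ⊞ (x ∷ xs))
  (stripUp⇒interlaced 0 (l ∷ ls) (x ∷ xs) z≤n) (interlaced⇒stripUp 0 (l ∷ ls) (x ∷ xs))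

stripDown⇒interlaced : ∀ {d} n (μ x : Vec ℕ d) → StripDownFrom (+ n) (↑ (μ ⊞ x)) x → Interlaced n μ (μ ⊞ x)
stripDown⇒interlaced n []       []       _ = tt
stripDown⇒interlaced n (l ∷ ls) (x ∷ xs) (n+x≤l+x , s) =
  ℕ.+-cancelʳ-≤ x n l (ℤ.drop‿+≤+ n+x≤l+x) , ℕ.m≤m+n l x , stripDown⇒interlaced (l + x) ls xs s

interlaced⇒stripDown : ∀ {d} n (μ x : Vec ℕ d) → Interlaced n μ (μ ⊞ x) → StripDownFrom (+ n) (↑ (μ ⊞ x)) x
interlaced⇒stripDown n []       []       _ = tt
interlaced⇒stripDown n (l ∷ ls) (x ∷ xs) (n≤l , _ , i) =
  ℤ.+≤+ (ℕ.+-monoˡ-≤ x n≤l) , interlaced⇒stripDown (l + x) ls xs i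

⟦stripDown⟧ : ∀ {d} (μ x : Vec ℕ d) → ⟦ stripDown? (↑ (μ ⊞ x)) x ⟧ ≡ ⟦ μ ≺? μ ⊞ x ⟧
⟦stripDown⟧ []       []       = refl
⟦stripDown⟧ (l ∷ ls) (x ∷ xs) = ⟦⟧-cong (stripDown? (↑ ((l ∷ ls) ⊞ (x ∷ xs))) (x ∷ xs)) ((l ∷ ls) ≺? (l ∷ ls) ⊞ (x ∷ xs))
  (λ s → z≤n , ℕ.m≤m+n l x , stripDown⇒interlaced (l + x) ls xs s)
  (λ (_ , _ , i) → interlaced⇒stripDown (l + x) ls xs i)

increasing-⊖ : ∀ {d} (c : Vec ℤ d) x → Increasing c → StripDown c x → Increasing (c ⊖ x)
increasing-⊖ []          []           _         _ = tt
increasing-⊖ (a ∷ [])    (x ∷ [])     _         _ = tt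
increasing-⊖ (a ∷ b ∷ c) (x ∷ y ∷ xs) (a≤b , i) (a+y≤b , s) =
  ℤ.≤-trans (ℤ.i≤j⇒i-k≤j (+ x) (ℤ.≤-refl {a}))
    (subst (ℤ._≤ b ℤ.- + y) (cancel a (+ y)) (ℤ.+-monoˡ-≤ (ℤ.- + y) a+y≤b)) ,
  increasing-⊖ (b ∷ c) (y ∷ xs) i s
  where
  cancel : ∀ a y → a ℤ.+ y ℤ.- y ≡ a
  cancel = ℤSolver.solve-∀

increasing-interlaced : ∀ {d} a (μ ν : Vec ℕ d) → Interlaced a μ ν → Increasing (↑ ν)
increasing-interlaced a []           []           _ = tt
increasing-interlaced a (l ∷ [])     (n ∷ [])     _ = tt
increasing-interlaced a (l ∷ l′ ∷ ls) (n ∷ n′ ∷ ns) (_ , _ , i@(n≤l′ , l′≤n′ , _)) =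
  ℤ.+≤+ (ℕ.≤-trans n≤l′ l′≤n′) , increasing-interlaced n (l′ ∷ ls) (n′ ∷ ns) i

increasing-∅ : ∀ d → Increasing (↑ ∅ {d})
increasing-∅ zero          = tt
increasing-∅ (suc zero)    = tt
increasing-∅ (suc (suc d)) = ℤ.≤-refl , increasing-∅ (suc d)

tower⇒increasing : ∀ {d n} (xs : Vec (Vec ℕ d) n) → Tower xs → Increasing (↑ total xs)
tower⇒increasing {d} []    _        = increasing-∅ d
tower⇒increasing (x ∷ xs) (strip , _) = increasing-interlaced 0 (total xs) (total xs ⊞ x) strip

↑-⊞ : ∀ {d} (μ x : Vec ℕ d) → ↑ (μ ⊞ x) ≡ ↑ μ ⊕ x
↑-⊞ []       []       = refl
↑-⊞ (l ∷ ls) (x ∷ xs) = cong (_∷_ (+ (l + x))) (↑-⊞ ls xs)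

⊖-⊞ : ∀ {d} (c : Vec ℤ d) (μ x : Vec ℕ d) → c ⊖ (μ ⊞ x) ≡ (c ⊖ x) ⊖ μ
⊖-⊞ []      []       []       = refl
⊖-⊞ (a ∷ c) (l ∷ ls) (x ∷ xs) = cong₂ _∷_ (trans (cong (λ z → a ℤ.- z) (ℤ.pos-+ l x)) (lemma a (+ l) (+ x))) (⊖-⊞ c ls xs)
  where
  lemma : ∀ a l x → a ℤ.- (l ℤ.+ x) ≡ a ℤ.- x ℤ.- l
  lemma = ℤSolver.solve-∀

⊖-∅ : ∀ {d} (c : Vec ℤ d) → c ⊖ ∅ ≡ c
⊖-∅ []      = refl
⊖-∅ (a ∷ c) = cong₂ _∷_ (ℤ.+-identityʳ a) (⊖-∅ c)

↑∅≡zeros : ∀ d → ↑ ∅ {d} ≡ zeros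
↑∅≡zeros d = Vec.map-replicate (λ i → + i) 0 d

⊖⇒↑ : ∀ {d} (c : Vec ℤ d) (μ x : Vec ℕ d) → c ⊖ x ≡ ↑ μ → c ≡ ↑ (μ ⊞ x)
⊖⇒↑ []      []       []       _  = refl
⊖⇒↑ (a ∷ c) (l ∷ ls) (x ∷ xs) eq = cong₂ _∷_
  (trans (sym (cancel a (+ x))) (cong (ℤ._+ + x) (Vec.∷-injectiveˡ eq)))
  (⊖⇒↑ c ls xs (Vec.∷-injectiveʳ eq))
  where
  cancel : ∀ a x → a ℤ.- x ℤ.+ x ≡ a
  cancel = ℤSolver.solve-∀

↑⇒⊖ : ∀ {d} (μ x : Vec ℕ d) → ↑ (μ ⊞ x) ⊖ x ≡ ↑ μ
↑⇒⊖ []       []       = refl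
↑⇒⊖ (l ∷ ls) (x ∷ xs) = cong₂ _∷_ (cancel (+ l) (+ x)) (↑⇒⊖ ls xs)
  where
  cancel : ∀ l x → l ℤ.+ x ℤ.- x ≡ l
  cancel = ℤSolver.solve-∀

infix 4 _≟ᵛ_
_≟ᵛ_ : ∀ {d} (c c′ : Vec ℤ d) → Dec (c ≡ c′)
_≟ᵛ_ = Vec.≡-dec ℤ._≟_

compositionSequences : ∀ d r n → Enumeration (setoid (Vec (Vec ℕ d) n)) (VecAll.All (λ x → sum x ≡ r))
compositionSequences d r n = enumerate-Vec (enumerate-compositions d r) n

module _ (d r : ℕ) where

  private
    C : List (Vec ℕ d)
    C = compositions d r

    Cs : ∀ n → List (Vec (Vec ℕ d) n)
    Cs n = elements (compositionSequences d r n)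

    ∑-Cs-∷ : ∀ {n} (f : Vec (Vec ℕ d) (suc n) → ℤ) →
             ∑ₗ (Cs (suc n)) f ≡ ∑ₗ C (λ x → ∑ₗ (Cs n) (λ xs → f (x ∷ xs)))
    ∑-Cs-∷ {n} f = ∑ₗ-cartesianProductWith _∷_ C (Cs n) f

    open ≡-Reasoning

  -- The sum over the latest step is itself an antisymmetric function of the point before it, by
  -- `antisymmetric-shift`, so the induction hypothesis applies to the shorter walk. Once that walk
  -- is a tower, its end lies in the chamber and `stripUp-sum` restricts the latest step.
  towerUp-sum : ∀ n {N : Vec ℤ d → ℤ} → Antisymmetric N →
    ∑ₗ (Cs n) (λ xs → N (↑ total xs)) ≡ ∑ₗ (Cs n) (λ xs → ⟦ tower? xs ⟧ * N (↑ total xs))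
  towerUp-sum zero    {N} anti = cong (ℤ._+ 0ℤ) (sym (ℤ.*-identityˡ (N (↑ ∅))))
  towerUp-sum (suc n) {N} anti = begin
    ∑ₗ (Cs (suc n)) (λ xs → N (↑ total xs))
      ≡⟨ ∑-Cs-∷ _ ⟩
    ∑ₗ C (λ x → ∑ₗ (Cs n) (λ xs → N (↑ (total xs ⊞ x))))
      ≡⟨ ∑ₗ-swap C (Cs n) _ ⟩
    ∑ₗ (Cs n) (λ xs → ∑ₗ C (λ x → N (↑ (total xs ⊞ x))))
      ≡⟨ ∑ₗ-cong (Cs n) (λ xs → ∑ₗ-cong C (λ x → cong N (↑-⊞ (total xs) x))) ⟩
    ∑ₗ (Cs n) (λ xs → ∑ₗ C (λ x → N (↑ total xs ⊕ x)))
      ≡⟨ towerUp-sum n (antisymmetric-shift (λ i → + i) r anti) ⟩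
    ∑ₗ (Cs n) (λ xs → ⟦ tower? xs ⟧ * ∑ₗ C (λ x → N (↑ total xs ⊕ x)))
      ≡⟨ ∑ₗ-cong (Cs n) (λ xs → ⟦⟧-*-cong (tower? xs) (λ t → stripUp-sum r anti (↑ total xs) (tower⇒increasing xs t))) ⟩
    ∑ₗ (Cs n) (λ xs → ⟦ tower? xs ⟧ * ∑ₗ C (λ x → ⟦ stripUp? (↑ total xs) x ⟧ * N (↑ total xs ⊕ x)))
      ≡⟨ ∑ₗ-cong (Cs n) (λ xs → ∑ₗ-*ˡ C ⟦ tower? xs ⟧ _) ⟨
    ∑ₗ (Cs n) (λ xs → ∑ₗ C (λ x → ⟦ tower? xs ⟧ * (⟦ stripUp? (↑ total xs) x ⟧ * N (↑ total xs ⊕ x))))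
      ≡⟨ ∑ₗ-cong (Cs n) (λ xs → ∑ₗ-cong C (λ x → step x xs)) ⟩
    ∑ₗ (Cs n) (λ xs → ∑ₗ C (λ x → ⟦ tower? (x ∷ xs) ⟧ * N (↑ total (x ∷ xs))))
      ≡⟨ ∑ₗ-swap C (Cs n) _ ⟨
    ∑ₗ C (λ x → ∑ₗ (Cs n) (λ xs → ⟦ tower? (x ∷ xs) ⟧ * N (↑ total (x ∷ xs))))
      ≡⟨ ∑-Cs-∷ _ ⟨
    ∑ₗ (Cs (suc n)) (λ xs → ⟦ tower? xs ⟧ * N (↑ total xs)) ∎
    where
    lemma : ∀ t s u → t * (s * u) ≡ (s * t) * u
    lemma = ℤSolver.solve-∀

    step : ∀ x (xs : Vec (Vec ℕ d) n) → ⟦ tower? xs ⟧ * (⟦ stripUp? (↑ total xs) x ⟧ * N (↑ total xs ⊕ x)) ≡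
                    ⟦ tower? (x ∷ xs) ⟧ * N (↑ total (x ∷ xs))
    step x xs = trans (lemma ⟦ tower? xs ⟧ ⟦ stripUp? (↑ total xs) x ⟧ (N (↑ total xs ⊕ x))) (cong₂ _*_
      (trans (cong (_* ⟦ tower? xs ⟧) (⟦stripUp⟧ (total xs) x)) (sym (⟦⟧-× (total xs ≺? total xs ⊞ x) (tower? xs))))
      (cong N (sym (↑-⊞ (total xs) x))))

  ∑-Cs-⊖ : ∀ n (N : Vec ℤ d → ℤ) c →
    ∑ₗ (Cs (suc n)) (λ ys → N (c ⊖ total ys)) ≡ ∑ₗ C (λ y → ∑ₗ (Cs n) (λ ys → N ((c ⊖ y) ⊖ total ys)))
  ∑-Cs-⊖ n N c = trans (∑-Cs-∷ _) (∑ₗ-cong C (λ y → ∑ₗ-cong (Cs n) (λ ys → cong N (⊖-⊞ c (total ys) y))))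

  antisymmetric-∑-⊖ : ∀ n {N : Vec ℤ d → ℤ} → Antisymmetric N → Antisymmetric (λ c → ∑ₗ (Cs n) (λ ys → N (c ⊖ total ys)))
  antisymmetric-∑-⊖ zero    {N} anti =
    antisymmetric-cong (λ c → sym (trans (ℤ.+-identityʳ _) (cong N (⊖-∅ c)))) anti
  antisymmetric-∑-⊖ (suc n) {N} anti =
    antisymmetric-cong (λ c → sym (∑-Cs-⊖ n N c)) (antisymmetric-shift (λ y → ℤ.- + y) r (antisymmetric-∑-⊖ n anti))

  -- The head of `ys` is the first step taken down from `c`. The sum over the remaining steps is
  -- antisymmetric in their starting point, so `stripDown-sum` applies, and a strip leaves the walk
  -- inside the chamber for the induction. At the bottom, the alternant tests whether the origin has
  -- been reached.
  towerDown-sum : ∀ n (c : Vec ℤ d) → Increasing c →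
    ∑ₗ (Cs n) (λ ys → alternant (c ⊖ total ys)) ≡ ∑ₗ (Cs n) (λ ys → ⟦ tower? ys ⟧ * ⟦ c ≟ᵛ (↑ total ys) ⟧)
  towerDown-sum zero    c inc = cong (ℤ._+ 0ℤ) (begin
    alternant (c ⊖ ∅)          ≡⟨ cong alternant (⊖-∅ c) ⟩
    alternant c                ≡⟨ alternant-increasing c inc ⟩
    ⟦ c ≟ᵛ zeros ⟧             ≡⟨ cong (λ z → ⟦ c ≟ᵛ z ⟧) (↑∅≡zeros d) ⟨
    ⟦ c ≟ᵛ (↑ ∅) ⟧             ≡⟨ ℤ.*-identityˡ _ ⟨
    1ℤ * ⟦ c ≟ᵛ (↑ ∅) ⟧        ∎)
  towerDown-sum (suc n) c inc = begin
    ∑ₗ (Cs (suc n)) (λ ys → alternant (c ⊖ total ys))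
      ≡⟨ ∑-Cs-⊖ n alternant c ⟩
    ∑ₗ C (λ y → ∑ₗ (Cs n) (λ ys → alternant ((c ⊖ y) ⊖ total ys)))
      ≡⟨ stripDown-sum r (antisymmetric-∑-⊖ n alternant-antisymmetric) c inc ⟩
    ∑ₗ C (λ y → ⟦ stripDown? c y ⟧ * ∑ₗ (Cs n) (λ ys → alternant ((c ⊖ y) ⊖ total ys)))
      ≡⟨ ∑ₗ-cong C (λ y → ⟦⟧-*-cong (stripDown? c y) (λ s → towerDown-sum n (c ⊖ y) (increasing-⊖ c y inc s))) ⟩
    ∑ₗ C (λ y → ⟦ stripDown? c y ⟧ * ∑ₗ (Cs n) (λ ys → ⟦ tower? ys ⟧ * ⟦ (c ⊖ y) ≟ᵛ (↑ total ys) ⟧))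
      ≡⟨ ∑ₗ-cong C (λ y → ∑ₗ-*ˡ (Cs n) ⟦ stripDown? c y ⟧ _) ⟨
    ∑ₗ C (λ y → ∑ₗ (Cs n) (λ ys → ⟦ stripDown? c y ⟧ * (⟦ tower? ys ⟧ * ⟦ (c ⊖ y) ≟ᵛ (↑ total ys) ⟧)))
      ≡⟨ ∑ₗ-cong C (λ y → ∑ₗ-cong (Cs n) (λ ys → step y ys)) ⟩
    ∑ₗ C (λ y → ∑ₗ (Cs n) (λ ys → ⟦ tower? (y ∷ ys) ⟧ * ⟦ c ≟ᵛ (↑ total (y ∷ ys)) ⟧))
      ≡⟨ ∑-Cs-∷ _ ⟨
    ∑ₗ (Cs (suc n)) (λ ys → ⟦ tower? ys ⟧ * ⟦ c ≟ᵛ (↑ total ys) ⟧) ∎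
    where
    step : ∀ y (ys : Vec (Vec ℕ d) n) → ⟦ stripDown? c y ⟧ * (⟦ tower? ys ⟧ * ⟦ (c ⊖ y) ≟ᵛ (↑ total ys) ⟧) ≡
                    ⟦ tower? (y ∷ ys) ⟧ * ⟦ c ≟ᵛ (↑ total (y ∷ ys)) ⟧
    -- The strip condition is stated for `c` on one side and for `total ys` on the other. They can
    -- be compared once `c` is the full total; otherwise both sides contain a vanishing indicator.
    step y ys with c ≟ᵛ (↑ (total ys ⊞ y))
    ... | no c≢ rewrite dec-false ((c ⊖ y) ≟ᵛ (↑ total ys)) (λ eq → c≢ (⊖⇒↑ c (total ys) y eq)) =
      trans (cong (⟦ stripDown? c y ⟧ *_) (ℤ.*-zeroʳ ⟦ tower? ys ⟧))
        (trans (ℤ.*-zeroʳ ⟦ stripDown? c y ⟧) (sym (ℤ.*-zeroʳ ⟦ tower? (y ∷ ys) ⟧)))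
    ... | yes refl rewrite dec-true ((c ⊖ y) ≟ᵛ (↑ total ys)) (↑⇒⊖ (total ys) y) =
      trans (sym (ℤ.*-assoc ⟦ stripDown? (↑ (total ys ⊞ y)) y ⟧ ⟦ tower? ys ⟧ 1ℤ)) (cong (_* 1ℤ)
        (trans (cong (_* ⟦ tower? ys ⟧) (⟦stripDown⟧ (total ys) y)) (sym (⟦⟧-× (total ys ≺? total ys ⊞ y) (tower? ys)))))

  reflection : ∀ n → ∑ₗ (Cs n) (λ xs → ∑ₗ (Cs n) (λ ys → alternant (↑ total xs ⊖ total ys))) ≡
    ∑ₗ (Cs n) (λ xs → ⟦ tower? xs ⟧ * ∑ₗ (Cs n) (λ ys → ⟦ tower? ys ⟧ * ⟦ (↑ total xs) ≟ᵛ (↑ total ys) ⟧))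
  reflection n = trans (towerUp-sum n (antisymmetric-∑-⊖ n alternant-antisymmetric))
    (∑ₗ-cong (Cs n) (λ xs → ⟦⟧-*-cong (tower? xs) (λ t → towerDown-sum n (↑ total xs) (tower⇒increasing xs t))))

-- Walks as pairs of sequences of compositions

enumerate-∩ : ∀ {A : Set} {P Q : Pred A 0ℓ} → Decidable P → Enumeration (setoid A) Q →
              Enumeration (setoid A) (λ x → Q x × P x)
enumerate-∩ P? E = record
  { elements = filter P? (elements E)
  ; unique   = Unique.filter⁺ P? (unique E)
  ; sound    = All.tabulate λ x∈ → map₁ (All.lookup (sound E)) (∈.∈-filter⁻ P? {xs = elements E} x∈)
  ; complete = λ (qx , px) → ∈.∈-filter⁺ P? (complete E qx) px
  }

count : ∀ {d m} → Fin d → Vec (Fin d) m → ℕ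
count k []      = 0
count k (a ∷ w) = iverson (a Fin.≟ k) + count k w

content : ∀ {d m} → Vec (Fin d) m → Vec ℕ d
content w = tabulate (λ k → count k w)

count-++ : ∀ {d m n} k (w : Vec (Fin d) m) (w′ : Vec (Fin d) n) → count k (w Vec.++ w′) ≡ count k w + count k w′
count-++ k []      w′ = refl
count-++ k (a ∷ w) w′ = trans (cong (λ z → iverson (a Fin.≟ k) + z) (count-++ k w w′)) (sym (ℕ.+-assoc (iverson (a Fin.≟ k)) _ _))

sum-tabulate-+ : ∀ {d} (f h : Fin d → ℕ) → sum (tabulate (λ k → f k + h k)) ≡ sum (tabulate f) + sum (tabulate h)
sum-tabulate-+ {zero}  f h = refl
sum-tabulate-+ {suc d} f h = trans (cong (λ s → f zero + h zero + s) (sum-tabulate-+ (f ∘ suc) (h ∘ suc)))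
  (interchange (f zero) (h zero) (sum (tabulate (f ∘ suc))) (sum (tabulate (h ∘ suc))))
  where
  interchange : ∀ a b c d → (a + b) + (c + d) ≡ (a + c) + (b + d)
  interchange = ℕSolver.solve-∀

sum-tabulate-0 : ∀ d → sum (tabulate {n = d} (λ _ → 0)) ≡ 0
sum-tabulate-0 zero    = refl
sum-tabulate-0 (suc d) = sum-tabulate-0 d

sum-iverson : ∀ {d} (a : Fin d) → sum (tabulate (λ k → iverson (a Fin.≟ k))) ≡ 1
sum-iverson {suc d} zero    = cong suc (sum-tabulate-0 d)
sum-iverson {suc d} (suc a) = sum-iverson a

sum-content : ∀ {d m} (w : Vec (Fin d) m) → sum (content w) ≡ m
sum-content {d} []      = sum-tabulate-0 d
sum-content     (a ∷ w) = trans (sum-tabulate-+ (λ k → iverson (a Fin.≟ k)) (λ k → count k w))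
  (cong₂ _+_ (sum-iverson a) (sum-content w))

Descending : ∀ {d m} → Vec (Fin d) m → Set
Descending []      = ⊤
Descending (a ∷ w) = VecAll.All (Fin._≤ a) w × Descending w

StepwiseDescending : ∀ {d m} → Vec (Fin d) m → Set
StepwiseDescending w = ∀ s s⁺ → toℕ s⁺ ≡ suc (toℕ s) → lookup w s Fin.≥ lookup w s⁺

stepwise⇒descending : ∀ {d m} (w : Vec (Fin d) m) → StepwiseDescending w → Descending w
stepwise⇒descending []      _ = tt
stepwise⇒descending (a ∷ w) step = below w step , stepwise⇒descending w (λ s s⁺ eq → step (suc s) (suc s⁺) (cong suc eq))
  where
  below : ∀ {d m} {a : Fin d} (w : Vec (Fin d) m) → StepwiseDescending (a ∷ w) → VecAll.All (Fin._≤ a) w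
  below []      _ = []
  below (b ∷ w) step = step zero (suc zero) refl ∷
    VecAll.map (λ c≤b → ℕ.≤-trans c≤b (step zero (suc zero) refl)) (below w (λ s s⁺ eq → step (suc s) (suc s⁺) (cong suc eq)))

descending⇒stepwise : ∀ {d m} (w : Vec (Fin d) m) → Descending w → StepwiseDescending w
descending⇒stepwise (a ∷ w) (≤a , dw) zero    (suc s⁺) eq = VecAll.lookup⁺ ≤a s⁺
descending⇒stepwise (a ∷ w) (≤a , dw) (suc s) (suc s⁺) eq = descending⇒stepwise w dw s s⁺ (ℕ.suc-injective eq)

counted≤ : ∀ {d m} {a b : Fin d} (w : Vec (Fin d) m) → VecAll.All (Fin._≤ b) w → 0 < count a w → a Fin.≤ b
counted≤ {a = a} (c ∷ w) (c≤b ∷ ≤b) 0<count with c Fin.≟ a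
... | yes refl = c≤b
... | no _     = counted≤ w ≤b 0<count

count-head : ∀ {d m} (a : Fin d) (w : Vec (Fin d) m) → 0 < count a (a ∷ w)
count-head a w rewrite iverson-true (a Fin.≟ a) refl = z<s

-- The first letter of a descending word is its largest. By equality of the counts each first letter
-- occurs in the other word, so each bounds the other.
descending-injective : ∀ {d m} (w w′ : Vec (Fin d) m) → Descending w → Descending w′ →
                       (∀ k → count k w ≡ count k w′) → w ≡ w′
descending-injective []      []        _          _            _  = refl
descending-injective (a ∷ w) (b ∷ w′) (≤a , dw) (≤b , dw′) eq
  with Fin.≤-antisym {i = a} {j = b}
         (counted≤ (b ∷ w′) (ℕ.≤-refl ∷ ≤b) (subst (0 <_) (eq a) (count-head a w)))
         (counted≤ (a ∷ w) (ℕ.≤-refl ∷ ≤a) (subst (0 <_) (sym (eq b)) (count-head b w′)))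
... | refl = cong (a ∷_) (descending-injective w w′ dw dw′ (λ k → ℕ.+-cancelˡ-≡ (iverson (a Fin.≟ k)) _ _ (eq k)))

-- The recursive word for the other letters is shifted up by one and the copies of the least letter
-- follow it, which is why the length arises as `sum xs + x`.
descending-surjective : ∀ {d r} (x : Vec ℕ d) → sum x ≡ r →
  ∃[ w ] Descending {d} {r} w × (∀ k → count k w ≡ lookup x k)
descending-surjective []       refl = [] , tt , λ ()
descending-surjective {suc d} (x ∷ xs) eq with trans (ℕ.+-comm (sum xs) x) eq | descending-surjective xs refl
... | refl | w , dw , counts = word , descending-word w dw , λ
  { zero    → trans (count-++ zero (Vec.map suc w) zeros′) (cong₂ _+_ (count-zero-map w) (count-zero-zeros x))
  ; (suc k) → trans (count-++ (suc k) (Vec.map suc w) zeros′)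
      (trans (cong₂ _+_ (trans (count-suc-map k w) (counts k)) (count-suc-zeros k x)) (ℕ.+-identityʳ _)) }
  where
  zeros′ : Vec (Fin (suc d)) x
  zeros′ = Vec.replicate x zero

  word : Vec (Fin (suc d)) (sum xs + x)
  word = Vec.map suc w Vec.++ zeros′

  all-zeros : ∀ (a : Fin (suc d)) m → VecAll.All (λ b → b Fin.≤ a) (Vec.replicate m (zero {d}))
  all-zeros a zero    = []
  all-zeros a (suc m) = z≤n ∷ all-zeros a m

  descending-word : ∀ {m} (w : Vec (Fin d) m) → Descending w → Descending (Vec.map suc w Vec.++ zeros′)
  descending-word []      _         = go x
    where
    go : ∀ m → Descending (Vec.replicate m (zero {d}))
    go zero    = tt
    go (suc m) = all-zeros zero m , go m
  descending-word (a ∷ w) (≤a , dw) =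
    VecAll.++⁺ (VecAll.map⁺ (VecAll.map s≤s ≤a)) (all-zeros (suc a) x) , descending-word w dw

  count-zero-map : ∀ {m} (w : Vec (Fin d) m) → count zero (Vec.map suc w) ≡ 0
  count-zero-map []      = refl
  count-zero-map (a ∷ w) = count-zero-map w

  count-suc-map : ∀ k {m} (w : Vec (Fin d) m) → count (suc k) (Vec.map suc w) ≡ count k w
  count-suc-map k []      = refl
  count-suc-map k (a ∷ w) = cong (λ z → iverson (a Fin.≟ k) + z) (count-suc-map k w)

  count-zero-zeros : ∀ m → count (zero {d}) (Vec.replicate m zero) ≡ m
  count-zero-zeros zero    = refl
  count-zero-zeros (suc m) = cong suc (count-zero-zeros m)

  count-suc-zeros : ∀ (k : Fin d) m → count (suc k) (Vec.replicate m zero) ≡ 0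
  count-suc-zeros k zero    = refl
  count-suc-zeros k (suc m) = count-suc-zeros k m

concat-injective : ∀ {A : Set} {n r} (xss yss : Vec (Vec A r) n) → Vec.concat xss ≡ Vec.concat yss → xss ≡ yss
concat-injective []         []         _  = refl
concat-injective (xs ∷ xss) (ys ∷ yss) eq =
  cong₂ _∷_ (Vec.++-injectiveˡ xs ys eq) (concat-injective xss yss (Vec.++-injectiveʳ xs ys eq))

module _ {n r d : ℕ} where

  blocks : Vec (Fin d) (n ℕ.* r) → Vec (Vec (Fin d) r) n
  blocks a = proj₁ (Vec.group n r a)

  concat-blocks : ∀ a → a ≡ Vec.concat (blocks a)
  concat-blocks a = proj₂ (Vec.group n r a)

  contents : Vec (Fin d) (n ℕ.* r) → Vec (Vec ℕ d) n
  contents a = Vec.map content (blocks a)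

  blockwise⇒descending : ∀ a → BlockwiseDecreasing n r a → ∀ i → Descending (lookup (blocks a) i)
  blockwise⇒descending a dec i = stepwise⇒descending (lookup (blocks a) i) λ s s⁺ eq →
    subst₂ (Fin._≥_ {d} {d}) (at s) (at s⁺) (dec i s s⁺ eq)
    where
    at : ∀ s → lookup a (combine i s) ≡ lookup (lookup (blocks a) i) s
    at s = trans (cong (λ v → lookup v (combine i s)) (concat-blocks a)) (Vec.lookup-concat (blocks a) i s)

  descending⇒blockwise : ∀ bs → (∀ i → Descending (lookup bs i)) → BlockwiseDecreasing n r (Vec.concat bs)
  descending⇒blockwise bs desc i s s⁺ eq =
    subst₂ (Fin._≥_ {d} {d}) (sym (Vec.lookup-concat bs i s)) (sym (Vec.lookup-concat bs i s⁺))
      (descending⇒stepwise (lookup bs i) (desc i) s s⁺ eq)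

  lookup-total : ∀ {m} (bs : Vec (Vec (Fin d) r) m) k → lookup (total (Vec.map content bs)) k ≡ count k (Vec.concat bs)
  lookup-total []       k = Vec.lookup-replicate k 0
  lookup-total (w ∷ bs) k = begin
    lookup (total (Vec.map content bs) ⊞ content w) k
      ≡⟨ Vec.lookup-zipWith _+_ k (total (Vec.map content bs)) (content w) ⟩
    lookup (total (Vec.map content bs)) k + lookup (content w) k
      ≡⟨ cong₂ _+_ (lookup-total bs k) (Vec.lookup∘tabulate (λ k → count k w) k) ⟩
    count k (Vec.concat bs) + count k w
      ≡⟨ ℕ.+-comm (count k (Vec.concat bs)) (count k w) ⟩
    count k w + count k (Vec.concat bs)
      ≡⟨ count-++ k w (Vec.concat bs) ⟨
    count k (w Vec.++ Vec.concat bs) ∎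
    where open ≡-Reasoning

  lookup-total-contents : ∀ a k → lookup (total (contents a)) k ≡ count k a
  lookup-total-contents a k = trans (lookup-total (blocks a) k) (cong (count k) (sym (concat-blocks a)))

  contents-injective : ∀ a a′ → BlockwiseDecreasing n r a → BlockwiseDecreasing n r a′ → contents a ≡ contents a′ → a ≡ a′
  contents-injective a a′ dec dec′ eq = trans (concat-blocks a) (trans (cong Vec.concat
      (go (blocks a) (blocks a′) (blockwise⇒descending a dec) (blockwise⇒descending a′ dec′) eq))
      (sym (concat-blocks a′)))
    where
    go : ∀ {m} (bs bs′ : Vec (Vec (Fin d) r) m) → (∀ i → Descending (lookup bs i)) → (∀ i → Descending (lookup bs′ i)) →
         Vec.map content bs ≡ Vec.map content bs′ → bs ≡ bs′
    go []       []         _  _   _  = refl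
    go (w ∷ bs) (w′ ∷ bs′) dw dw′ eq = cong₂ _∷_
      (descending-injective w w′ (dw zero) (dw′ zero) (λ k → trans (sym (Vec.lookup∘tabulate _ k))
        (trans (cong (λ v → lookup v k) (Vec.∷-injectiveˡ eq)) (Vec.lookup∘tabulate _ k))))
      (go bs bs′ (dw ∘ suc) (dw′ ∘ suc) (Vec.∷-injectiveʳ eq))

  contents-surjective : ∀ xs → VecAll.All (λ x → sum x ≡ r) xs → ∃[ a ] BlockwiseDecreasing n r a × contents a ≡ xs
  contents-surjective xs sums with go xs sums
    where
    go : ∀ {m} (xs : Vec (Vec ℕ d) m) → VecAll.All (λ x → sum x ≡ r) xs →
         ∃[ bs ] (∀ i → Descending (lookup bs i)) × Vec.map (content {m = r}) bs ≡ xs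
    go []       []         = [] , (λ ()) , refl
    go (x ∷ xs) (eq ∷ eqs) with descending-surjective x eq | go xs eqs
    ... | w , dw , counts | bs , dbs , eq′ = w ∷ bs , (λ { zero → dw ; (suc i) → dbs i }) ,
      cong₂ _∷_ (trans (Vec.tabulate-cong counts) (Vec.tabulate∘lookup x)) eq′
  ... | bs , desc , eq = Vec.concat bs , descending⇒blockwise bs desc ,
    trans (cong (Vec.map content) (concat-injective (blocks (Vec.concat bs)) bs (sym (concat-blocks (Vec.concat bs))))) eq

  sum-contents : ∀ a → VecAll.All (λ x → sum x ≡ r) (contents a)
  sum-contents a = VecAll.map⁺ (VecAll.universal sum-content (blocks a))

endpoint≡ : ∀ {d m} (a b : Vec (Fin d) m) k → endpoint (a , b) k ≡ + count k a ℤ.- + count k b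
endpoint≡ a b k = up a b
  where
  flat : ∀ {d} → List (Point d) → Fin d → ℤ
  flat = foldr (λ s p k → s k ℤ.+ p k) (λ _ → 0ℤ)

  down : ∀ {m} (b : Vec (Fin _) m) → flat (map (λ j k → ℤ.- unit j k) (Vec.toList b)) k ≡ ℤ.- + count k b
  down []      = refl
  down (j ∷ b) = trans (cong₂ (λ u v → ℤ.- u ℤ.+ v) (sym (+iverson (j Fin.≟ k))) (down b))
    (trans (sym (ℤ.neg-distrib-+ (+ iverson (j Fin.≟ k)) (+ count k b)))
      (cong ℤ.-_ (sym (ℤ.pos-+ (iverson (j Fin.≟ k)) (count k b)))))

  up : ∀ {m m′} (a : Vec (Fin _) m) (b : Vec (Fin _) m′) →
       flat (map unit (Vec.toList a) ++ map (λ j k → ℤ.- unit j k) (Vec.toList b)) k ≡ + count k a ℤ.- + count k b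
  up []      b = trans (down b) (sym (ℤ.+-identityˡ _))
  up (j ∷ a) b = trans (cong₂ ℤ._+_ (sym (+iverson (j Fin.≟ k))) (up a b))
    (trans (sym (ℤ.+-assoc (+ iverson (j Fin.≟ k)) (+ count k a) (ℤ.- + count k b)))
      (cong (λ z → z ℤ.- + count k b) (sym (ℤ.pos-+ (iverson (j Fin.≟ k)) (count k a)))))

lookup-↑⊖ : ∀ {d} (μ ν : Vec ℕ d) k → lookup (↑ μ ⊖ ν) k ≡ + lookup μ k ℤ.- + lookup ν k
lookup-↑⊖ (l ∷ ls) (n ∷ ns) zero    = refl
lookup-↑⊖ (l ∷ ls) (n ∷ ns) (suc k) = lookup-↑⊖ ls ns k

module _ (n r d : ℕ) where

  private
    Cs : Enumeration (setoid (Vec (Vec ℕ d) n)) (VecAll.All (λ x → sum x ≡ r))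
    Cs = compositionSequences d r n

    cs : Vec (Fin d) (n ℕ.* r) → Vec (Vec ℕ d) n
    cs = contents {n} {r}

    -- Negative steps count positively here: the Toeplitz point is the identity minus `π`, so it is
    -- the negated endpoint that matches `π`.
    difference : Walk d (n ℕ.* r) → Vec ℤ d
    difference (a , b) = ↑ total (cs b) ⊖ total (cs a)

    difference≡ : ∀ w k → lookup (difference w) k ≡ ℤ.- endpoint w k
    difference≡ (a , b) k = begin
      lookup (↑ total (cs b) ⊖ total (cs a)) k
        ≡⟨ lookup-↑⊖ (total (cs b)) (total (cs a)) k ⟩
      + lookup (total (cs b)) k ℤ.- + lookup (total (cs a)) k
        ≡⟨ cong₂ (λ u v → + u ℤ.- + v) (lookup-total-contents {n} {r} b k) (lookup-total-contents {n} {r} a k) ⟩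
      + count k b ℤ.- + count k a
        ≡⟨ lemma (+ count k a) (+ count k b) ⟩
      ℤ.- (+ count k a ℤ.- + count k b)
        ≡⟨ cong ℤ.-_ (endpoint≡ a b k) ⟨
      ℤ.- endpoint (a , b) k ∎
      where
      open ≡-Reasoning
      lemma : ∀ a b → b ℤ.- a ≡ ℤ.- (a ℤ.- b)
      lemma = ℤSolver.solve-∀

    cancel : ∀ k p → k ℤ.- (k ℤ.- p) ≡ p
    cancel = ℤSolver.solve-∀

    toeplitz⇒matches : ∀ (π : Permutation′ d) w → W* d (n ℕ.* r) (toeplitz π) w → Matches (difference w) π
    toeplitz⇒matches π w at k = begin
      lookup (difference w) k ℤ.+ + toℕ k      ≡⟨ cong (λ z → z ℤ.+ + toℕ k) (trans (difference≡ w k) (cong ℤ.-_ (at k))) ⟩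
      ℤ.- toeplitz π k ℤ.+ + toℕ k             ≡⟨ ℤ.+-comm (ℤ.- toeplitz π k) (+ toℕ k) ⟩
      + toℕ k ℤ.- (+ toℕ k ℤ.- + values π k)   ≡⟨ cancel (+ toℕ k) (+ values π k) ⟩
      + values π k                             ∎
      where open ≡-Reasoning

    matches⇒toeplitz : ∀ (π : Permutation′ d) w → Matches (difference w) π → W* d (n ℕ.* r) (toeplitz π) w
    matches⇒toeplitz π w m k = sym (begin
      + toℕ k ℤ.- + values π k                                 ≡⟨ cong (λ z → + toℕ k ℤ.- z) (m k) ⟨
      + toℕ k ℤ.- (lookup (difference w) k ℤ.+ + toℕ k)        ≡⟨ cong (λ z → + toℕ k ℤ.- (z ℤ.+ + toℕ k)) (difference≡ w k) ⟩
      + toℕ k ℤ.- (ℤ.- endpoint w k ℤ.+ + toℕ k)               ≡⟨ lemma (+ toℕ k) (endpoint w k) ⟩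
      endpoint w k                                             ∎)
      where
      open ≡-Reasoning
      lemma : ∀ k e → k ℤ.- (ℤ.- e ℤ.+ k) ≡ e
      lemma = ℤSolver.solve-∀

    walk-sequences : (π : Permutation′ d) → Enumeration (setoid (Vec (Vec ℕ d) n × Vec (Vec ℕ d) n)) _
    walk-sequences π = enumerate-∩ (λ (xs , ys) → matches? (↑ total xs ⊖ total ys) π) (enumerate-× Cs Cs)

  ∣W′∣≡ : ∀ (π : Permutation′ d) → + ∣ enumerate-W′ n r d (toeplitz π) ∣ ≡
          ∑ₗ (elements Cs) (λ xs → ∑ₗ (elements Cs) (λ ys → ⟦ matches? (↑ total xs ⊖ total ys) π ⟧))
  ∣W′∣≡ π = begin
    + ∣ enumerate-W′ n r d (toeplitz π) ∣
      ≡⟨ cong (λ k → + k) (∣∣-bijection (enumerate-W′ n r d (toeplitz π)) (walk-sequences π)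
           (λ (a , b) → cs b , cs a)
           (λ {w} (at , _ , _) → (sum-contents {n} {r} (proj₂ w) , sum-contents {n} {r} (proj₁ w)) , toeplitz⇒matches π w at)
           injective surjective) ⟩
    + ∣ walk-sequences π ∣
      ≡⟨ length-filter _ (cartesianProduct (elements Cs) (elements Cs)) ⟩
    ∑ₗ (cartesianProduct (elements Cs) (elements Cs)) (λ (xs , ys) → ⟦ matches? (↑ total xs ⊖ total ys) π ⟧)
      ≡⟨ ∑ₗ-cartesianProductWith _,_ (elements Cs) (elements Cs) _ ⟩
    ∑ₗ (elements Cs) (λ xs → ∑ₗ (elements Cs) (λ ys → ⟦ matches? (↑ total xs ⊖ total ys) π ⟧)) ∎
    where
    open ≡-Reasoning

    injective : ∀ {w w′ : Walk d (n ℕ.* r)} → W′ n r d (toeplitz π) w → W′ n r d (toeplitz π) w′ →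
                (cs (proj₂ w) , cs (proj₁ w)) ≡ (cs (proj₂ w′) , cs (proj₁ w′)) → w ≡ w′
    injective {a , b} {a′ , b′} (_ , da , db) (_ , da′ , db′) eq =
      cong₂ _,_ (contents-injective {n} {r} a a′ da da′ (cong proj₂ eq)) (contents-injective {n} {r} b b′ db db′ (cong proj₁ eq))

    surjective : ∀ {p} → _ → ∃[ w ] W′ n r d (toeplitz π) w × (cs (proj₂ w) , cs (proj₁ w)) ≡ p
    surjective {xs , ys} ((sx , sy) , m) with contents-surjective {n} {r} xs sx | contents-surjective {n} {r} ys sy
    ... | b , db , refl | a , da , refl = (a , b) , (matches⇒toeplitz π (a , b) m , da , db) , refl

  signed-walks : ∑ (S d) (λ π → sgn π * + ∣ enumerate-W′ n r d (toeplitz π) ∣) ≡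
    ∑ₗ (elements Cs) (λ xs → ∑ₗ (elements Cs) (λ ys → alternant (↑ total xs ⊖ total ys)))
  signed-walks = begin
    ∑ (S d) (λ π → sgn π * + ∣ enumerate-W′ n r d (toeplitz π) ∣)
      ≡⟨ foldr≡∑ₗ (elements (S d)) _ ⟩
    ∑ₗ (elements (S d)) (λ π → sgn π * + ∣ enumerate-W′ n r d (toeplitz π) ∣)
      ≡⟨ ∑ₗ-cong (elements (S d)) (λ π → trans (cong (sgn π *_) (∣W′∣≡ π)) (trans (sym (∑ₗ-*ˡ (elements Cs) (sgn π) _))
           (∑ₗ-cong (elements Cs) (λ xs → sym (∑ₗ-*ˡ (elements Cs) (sgn π) _))))) ⟩
    ∑ₗ (elements (S d)) (λ π → ∑ₗ (elements Cs) (λ xs → ∑ₗ (elements Cs) (λ ys → sgn π * ⟦ matches? (↑ total xs ⊖ total ys) π ⟧)))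
      ≡⟨ ∑ₗ-swap (elements (S d)) (elements Cs) _ ⟩
    ∑ₗ (elements Cs) (λ xs → ∑ₗ (elements (S d)) (λ π → ∑ₗ (elements Cs) (λ ys → sgn π * ⟦ matches? (↑ total xs ⊖ total ys) π ⟧)))
      ≡⟨ ∑ₗ-cong (elements Cs) (λ xs → ∑ₗ-swap (elements (S d)) (elements Cs) _) ⟩
    ∑ₗ (elements Cs) (λ xs → ∑ₗ (elements Cs) (λ ys → alternant (↑ total xs ⊖ total ys))) ∎
    where open ≡-Reasoning

  towerPair? : Decidable (λ ((xs , ys) : Vec (Vec ℕ d) n × Vec (Vec ℕ d) n) → Tower xs × Tower ys × ↑ total xs ≡ ↑ total ys)
  towerPair? (xs , ys) = tower? xs ×-dec tower? ys ×-dec (↑ total xs ≟ᵛ ↑ total ys)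

  towerPairs : Enumeration (setoid (Vec (Vec ℕ d) n × Vec (Vec ℕ d) n)) _
  towerPairs = enumerate-∩ towerPair? (enumerate-× Cs Cs)

  signed-walks≡towerPairs : ∑ (S d) (λ π → sgn π * + ∣ enumerate-W′ n r d (toeplitz π) ∣) ≡ + ∣ towerPairs ∣
  signed-walks≡towerPairs = trans signed-walks (trans (reflection d r n) (sym (begin
    + ∣ towerPairs ∣
      ≡⟨ length-filter towerPair? (cartesianProduct (elements Cs) (elements Cs)) ⟩
    ∑ₗ (cartesianProduct (elements Cs) (elements Cs)) (λ p → ⟦ towerPair? p ⟧)
      ≡⟨ ∑ₗ-cartesianProductWith _,_ (elements Cs) (elements Cs) (λ p → ⟦ towerPair? p ⟧) ⟩
    ∑ₗ (elements Cs) (λ xs → ∑ₗ (elements Cs) (λ ys → ⟦ towerPair? (xs , ys) ⟧))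
      ≡⟨ ∑ₗ-cong (elements Cs) (λ xs → trans (∑ₗ-cong (elements Cs) (λ ys → split xs ys))
           (∑ₗ-*ˡ (elements Cs) ⟦ tower? xs ⟧ _)) ⟩
    ∑ₗ (elements Cs) (λ xs → ⟦ tower? xs ⟧ * ∑ₗ (elements Cs) (λ ys → ⟦ tower? ys ⟧ * ⟦ ↑ total xs ≟ᵛ ↑ total ys ⟧)) ∎)))
    where
    open ≡-Reasoning
    split : ∀ xs ys → ⟦ towerPair? (xs , ys) ⟧ ≡ ⟦ tower? xs ⟧ * (⟦ tower? ys ⟧ * ⟦ ↑ total xs ≟ᵛ ↑ total ys ⟧)
    split xs ys = trans (⟦⟧-× (tower? xs) (tower? ys ×-dec (↑ total xs ≟ᵛ ↑ total ys)))
      (cong (⟦ tower? xs ⟧ *_) (⟦⟧-× (tower? ys) (↑ total xs ≟ᵛ ↑ total ys)))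

-- Growth diagrams

-- Burge's local rule, applied from the bottom row upwards: l, m and p run through
-- the rows of λ, μ and ρ, A is the larger of the previous entries of λ and μ, and
-- c is the carry.  The first entry of the result is the overflow into row d + 1.
grow : ∀ {d} → ℕ → ℕ → (ls ms ps : Vec ℕ d) → Vec ℕ (suc d)
grow A c []       []       []       = A + c ∷ []
grow A c (l ∷ ls) (m ∷ ms) (p ∷ ps) =
  (A + c) ⊓ p ∷ grow (l ⊔ m) (((A + c) ∸ p) + ((l ⊓ m) ∸ p)) ls ms ps

-- The inverse rule, run from the top row down. The incoming carry takes cells away from `l ⊓ m`,
-- but never below `o`; what it cannot take is passed to the row below together with `o ∸ A`.
shrink : ∀ {d} → ℕ → Vec ℕ (suc d) → (ls ms : Vec ℕ d) → Vec ℕ d × ℕ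
shrink A (o ∷ [])     []       []       = [] , o ∸ A
shrink A (o ∷ n ∷ ns) (l ∷ ls) (m ∷ ms) =
  let (ps , c) = shrink (l ⊔ m) (n ∷ ns) ls ms
  in ((l ⊓ m) ∸ c) ⊔ o ∷ ps , (o ∸ A) + ((o + c) ∸ (l ⊓ m))

-- The strip conditions of `ps` under `ls` and under `ms`, merged so that they involve just the
-- `l ⊓ m` and `l ⊔ m` of the local rule. `Outer` does the same for the strips on the other side.
Inner : ∀ {d} → ℕ → (ps ls ms : Vec ℕ d) → Set
Inner A []       []       []       = ⊤
Inner A (p ∷ ps) (l ∷ ls) (m ∷ ms) = A ≤ p × p ≤ l ⊓ m × Inner (l ⊔ m) ps ls ms

Outer : ∀ {d} → ℕ → Vec ℕ (suc d) → (ls ms : Vec ℕ d) → Set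
Outer A (o ∷ [])     []       []       = A ≤ o
Outer A (o ∷ n ∷ ns) (l ∷ ls) (m ∷ ms) = A ≤ o × o ≤ l ⊓ m × Outer (l ⊔ m) (n ∷ ns) ls ms

inner⁺ : ∀ {d} {a b} (ps ls ms : Vec ℕ d) → Interlaced a ps ls → Interlaced b ps ms → Inner (a ⊔ b) ps ls ms
inner⁺ []       []       []       _               _                 = tt
inner⁺ (p ∷ ps) (l ∷ ls) (m ∷ ms) (a≤p , p≤l , i) (b≤p , p≤m , i′) =
  ℕ.⊔-lub a≤p b≤p , ℕ.⊓-glb p≤l p≤m , inner⁺ ps ls ms i i′

inner⁻ : ∀ {d} {a b} (ps ls ms : Vec ℕ d) → Inner (a ⊔ b) ps ls ms → Interlaced a ps ls × Interlaced b ps ms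
inner⁻ []       []       []       _ = tt , tt
inner⁻ {a = a} {b} (p ∷ ps) (l ∷ ls) (m ∷ ms) (A≤p , p≤B , i) with inner⁻ {a = l} {m} ps ls ms i
... | iˡ , iᵐ = (ℕ.m⊔n≤o⇒m≤o a b A≤p , ℕ.m≤n⊓o⇒m≤n l m p≤B , iˡ) , (ℕ.m⊔n≤o⇒n≤o a b A≤p , ℕ.m≤n⊓o⇒m≤o l m p≤B , iᵐ)

outer⁺ : ∀ {d} {A o} (ns ls ms : Vec ℕ d) → A ≤ o → Interlaced o ls ns → Interlaced o ms ns → Outer A (o ∷ ns) ls ms
outer⁺ []       []       []       A≤o _               _                = A≤o
outer⁺ (n ∷ ns) (l ∷ ls) (m ∷ ms) A≤o (o≤l , l≤n , i) (o≤m , m≤n , i′) =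
  A≤o , ℕ.⊓-glb o≤l o≤m , outer⁺ ns ls ms (ℕ.⊔-lub l≤n m≤n) i i′

outer⁻ : ∀ {d} {A o} (ns ls ms : Vec ℕ d) → Outer A (o ∷ ns) ls ms → A ≤ o × Interlaced o ls ns × Interlaced o ms ns
outer⁻ []       []       []       A≤o = A≤o , tt , tt
outer⁻ (n ∷ ns) (l ∷ ls) (m ∷ ms) (A≤o , o≤B , out) with outer⁻ ns ls ms out
... | l⊔m≤n , iˡ , iᵐ = A≤o , (ℕ.m≤n⊓o⇒m≤n l m o≤B , ℕ.m⊔n≤o⇒m≤o l m l⊔m≤n , iˡ) ,
                               (ℕ.m≤n⊓o⇒m≤o l m o≤B , ℕ.m⊔n≤o⇒n≤o l m l⊔m≤n , iᵐ)

module _ {A B p : ℕ} (c : ℕ) (A≤p : A ≤ p) (p≤B : p ≤ B) where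

  private
    o = (A + c) ⊓ p
    c′ = ((A + c) ∸ p) + (B ∸ p)

  -- If `A + c ≤ p`, the new entry absorbs the whole carry and `B ∸ p` is passed on. Otherwise the
  -- entry stops at `p` and the surplus is passed on as well. In each case the truncated
  -- subtractions become exact or zero.
  cell-inverse : (B ∸ c′) ⊔ o ≡ p × (o ∸ A) + ((o + c′) ∸ B) ≡ c
  cell-inverse with ℕ.≤-total (A + c) p
  ... | inj₁ A+c≤p rewrite ℕ.m≤n⇒m⊓n≡m A+c≤p | ℕ.m≤n⇒m∸n≡0 A+c≤p =
    trans (cong (_⊔ (A + c)) (ℕ.m∸[m∸n]≡n p≤B)) (ℕ.m≥n⇒m⊔n≡m A+c≤p) ,
    trans (cong₂ _+_ (ℕ.m+n∸m≡n A c) (ℕ.m≤n⇒m∸n≡0 (ℕ.≤-trans (ℕ.+-monoˡ-≤ (B ∸ p) A+c≤p) (ℕ.≤-reflexive (ℕ.m+[n∸m]≡n p≤B)))))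
      (ℕ.+-identityʳ c)
  ... | inj₂ p≤A+c rewrite ℕ.m≥n⇒m⊓n≡n p≤A+c =
    ℕ.m≤n⇒m⊔n≡n (ℕ.≤-trans (ℕ.∸-monoʳ-≤ B (ℕ.m≤n+m (B ∸ p) ((A + c) ∸ p))) (ℕ.≤-reflexive (ℕ.m∸[m∸n]≡n p≤B))) ,
    ℕ.+-cancelˡ-≡ A _ _ (begin
      A + ((p ∸ A) + ((p + (e + (B ∸ p))) ∸ B))   ≡⟨ ℕ.+-assoc A (p ∸ A) _ ⟨
      (A + (p ∸ A)) + ((p + (e + (B ∸ p))) ∸ B)   ≡⟨ cong₂ _+_ (ℕ.m+[n∸m]≡n A≤p) (cong (_∸ B) (lemma p e (B ∸ p))) ⟩
      p + (((p + (B ∸ p)) + e) ∸ B)               ≡⟨ cong (λ z → p + ((z + e) ∸ B)) (ℕ.m+[n∸m]≡n p≤B) ⟩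
      p + ((B + e) ∸ B)                           ≡⟨ cong (λ z → p + z) (ℕ.m+n∸m≡n B e) ⟩
      p + e                                       ≡⟨ ℕ.m+[n∸m]≡n p≤A+c ⟩
      A + c                                       ∎)
    where
    open ≡-Reasoning
    e = (A + c) ∸ p
    lemma : ∀ p e b → p + (e + b) ≡ (p + b) + e
    lemma = ℕSolver.solve-∀

  cell-size : o + p + c′ ≡ A + B + c
  cell-size = begin
    (A + c) ⊓ p + p + (((A + c) ∸ p) + (B ∸ p))       ≡⟨ cong (λ z → z + p + c′) (ℕ.⊓-comm (A + c) p) ⟩
    p ⊓ (A + c) + p + (((A + c) ∸ p) + (B ∸ p))       ≡⟨ lemma (p ⊓ (A + c)) p ((A + c) ∸ p) (B ∸ p) ⟩
    (p ⊓ (A + c) + ((A + c) ∸ p)) + (p + (B ∸ p))     ≡⟨ cong₂ _+_ (ℕ.m⊓n+n∸m≡n p (A + c)) (ℕ.m+[n∸m]≡n p≤B) ⟩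
    A + c + B                                         ≡⟨ lemma′ A c B ⟩
    A + B + c                                         ∎
    where
    open ≡-Reasoning
    lemma : ∀ u p v w → u + p + (v + w) ≡ (u + v) + (p + w)
    lemma = ℕSolver.solve-∀
    lemma′ : ∀ a c b → a + c + b ≡ a + b + c
    lemma′ = ℕSolver.solve-∀

module _ {A B o : ℕ} (c : ℕ) (A≤o : A ≤ o) (o≤B : o ≤ B) where

  private
    p = (B ∸ c) ⊔ o
    c′ = (o ∸ A) + ((o + c) ∸ B)

    A+c′ : A + c′ ≡ o + ((o + c) ∸ B)
    A+c′ = trans (sym (ℕ.+-assoc A (o ∸ A) _)) (cong (_+ ((o + c) ∸ B)) (ℕ.m+[n∸m]≡n A≤o))

  cell-inverse′ : (A + c′) ⊓ p ≡ o × ((A + c′) ∸ p) + (B ∸ p) ≡ c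
  cell-inverse′ rewrite A+c′ with ℕ.≤-total (o + c) B
  ... | inj₁ o+c≤B rewrite ℕ.m≤n⇒m∸n≡0 o+c≤B | ℕ.+-identityʳ o | ℕ.m≥n⇒m⊔n≡m (ℕ.m+n≤o⇒m≤o∸n o o+c≤B) =
    ℕ.m≤n⇒m⊓n≡m (ℕ.m+n≤o⇒m≤o∸n o o+c≤B) ,
    cong₂ _+_ (ℕ.m≤n⇒m∸n≡0 (ℕ.m+n≤o⇒m≤o∸n o o+c≤B)) (ℕ.m∸[m∸n]≡n (ℕ.m+n≤o⇒n≤o o o+c≤B))
  ... | inj₂ B≤o+c rewrite ℕ.m≤n⇒m⊔n≡n (ℕ.m≤n+o⇒m∸n≤o B c (ℕ.≤-trans B≤o+c (ℕ.≤-reflexive (ℕ.+-comm o c)))) =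
    ℕ.m≥n⇒m⊓n≡n (ℕ.m≤m+n o f) ,
    ℕ.+-cancelˡ-≡ o _ _ (begin
      o + (((o + f) ∸ o) + (B ∸ o))   ≡⟨ cong (λ z → o + (z + (B ∸ o))) (ℕ.m+n∸m≡n o f) ⟩
      o + (f + (B ∸ o))               ≡⟨ lemma o f (B ∸ o) ⟩
      (o + (B ∸ o)) + f               ≡⟨ cong (_+ f) (ℕ.m+[n∸m]≡n o≤B) ⟩
      B + f                           ≡⟨ ℕ.m+[n∸m]≡n B≤o+c ⟩
      o + c                           ∎)
    where
    open ≡-Reasoning
    f = (o + c) ∸ B
    lemma : ∀ o f b → o + (f + b) ≡ (o + b) + f
    lemma = ℕSolver.solve-∀

grow-outer : ∀ {d} A c (ls ms ps : Vec ℕ d) → Inner A ps ls ms → Outer A (grow A c ls ms ps) ls ms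
grow-outer A c []       []       []       _ = ℕ.m≤m+n A c
grow-outer A c (l ∷ ls) (m ∷ ms) (p ∷ ps) (A≤p , p≤B , i)
  with grow (l ⊔ m) (((A + c) ∸ p) + ((l ⊓ m) ∸ p)) ls ms ps
     | grow-outer (l ⊔ m) (((A + c) ∸ p) + ((l ⊓ m) ∸ p)) ls ms ps i
... | n ∷ ns | out = ℕ.⊓-glb (ℕ.m≤m+n A c) A≤p , ℕ.≤-trans (ℕ.m⊓n≤n (A + c) p) p≤B , out

shrink-grow : ∀ {d} A c (ls ms ps : Vec ℕ d) → Inner A ps ls ms → shrink A (grow A c ls ms ps) ls ms ≡ (ps , c)
shrink-grow A c []       []       []       _ = cong ([] ,_) (ℕ.m+n∸m≡n A c)
shrink-grow A c (l ∷ ls) (m ∷ ms) (p ∷ ps) (A≤p , p≤B , i)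
  with grow (l ⊔ m) (((A + c) ∸ p) + ((l ⊓ m) ∸ p)) ls ms ps
     | shrink-grow (l ⊔ m) (((A + c) ∸ p) + ((l ⊓ m) ∸ p)) ls ms ps i
... | n ∷ ns | eq rewrite eq = cong₂ (λ q c → q ∷ ps , c) (proj₁ (cell-inverse c A≤p p≤B)) (proj₂ (cell-inverse c A≤p p≤B))

grow-shrink : ∀ {d} A (ns : Vec ℕ (suc d)) ls ms → Outer A ns ls ms →
  let (ps , c) = shrink A ns ls ms in grow A c ls ms ps ≡ ns × Inner A ps ls ms
grow-shrink A (o ∷ [])     []       []       A≤o = cong (_∷ []) (ℕ.m+[n∸m]≡n A≤o) , tt
grow-shrink A (o ∷ n ∷ ns) (l ∷ ls) (m ∷ ms) (A≤o , o≤B , out)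
  with shrink (l ⊔ m) (n ∷ ns) ls ms | grow-shrink (l ⊔ m) (n ∷ ns) ls ms out
... | ps , c | eq , i =
  cong₂ _∷_ (proj₁ (cell-inverse′ c A≤o o≤B))
    (trans (cong (λ z → grow (l ⊔ m) z ls ms ps) (proj₂ (cell-inverse′ c A≤o o≤B))) eq) ,
  (ℕ.≤-trans A≤o (ℕ.m≤n⊔m ((l ⊓ m) ∸ c) o) , ℕ.⊔-lub (ℕ.m∸n≤m (l ⊓ m) c) o≤B , i)

m⊓n+m⊔n≡m+n : ∀ m n → (m ⊓ n) + (m ⊔ n) ≡ m + n
m⊓n+m⊔n≡m+n m n with ℕ.≤-total m n
... | inj₁ m≤n rewrite ℕ.m≤n⇒m⊓n≡m m≤n | ℕ.m≤n⇒m⊔n≡n m≤n = refl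
... | inj₂ n≤m rewrite ℕ.m≥n⇒m⊓n≡n n≤m | ℕ.m≥n⇒m⊔n≡m n≤m = ℕ.+-comm n m

-- Conservation of cells. In each row `cell-size` balances the entries against the incoming and
-- outgoing carries, and the `l ⊓ m` used in a row and the `l ⊔ m` handed to the next one add up to
-- `l + m`.
grow-size : ∀ {d} A c (ls ms ps : Vec ℕ d) → Inner A ps ls ms →
            sum (grow A c ls ms ps) + sum ps ≡ A + sum ls + sum ms + c
grow-size A c []       []       []       _ = lemma A c
  where
  lemma : ∀ a c → a + c + 0 + 0 ≡ a + 0 + 0 + c
  lemma = ℕSolver.solve-∀
grow-size A c (l ∷ ls) (m ∷ ms) (p ∷ ps) (A≤p , p≤B , i) = ℕ.+-cancelʳ-≡ c′ _ _ (begin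
  (o + G) + (p + sum ps) + c′
    ≡⟨ shuffle o G p (sum ps) c′ ⟩
  (o + p + c′) + (G + sum ps)
    ≡⟨ cong₂ _+_ (cell-size c A≤p p≤B) (grow-size (l ⊔ m) c′ ls ms ps i) ⟩
  (A + (l ⊓ m) + c) + ((l ⊔ m) + sum ls + sum ms + c′)
    ≡⟨ shuffle′ A (l ⊓ m) c (l ⊔ m) (sum ls) (sum ms) c′ ⟩
  A + sum ls + sum ms + c + ((l ⊓ m) + (l ⊔ m)) + c′
    ≡⟨ cong (λ z → A + sum ls + sum ms + c + z + c′) (m⊓n+m⊔n≡m+n l m) ⟩
  A + sum ls + sum ms + c + (l + m) + c′
    ≡⟨ shuffle″ A (sum ls) (sum ms) c l m c′ ⟩
  A + (l + sum ls) + (m + sum ms) + c + c′ ∎)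
  where
  open ≡-Reasoning
  o = (A + c) ⊓ p
  c′ = ((A + c) ∸ p) + ((l ⊓ m) ∸ p)
  G = sum (grow (l ⊔ m) c′ ls ms ps)
  shuffle : ∀ o g p q c → (o + g) + (p + q) + c ≡ (o + p + c) + (g + q)
  shuffle = ℕSolver.solve-∀
  shuffle′ : ∀ a b c d e f h → (a + b + c) + (d + e + f + h) ≡ a + e + f + c + (b + d) + h
  shuffle′ = ℕSolver.solve-∀
  shuffle″ : ∀ a e f c l m h → a + e + f + c + (l + m) + h ≡ a + (l + e) + (m + f) + c + h
  shuffle″ = ℕSolver.solve-∀

private variable
  d m n : ℕ

∅≺∅ : ∀ d → ∅ {d} ≺ ∅
∅≺∅ zero    = tt
∅≺∅ (suc d) = z≤n , z≤n , ∅≺∅ d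

≺∅⇒≡∅ : (μ : Vec ℕ d) → μ ≺ ∅ → μ ≡ ∅
≺∅⇒≡∅ []      _             = refl
≺∅⇒≡∅ (l ∷ μ) (_ , z≤n , i) = cong (0 ∷_) (≺∅⇒≡∅ μ i)

-- The default supplies the empty shapes on the outer border of the diagram.
first : Vec (Vec ℕ d) n → Vec ℕ d
first []       = ∅
first (μ ∷ μs) = μ

Chain : Vec (Vec ℕ d) n → Set
Chain []       = ⊤
Chain (μ ∷ μs) = first μs ≺ μ × Chain μs

-- One row of a growth diagram, filled from right to left: μs are the shapes along
-- its lower border and ks its entries.
insert : Vec (Vec ℕ d) n → Vec ℕ n → Vec (Vec ℕ d) n
insert []       []       = []
insert (μ ∷ μs) (k ∷ ks) = Vec.tail (grow 0 k μ (first (insert μs ks)) (first μs)) ∷ insert μs ks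

-- No cell of the row overflows into row `d + 1`, so the `Vec.tail` in `insert` loses nothing.
Fits : Vec (Vec ℕ d) n → Vec ℕ n → Set
Fits []       []       = ⊤
Fits (μ ∷ μs) (k ∷ ks) = Vec.head (grow 0 k μ (first (insert μs ks)) (first μs)) ≡ 0 × Fits μs ks

-- Runs from left to right: each cell yields its entry and the shape `ρ` at its lower right corner,
-- which is the lower left corner of the next cell. The `0` put in front of `ν` is the empty row
-- `d + 1`.
extract : Vec (Vec ℕ d) n → Vec ℕ d → Vec (Vec ℕ d) n × Vec ℕ n
extract []       μ = [] , []
extract (ν ∷ νs) μ =
  let (ρ , k) = shrink 0 (0 ∷ ν) μ (first νs)
      (μs , ks) = extract νs ρ
  in μ ∷ μs , k ∷ ks

outer-tail : ∀ {A} (ns : Vec ℕ (suc d)) {ls ms} → Outer A ns ls ms → Vec.head ns ≡ 0 → ls ≺ Vec.tail ns × ms ≺ Vec.tail ns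
outer-tail (_ ∷ ns) {ls} {ms} out refl = proj₂ (outer⁻ ns ls ms out)

insert-chain : (μs : Vec (Vec ℕ d) n) (ks : Vec ℕ n) → Chain μs → Fits μs ks →
               Chain (insert μs ks) × first μs ≺ first (insert μs ks)
insert-chain {d} [] [] _ _ = tt , ∅≺∅ d
insert-chain (μ ∷ μs) (k ∷ ks) (ρ≺μ , chain) (o≡0 , fits) with insert-chain μs ks chain fits
... | chain′ , ρ≺ν
  with outer-tail _ (grow-outer 0 k μ (first (insert μs ks)) (first μs) (inner⁺ (first μs) μ _ ρ≺μ ρ≺ν)) o≡0
...   | μ≺ν′ , ν≺ν′ = (ν≺ν′ , chain′) , μ≺ν′

0∷tail : (ns : Vec ℕ (suc d)) → Vec.head ns ≡ 0 → 0 ∷ Vec.tail ns ≡ ns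
0∷tail (_ ∷ ns) refl = refl

extract-insert : (μs : Vec (Vec ℕ d) n) (ks : Vec ℕ n) → Chain μs → Fits μs ks →
                 extract (insert μs ks) (first μs) ≡ (μs , ks)
extract-insert []       []       _             _ = refl
extract-insert (μ ∷ μs) (k ∷ ks) (ρ≺μ , chain) (o≡0 , fits)
  rewrite 0∷tail (grow 0 k μ (first (insert μs ks)) (first μs)) o≡0
        | shrink-grow 0 k μ (first (insert μs ks)) (first μs)
            (inner⁺ (first μs) μ _ ρ≺μ (proj₂ (insert-chain μs ks chain fits)))
        | extract-insert μs ks chain fits = refl

insert-extract : (νs : Vec (Vec ℕ d) n) (μ : Vec ℕ d) → Chain νs → μ ≺ first νs →
  let (μs , ks) = extract νs μ in Chain μs × Fits μs ks × insert μs ks ≡ νs × first μs ≡ μ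
insert-extract []       μ _             μ≺∅ = tt , tt , refl , sym (≺∅⇒≡∅ μ μ≺∅)
insert-extract (ν ∷ νs) μ (ν′≺ν , chain) μ≺ν
  with shrink 0 (0 ∷ ν) μ (first νs) | grow-shrink 0 (0 ∷ ν) μ (first νs) (outer⁺ ν μ (first νs) z≤n μ≺ν ν′≺ν)
... | ρ , k | eq , inner with inner⁻ {a = 0} {0} ρ μ (first νs) inner
...   | ρ≺μ , ρ≺ν′ with extract νs ρ | insert-extract νs ρ chain ρ≺ν′
...     | μs , ks | chain′ , fits , refl , refl =
  (ρ≺μ , chain′) , (cong Vec.head eq , fits) , cong (_∷ insert μs ks) (cong Vec.tail eq) , refl

-- The last row of the matrix is inserted first, so each shape belongs to a lower right submatrix:
-- the rows inserted so far and the columns from its own onwards.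
shapes : (d : ℕ) → Vec (Vec ℕ n) m → Vec (Vec ℕ d) n
shapes d []      = Vec.replicate _ ∅
shapes d (k ∷ M) = insert (shapes d M) k

AllFit : ℕ → Vec (Vec ℕ n) m → Set
AllFit d []      = ⊤
AllFit d (k ∷ M) = Fits (shapes d M) k × AllFit d M

firsts : (d : ℕ) → Vec (Vec ℕ n) m → Vec (Vec ℕ d) m
firsts d []      = []
firsts d (k ∷ M) = first (shapes d (k ∷ M)) ∷ firsts d M

-- The upper and left borders determine the diagram: `first μs` is the left end of the lower border
-- of the current row, and `extract` needs nothing else from below.
rebuild : Vec (Vec ℕ d) n → Vec (Vec ℕ d) m → Vec (Vec ℕ n) m
rebuild νs []       = []
rebuild νs (μ ∷ μs) = let (ρs , k) = extract νs (first μs) in k ∷ rebuild ρs μs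

first-replicate : ∀ d n → first (Vec.replicate n (∅ {d})) ≡ ∅
first-replicate d zero    = refl
first-replicate d (suc n) = refl

first-firsts : ∀ d (M : Vec (Vec ℕ n) m) → first (firsts d M) ≡ first (shapes d M)
first-firsts {n} d [] = sym (first-replicate d n)
first-firsts d (k ∷ M)    = refl

chain-replicate : ∀ d n → Chain (Vec.replicate n (∅ {d}))
chain-replicate d zero    = tt
chain-replicate d (suc n) = subst (_≺ ∅) (sym (first-replicate d n)) (∅≺∅ d) , chain-replicate d n

chain-∅ : (νs : Vec (Vec ℕ d) n) → Chain νs → first νs ≡ ∅ → νs ≡ Vec.replicate n ∅
chain-∅ []       _             _    = refl
chain-∅ (ν ∷ νs) (ν′≺ν , chain) refl = cong (∅ ∷_) (chain-∅ νs chain (≺∅⇒≡∅ (first νs) ν′≺ν))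

shapes-chain : ∀ d (M : Vec (Vec ℕ n) m) → AllFit d M → Chain (shapes d M)
shapes-chain {n} d [] _   = chain-replicate d n
shapes-chain d (k ∷ M) (fits , all) = proj₁ (insert-chain (shapes d M) k (shapes-chain d M all) fits)

firsts-chain : ∀ d (M : Vec (Vec ℕ n) m) → AllFit d M → Chain (firsts d M)
firsts-chain d [] _ = tt
firsts-chain d (k ∷ M) (fits , all) =
  subst (_≺ first (shapes d (k ∷ M))) (sym (first-firsts d M)) (proj₂ (insert-chain (shapes d M) k (shapes-chain d M all) fits)) , firsts-chain d M all

rebuild-shapes : ∀ d (M : Vec (Vec ℕ n) m) → AllFit d M → rebuild (shapes d M) (firsts d M) ≡ M
rebuild-shapes d [] _ = refl
rebuild-shapes d (k ∷ M) (fits , all)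
  rewrite first-firsts d M | extract-insert (shapes d M) k (shapes-chain d M all) fits
  = cong (k ∷_) (rebuild-shapes d M all)

-- The two borders share a corner, the shape of the whole matrix. When the left border is used up
-- this corner is empty, and `chain-∅` then empties the entire upper border.
shapes-rebuild : ∀ {d n m} (νs : Vec (Vec ℕ d) n) (μs : Vec (Vec ℕ d) m) → Chain νs → Chain μs → first νs ≡ first μs →
  AllFit d (rebuild νs μs) × shapes d (rebuild νs μs) ≡ νs × firsts d (rebuild νs μs) ≡ μs
shapes-rebuild νs [] chain _ eq = tt , sym (chain-∅ νs chain eq) , refl
shapes-rebuild νs (μ ∷ μs) chain (μ′≺μ , chain′) refl
  with extract νs (first μs) | insert-extract νs (first μs) chain μ′≺μ
... | ρs , k | chain″ , fits , refl , eq with shapes-rebuild ρs μs chain″ chain′ eq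
...   | all , shapes≡ , firsts≡ =
  (subst (λ z → Fits z k) (sym shapes≡) fits , all) ,
  cong (λ z → insert z k) shapes≡ ,
  cong₂ _∷_ (cong (λ z → first (insert z k)) shapes≡) firsts≡

StepSizes : Vec (Vec ℕ d) n → Vec ℕ n → Set
StepSizes []       []       = ⊤
StepSizes (μ ∷ μs) (s ∷ ss) = sum μ ≡ sum (first μs) + s × StepSizes μs ss

stepSizes-unique : (μs : Vec (Vec ℕ d) n) {ss ss′ : Vec ℕ n} → StepSizes μs ss → StepSizes μs ss′ → ss ≡ ss′
stepSizes-unique []       {[]}     {[]}       _          _            = refl
stepSizes-unique (μ ∷ μs) {s ∷ ss} {s′ ∷ ss′} (eq , sz) (eq′ , sz′) =
  cong₂ _∷_ (ℕ.+-cancelˡ-≡ (sum (first μs)) s s′ (trans (sym eq) eq′)) (stepSizes-unique μs sz sz′)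

private
  cell-sum : ∀ k (μ ν ρ : Vec ℕ d) → ρ ≺ μ → ρ ≺ ν → Vec.head (grow 0 k μ ν ρ) ≡ 0 →
             sum (Vec.tail (grow 0 k μ ν ρ)) + sum ρ ≡ sum μ + sum ν + k
  cell-sum k μ ν ρ ρ≺μ ρ≺ν o≡0 =
    trans (cong (_+ sum ρ) (sym (head-0 (grow 0 k μ ν ρ) o≡0))) (grow-size 0 k μ ν ρ (inner⁺ ρ μ ν ρ≺μ ρ≺ν))
    where
    head-0 : (ns : Vec ℕ (suc d)) → Vec.head ns ≡ 0 → sum ns ≡ sum (Vec.tail ns)
    head-0 (_ ∷ ns) refl = refl

insert-sum : (μs : Vec (Vec ℕ d) n) (ks : Vec ℕ n) → Chain μs → Fits μs ks →
             sum (first (insert μs ks)) ≡ sum (first μs) + sum ks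
insert-sum {d} [] [] _ _ = sym (ℕ.+-identityʳ _)
insert-sum (μ ∷ μs) (k ∷ ks) (ρ≺μ , chain) (o≡0 , fits) = ℕ.+-cancelʳ-≡ (sum (first μs)) _ _ (begin
  sum (first (insert (μ ∷ μs) (k ∷ ks))) + sum (first μs)
    ≡⟨ cell-sum k μ (first (insert μs ks)) (first μs) ρ≺μ (proj₂ (insert-chain μs ks chain fits)) o≡0 ⟩
  sum μ + sum (first (insert μs ks)) + k
    ≡⟨ cong (λ z → sum μ + z + k) (insert-sum μs ks chain fits) ⟩
  sum μ + (sum (first μs) + sum ks) + k
    ≡⟨ lemma (sum μ) (sum (first μs)) (sum ks) k ⟩
  sum μ + (k + sum ks) + sum (first μs) ∎)
  where
  open ≡-Reasoning
  lemma : ∀ a b c k → a + (b + c) + k ≡ a + (k + c) + b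
  lemma = ℕSolver.solve-∀

-- By conservation of cells the step in a column grows by the entry placed there. Starting from
-- empty shapes, the steps along the upper border become the column sums, just as `insert-sum` makes
-- those along the left border the row sums.
insert-stepSizes : (μs : Vec (Vec ℕ d) n) (ks ss : Vec ℕ n) → Chain μs → Fits μs ks →
                   StepSizes μs ss → StepSizes (insert μs ks) (ss ⊞ ks)
insert-stepSizes []       []       []       _             _            _         = tt
insert-stepSizes (μ ∷ μs) (k ∷ ks) (s ∷ ss) (ρ≺μ , chain) (o≡0 , fits) (eq , sz) =
  ℕ.+-cancelʳ-≡ (sum (first μs)) _ _ (begin
    sum (first (insert (μ ∷ μs) (k ∷ ks))) + sum (first μs)
      ≡⟨ cell-sum k μ (first (insert μs ks)) (first μs) ρ≺μ (proj₂ (insert-chain μs ks chain fits)) o≡0 ⟩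
    sum μ + sum (first (insert μs ks)) + k
      ≡⟨ cong (λ z → z + sum (first (insert μs ks)) + k) eq ⟩
    sum (first μs) + s + sum (first (insert μs ks)) + k
      ≡⟨ lemma (sum (first μs)) s (sum (first (insert μs ks))) k ⟩
    sum (first (insert μs ks)) + (s + k) + sum (first μs) ∎) ,
  insert-stepSizes μs ks ss chain fits sz
  where
  open ≡-Reasoning
  lemma : ∀ a s b k → a + s + b + k ≡ b + (s + k) + a
  lemma = ℕSolver.solve-∀

shapes-stepSizes : ∀ d (M : Vec (Vec ℕ n) m) → AllFit d M → StepSizes (shapes d M) (total M)
shapes-stepSizes {n} d [] _ = go n
  where
  go : ∀ n → StepSizes (Vec.replicate n (∅ {d})) (∅ {n})
  go zero    = tt
  go (suc n) = trans (cong sum (sym (first-replicate d n))) (sym (ℕ.+-identityʳ _)) , go n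
shapes-stepSizes d (k ∷ M) (fits , all) =
  insert-stepSizes (shapes d M) k (total M) (shapes-chain d M all) fits (shapes-stepSizes d M all)

firsts-stepSizes : ∀ d (M : Vec (Vec ℕ n) m) → AllFit d M → StepSizes (firsts d M) (Vec.map sum M)
firsts-stepSizes d [] _ = tt
firsts-stepSizes d (k ∷ M) (fits , all) =
  trans (insert-sum (shapes d M) k (shapes-chain d M all) fits) (cong (λ z → sum z + sum k) (sym (first-firsts d M))) ,
  firsts-stepSizes d M all

-- Chains of partitions and their sequences of steps.

partials : Vec (Vec ℕ d) n → Vec (Vec ℕ d) n
partials []       = []
partials (x ∷ xs) = total (x ∷ xs) ∷ partials xs

differences : Vec (Vec ℕ d) n → Vec (Vec ℕ d) n
differences []       = []
differences (μ ∷ μs) = zipWith _∸_ μ (first μs) ∷ differences μs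

first-partials : (xs : Vec (Vec ℕ d) n) → first (partials xs) ≡ total xs
first-partials []       = refl
first-partials (x ∷ xs) = refl

⊞-∸ : (μ x : Vec ℕ d) → zipWith _∸_ (μ ⊞ x) μ ≡ x
⊞-∸ []      []      = refl
⊞-∸ (l ∷ μ) (y ∷ x) = cong₂ _∷_ (ℕ.m+n∸m≡n l y) (⊞-∸ μ x)

∸-⊞ : ∀ {a} (μ ν : Vec ℕ d) → Interlaced a μ ν → μ ⊞ zipWith _∸_ ν μ ≡ ν
∸-⊞ []      []      _             = refl
∸-⊞ (l ∷ μ) (n ∷ ν) (_ , l≤n , i) = cong₂ _∷_ (ℕ.m+[n∸m]≡n l≤n) (∸-⊞ μ ν i)

differences-partials : (xs : Vec (Vec ℕ d) n) → differences (partials xs) ≡ xs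
differences-partials []       = refl
differences-partials (x ∷ xs) = cong₂ _∷_
  (trans (cong (zipWith _∸_ (total xs ⊞ x)) (first-partials xs)) (⊞-∸ (total xs) x)) (differences-partials xs)

total-differences : (μs : Vec (Vec ℕ d) n) → Chain μs → total (differences μs) ≡ first μs
total-differences []       _             = refl
total-differences (μ ∷ μs) (strip , chain) =
  trans (cong (_⊞ zipWith _∸_ μ (first μs)) (total-differences μs chain)) (∸-⊞ (first μs) μ strip)

partials-differences : (μs : Vec (Vec ℕ d) n) → Chain μs → partials (differences μs) ≡ μs
partials-differences []       _       = refl
partials-differences (μ ∷ μs) chain = cong₂ _∷_ (total-differences (μ ∷ μs) chain) (partials-differences μs (proj₂ chain))

partials-chain : (xs : Vec (Vec ℕ d) n) → Tower xs → Chain (partials xs)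
partials-chain []       _               = tt
partials-chain (x ∷ xs) (strip , tower) = subst (_≺ total xs ⊞ x) (sym (first-partials xs)) strip , partials-chain xs tower

differences-tower : (μs : Vec (Vec ℕ d) n) → Chain μs → Tower (differences μs)
differences-tower []       _ = tt
differences-tower (μ ∷ μs) chain@(strip , chain′) =
  subst₂ _≺_ (sym (total-differences μs chain′)) (sym (total-differences (μ ∷ μs) chain)) strip , differences-tower μs chain′

sum-⊞ : (μ x : Vec ℕ d) → sum (μ ⊞ x) ≡ sum μ + sum x
sum-⊞ []      []      = refl
sum-⊞ (l ∷ μ) (y ∷ x) = trans (cong (λ z → l + y + z) (sum-⊞ μ x)) (lemma l y (sum μ) (sum x))
  where
  lemma : ∀ a b c d → a + b + (c + d) ≡ (a + c) + (b + d)
  lemma = ℕSolver.solve-∀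

partials-stepSizes : (xs : Vec (Vec ℕ d) n) → StepSizes (partials xs) (Vec.map sum xs)
partials-stepSizes []       = tt
partials-stepSizes (x ∷ xs) =
  trans (sum-⊞ (total xs) x) (cong (λ z → sum z + sum x) (sym (first-partials xs))) , partials-stepSizes xs

-- Longest planar matchings

-- For a partition listed from its smallest part, an entry with `d` entries after it is the part
-- number `d + 1`, so `h` plays the role of the number of nonzero parts. A value of `h` beyond the
-- length is not excluded here; `Heights` adds that bound.
Height : Vec ℕ d → ℕ → Set
Height []               h = ⊤
Height (_∷_ {d} x xs) h = ((0 < x → d < h) × (d < h → 0 < x)) × Height xs h

-- The length reached through a cell with entry `k`, when `h` is the longest matching strictly below
-- and to the right of it.
hit : ℕ → ℕ → ℕ
hit zero    h = 0
hit (suc k) h = suc h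

<⊔⁻ : ∀ {i} a b → i < a ⊔ b → i < a ⊎ i < b
<⊔⁻ a b i< with ℕ.⊔-sel a b
... | inj₁ eq = inj₁ (subst (_ <_) eq i<)
... | inj₂ eq = inj₂ (subst (_ <_) eq i<)

<⊔ˡ : ∀ {i} a b → i < a → i < a ⊔ b
<⊔ˡ a b i<a = ℕ.≤-trans i<a (ℕ.m≤m⊔n a b)

<⊔ʳ : ∀ {i} a b → i < b → i < a ⊔ b
<⊔ʳ a b i<b = ℕ.≤-trans i<b (ℕ.m≤n⊔m a b)

0<⊓ : ∀ {a b} → 0 < a → 0 < b → 0 < a ⊓ b
0<⊓ (s≤s _) (s≤s _) = z<s

-- Below the first row where λ or μ is nonempty the carry is still the entry k.
grow-height : ∀ {hˡ hᵐ hᵖ k} A c (ls ms ps : Vec ℕ d) → Inner A ps ls ms →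
  Height ls hˡ → Height ms hᵐ → Height ps hᵖ →
  (0 < A → d < hˡ ⊔ hᵐ) → (d < hˡ ⊔ hᵐ → 0 < A) → (A ≡ 0 → c ≡ k) →
  Height (grow A c ls ms ps) ((hˡ ⊔ hᵐ) ⊔ hit k hᵖ)
grow-height {hˡ = hˡ} {hᵐ} {hᵖ} {k} zero c [] [] [] _ _ _ _ A⇒ ⇒A c≡k rewrite c≡k refl = (to k , from k) , tt
  where
  to : ∀ k → 0 < k → 0 < (hˡ ⊔ hᵐ) ⊔ hit k hᵖ
  to (suc k) _ = <⊔ʳ (hˡ ⊔ hᵐ) (suc hᵖ) z<s
  from : ∀ k → 0 < (hˡ ⊔ hᵐ) ⊔ hit k hᵖ → 0 < k
  from zero    lt with <⊔⁻ (hˡ ⊔ hᵐ) 0 lt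
  ... | inj₁ lt′ = ⇒A lt′
  from (suc k) lt = z<s
grow-height {hˡ = hˡ} {hᵐ} {hᵖ} {k} (suc A) c [] [] [] _ _ _ _ A⇒ ⇒A c≡k =
  ((λ _ → <⊔ˡ (hˡ ⊔ hᵐ) (hit k hᵖ) (A⇒ z<s)) , (λ _ → z<s)) , tt
grow-height {hˡ = hˡ} {hᵐ} {hᵖ} {k} A c (_∷_ {e} l ls) (m ∷ ms) (p ∷ ps) (A≤p , p≤B , i)
  ((l⇒ , ⇒l) , Hˡ) ((m⇒ , ⇒m) , Hᵐ) ((p⇒ , ⇒p) , Hᵖ) A⇒ ⇒A c≡k =
  row A c A≤p A⇒ ⇒A c≡k ,
  grow-height (l ⊔ m) (((A + c) ∸ p) + ((l ⊓ m) ∸ p)) ls ms ps i Hˡ Hᵐ Hᵖ lm⇒ ⇒lm carry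
  where
  lm⇒ : 0 < l ⊔ m → e < hˡ ⊔ hᵐ
  lm⇒ lt with <⊔⁻ l m lt
  ... | inj₁ 0<l = <⊔ˡ hˡ hᵐ (l⇒ 0<l)
  ... | inj₂ 0<m = <⊔ʳ hˡ hᵐ (m⇒ 0<m)

  ⇒lm : e < hˡ ⊔ hᵐ → 0 < l ⊔ m
  ⇒lm lt with <⊔⁻ hˡ hᵐ lt
  ... | inj₁ e<hˡ = <⊔ˡ l m (⇒l e<hˡ)
  ... | inj₂ e<hᵐ = <⊔ʳ l m (⇒m e<hᵐ)

  -- From `A ≤ p ≤ l ⊓ m`, an empty row of `λ` and `μ` forces `A` and `p` to vanish too, and the
  -- carry passes through unchanged.
  carry : l ⊔ m ≡ 0 → ((A + c) ∸ p) + ((l ⊓ m) ∸ p) ≡ k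
  carry l⊔m≡0 with ℕ.n≤0⇒n≡0 (ℕ.≤-trans (ℕ.m≤m⊔n l m) (ℕ.≤-reflexive l⊔m≡0))
                 | ℕ.n≤0⇒n≡0 (ℕ.≤-trans (ℕ.m≤n⊔m l m) (ℕ.≤-reflexive l⊔m≡0))
  ... | refl | refl with ℕ.n≤0⇒n≡0 p≤B
  ...   | refl with ℕ.n≤0⇒n≡0 A≤p
  ...     | refl = trans (ℕ.+-identityʳ c) (c≡k refl)

  row : ∀ A c → A ≤ p → (0 < A → suc e < hˡ ⊔ hᵐ) → (suc e < hˡ ⊔ hᵐ → 0 < A) → (A ≡ 0 → c ≡ k) →
        (0 < (A + c) ⊓ p → suc e < (hˡ ⊔ hᵐ) ⊔ hit k hᵖ) × (suc e < (hˡ ⊔ hᵐ) ⊔ hit k hᵖ → 0 < (A + c) ⊓ p)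
  row (suc A) c A≤p A⇒ ⇒A c≡k =
    (λ _ → <⊔ˡ (hˡ ⊔ hᵐ) (hit k hᵖ) (A⇒ z<s)) , (λ _ → 0<⊓ {suc A + c} z<s (ℕ.≤-trans z<s A≤p))
  -- The new entry is `k ⊓ p`. It lies one row below the entry `p` of `ρ`, so `ν` gains this row
  -- when `k` is nonzero and `ρ` reaches the row above: this is the `suc` in `hit`.
  row zero    c A≤p A⇒ ⇒A c≡k rewrite c≡k refl = to k , from k
    where
    to : ∀ k → 0 < k ⊓ p → suc e < (hˡ ⊔ hᵐ) ⊔ hit k hᵖ
    to (suc k) lt = <⊔ʳ (hˡ ⊔ hᵐ) (suc hᵖ) (s<s (p⇒ (ℕ.m≤n⊓o⇒m≤o (suc k) p lt)))

    from : ∀ k → suc e < (hˡ ⊔ hᵐ) ⊔ hit k hᵖ → 0 < k ⊓ p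
    from zero    lt with <⊔⁻ (hˡ ⊔ hᵐ) 0 lt
    ... | inj₁ lt′ = contradiction (⇒A lt′) (λ ())
    from (suc k) lt with <⊔⁻ (hˡ ⊔ hᵐ) (suc hᵖ) lt
    ... | inj₁ lt′ = contradiction (⇒A lt′) (λ ())
    ... | inj₂ lt′ = 0<⊓ {suc k} z<s (⇒p (ℕ.≤-pred lt′))

-- The value `0` past the end is the length for an empty range of columns.
at : Vec ℕ n → ℕ → ℕ
at []       j       = 0
at (h ∷ hs) zero    = h
at (h ∷ hs) (suc j) = at hs j

-- The lengths of the longest planar matchings in the columns from j on, when a
-- row ks is put on top of a matrix for which these lengths are hs.
insertLength : Vec ℕ n → Vec ℕ n → Vec ℕ n
insertLength []       []       = []
insertLength (h ∷ hs) (k ∷ ks) = (h ⊔ at (insertLength hs ks) 0) ⊔ hit k (at hs 0) ∷ insertLength hs ks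

lengths : Vec (Vec ℕ n) m → Vec ℕ n
lengths []      = ∅
lengths (k ∷ M) = insertLength (lengths M) k

height-∅ : ∀ d → Height (∅ {d}) 0
height-∅ zero    = tt
height-∅ (suc d) = ((λ ()) , (λ ())) , height-∅ d

Heights : Vec (Vec ℕ d) n → Vec ℕ n → Set
Heights []                 []       = ⊤
Heights (_∷_ {n} μ μs) (h ∷ hs) = (Height μ h × h ≤ Vec.length μ) × Heights μs hs

heights-first : (μs : Vec (Vec ℕ d) n) (hs : Vec ℕ n) → Heights μs hs → Height (first μs) (at hs 0) × at hs 0 ≤ d
heights-first {d} []       []       _        = height-∅ d , z≤n
heights-first     (μ ∷ μs) (h ∷ hs) (Hμ , _) = Hμ

private
  cell-height : ∀ {hᵘ hᵛ hʳ} k (μ ν ρ : Vec ℕ d) → ρ ≺ μ → ρ ≺ ν →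
    Height μ hᵘ × hᵘ ≤ d → Height ν hᵛ × hᵛ ≤ d → Height ρ hʳ → Height (grow 0 k μ ν ρ) ((hᵘ ⊔ hᵛ) ⊔ hit k hʳ)
  cell-height {hᵘ = hᵘ} {hᵛ} k μ ν ρ ρ≺μ ρ≺ν (Hᵘ , hᵘ≤d) (Hᵛ , hᵛ≤d) Hʳ =
    grow-height 0 k μ ν ρ (inner⁺ ρ μ ν ρ≺μ ρ≺ν) Hᵘ Hᵛ Hʳ (λ ()) (λ d< → contradiction (ℕ.⊔-lub hᵘ≤d hᵛ≤d) (ℕ.<⇒≱ d<)) (λ _ → refl)

  -- The overflow is part number `d + 1`, so its vanishing is the bound `h ≤ d`. Here the bound on
  -- matchings and the condition `Fits` meet.
  height-overflow : ∀ {h} (ns : Vec ℕ (suc d)) → Height ns h →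
    (Vec.head ns ≡ 0 → Height (Vec.tail ns) h × h ≤ d) × (h ≤ d → Vec.head ns ≡ 0)
  height-overflow (zero  ∷ ns) ((_ , from) , H) = (λ _ → H , ℕ.≮⇒≥ (λ d<h → contradiction (from d<h) (λ ()))) , (λ _ → refl)
  height-overflow (suc o ∷ ns) ((to , _) , H)   = (λ ()) , (λ h≤d → contradiction h≤d (ℕ.<⇒≱ (to z<s)))

insert-heights : (μs : Vec (Vec ℕ d) n) (hs ks : Vec ℕ n) → Chain μs → Heights μs hs → Fits μs ks →
                 Heights (insert μs ks) (insertLength hs ks)
insert-heights []       []       []       _ _ _ = tt
insert-heights (μ ∷ μs) (h ∷ hs) (k ∷ ks) (ρ≺μ , chain) (Hμ , H) (o≡0 , fits) =
  proj₁ (height-overflow _ (cell-height k μ _ (first μs) ρ≺μ (proj₂ (insert-chain μs ks chain fits)) Hμ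
    (heights-first _ _ IH) (proj₁ (heights-first μs hs H)))) o≡0 , IH
  where IH = insert-heights μs hs ks chain H fits

-- The new lengths do not increase to the right, so the bound at the first column passes to the
-- remaining ones, which must fit before the first cell can be examined.
heights⇒fits : (μs : Vec (Vec ℕ d) n) (hs ks : Vec ℕ n) → Chain μs → Heights μs hs → at (insertLength hs ks) 0 ≤ d → Fits μs ks
heights⇒fits []       []       []       _ _ _ = tt
heights⇒fits (μ ∷ μs) (h ∷ hs) (k ∷ ks) (ρ≺μ , chain) (Hμ , H) ≤d =
  proj₂ (height-overflow _ (cell-height k μ _ (first μs) ρ≺μ (proj₂ (insert-chain μs ks chain fits)) Hμ
    (heights-first _ _ (insert-heights μs hs ks chain H fits)) (proj₁ (heights-first μs hs H)))) ≤d , fits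
  where
  fits = heights⇒fits μs hs ks chain H
    (ℕ.≤-trans (ℕ.m≤n⊔m h _) (ℕ.≤-trans (ℕ.m≤m⊔n _ (hit k (at hs 0))) ≤d))

at-insertLength-≥ : ∀ (hs ks : Vec ℕ n) j → at hs j ≤ at (insertLength hs ks) j
at-insertLength-≥ []       []       j       = z≤n
at-insertLength-≥ (h ∷ hs) (k ∷ ks) zero    = ℕ.≤-trans (ℕ.m≤m⊔n h _) (ℕ.m≤m⊔n _ (hit k (at hs 0)))
at-insertLength-≥ (h ∷ hs) (k ∷ ks) (suc j) = at-insertLength-≥ hs ks j

shapes-heights : ∀ d (M : Vec (Vec ℕ n) m) → AllFit d M → Heights (shapes d M) (lengths M)
shapes-heights {n} d [] _ = go n
  where
  go : ∀ n → Heights (Vec.replicate n (∅ {d})) ∅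
  go zero    = tt
  go (suc n) = (height-∅ d , z≤n) , go n
shapes-heights d (k ∷ M) (fits , all) = insert-heights (shapes d M) (lengths M) k (shapes-chain d M all) (shapes-heights d M all) fits

allFit⇒lengths≤ : ∀ d (M : Vec (Vec ℕ n) m) → AllFit d M → at (lengths M) 0 ≤ d
allFit⇒lengths≤ d M all = proj₂ (heights-first (shapes d M) (lengths M) (shapes-heights d M all))

lengths≤⇒allFit : ∀ d (M : Vec (Vec ℕ n) m) → at (lengths M) 0 ≤ d → AllFit d M
lengths≤⇒allFit d []      _  = tt
lengths≤⇒allFit d (k ∷ M) ≤d =
  heights⇒fits (shapes d M) (lengths M) k (shapes-chain d M all) (shapes-heights d M all) ≤d , all
  where all = lengths≤⇒allFit d M (ℕ.≤-trans (at-insertLength-≥ (lengths M) k 0) ≤d)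

-- Increasing chains of nonzero entries.

entry : Vec (Vec ℕ n) m → Fin m × Fin n → ℕ
entry M (u , v) = lookup (lookup M u) v

infix 4 _↗_
_↗_ : Fin m × Fin n → Fin m × Fin n → Set
(u , v) ↗ (u′ , v′) = u Fin.< u′ × v Fin.< v′

-- A planar matching is, up to the order of its edges, a chain for _↗_.
IncreasingCells : Vec (Vec ℕ n) m → ℕ → List (Fin m × Fin n) → Set
IncreasingCells M j es = AllPairs _↗_ es × All (λ e → 0 < entry M e) es × All (λ e → j ≤ toℕ (proj₂ e)) es

at-∅ : ∀ n j → at (∅ {n}) j ≡ 0
at-∅ zero    j       = refl
at-∅ (suc n) zero    = refl
at-∅ (suc n) (suc j) = at-∅ n j

at-insertLength-hit : ∀ (hs ks : Vec ℕ n) v → 0 < lookup ks v → suc (at hs (suc (toℕ v))) ≤ at (insertLength hs ks) (toℕ v)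
at-insertLength-hit (h ∷ hs) (suc k ∷ ks) zero    _   = ℕ.m≤n⊔m (h ⊔ at (insertLength hs ks) 0) _
at-insertLength-hit (h ∷ hs) (k ∷ ks)     (suc v) 0<k = at-insertLength-hit hs ks v 0<k

Nonincreasing : Vec ℕ n → Set
Nonincreasing hs = ∀ j → at hs (suc j) ≤ at hs j

insertLength-nonincreasing : ∀ (hs ks : Vec ℕ n) → Nonincreasing (insertLength hs ks)
insertLength-nonincreasing []       []       j       = z≤n
insertLength-nonincreasing (h ∷ hs) (k ∷ ks) zero    = ℕ.≤-trans (ℕ.m≤n⊔m h _) (ℕ.m≤m⊔n _ (hit k (at hs 0)))
insertLength-nonincreasing (h ∷ hs) (k ∷ ks) (suc j) = insertLength-nonincreasing hs ks j

nonincreasing-≤ : ∀ (hs : Vec ℕ n) → Nonincreasing hs → ∀ {i j} → i ≤ j → at hs j ≤ at hs i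
nonincreasing-≤ hs dec i≤j = go (ℕ.≤⇒≤′ i≤j)
  where
  go : ∀ {i j} → i ℕ.≤′ j → at hs j ≤ at hs i
  go ℕ.≤′-refl            = ℕ.≤-refl
  go (ℕ.≤′-step {j} i≤′j) = ℕ.≤-trans (dec j) (go i≤′j)

lower : (es : List (Fin (suc m) × Fin n)) → All (λ e → 0 < toℕ (proj₁ e)) es → ∃[ es′ ] es ≡ map (map₁ suc) es′
lower []                   []          = [] , refl
lower ((zero  , v) ∷ es) (() ∷ _)
lower ((suc u , v) ∷ es) (_ ∷ pos) with lower es pos
... | es′ , refl = (u , v) ∷ es′ , refl

lower-increasing : ∀ {k} {M : Vec (Vec ℕ n) m} {j} es → IncreasingCells (k ∷ M) j (map (map₁ suc) es) → IncreasingCells M j es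
lower-increasing es (inc , pos , right) =
  AllPairs.map (map₁ ℕ.≤-pred) (AllPairs.map⁻ inc) , All.map⁻ pos , All.map⁻ right

raise-increasing : ∀ {k} {M : Vec (Vec ℕ n) m} {j} es → IncreasingCells M j es → IncreasingCells (k ∷ M) j (map (map₁ suc) es)
raise-increasing es (inc , pos , right) =
  AllPairs.map⁺ (AllPairs.map (map₁ s≤s) inc) , All.map⁺ pos , All.map⁺ right

-- All cells after the first lie below the top row, so `lower` moves them into `M`. If the first
-- cell is in the top row, the others lie strictly to its right and `at-insertLength-hit` accounts
-- for it; otherwise the whole chain lives in `M`.
length≤lengths : ∀ (M : Vec (Vec ℕ n) m) j es → IncreasingCells M j es → length es ≤ at (lengths M) j
length≤lengths M       j []             _ = z≤n
length≤lengths []      j ((() , v) ∷ es)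
length≤lengths (k ∷ M) j ((u , v) ∷ es) ((above ∷ inc) , (0<k ∷ pos) , (j≤v ∷ right))
  with lower es (All.map (λ (u<u′ , _) → ℕ.≤-trans z<s u<u′) above)
... | es′ , refl = go u 0<k above
  where
  go : ∀ u → 0 < entry (k ∷ M) (u , v) → All ((u , v) ↗_) (map (map₁ suc) es′) →
       suc (length (map (map₁ suc) es′)) ≤ at (insertLength (lengths M) k) j
  go zero 0<k above = begin
    suc (length (map (map₁ suc) es′))          ≡⟨ cong suc (List.length-map (map₁ suc) es′) ⟩
    suc (length es′)                           ≤⟨ s≤s (length≤lengths M (suc (toℕ v)) es′ (lower-increasing {k = k} {M} es′
                                                    (inc , pos , All.map proj₂ above))) ⟩
    suc (at (lengths M) (suc (toℕ v)))         ≤⟨ at-insertLength-hit (lengths M) k v 0<k ⟩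
    at (insertLength (lengths M) k) (toℕ v)    ≤⟨ nonincreasing-≤ (insertLength (lengths M) k) (insertLength-nonincreasing (lengths M) k) j≤v ⟩
    at (insertLength (lengths M) k) j          ∎
    where open ℕ.≤-Reasoning
  go (suc u) 0<k above = begin
    suc (length (map (map₁ suc) es′))          ≡⟨ cong suc (List.length-map (map₁ suc) es′) ⟩
    length ((u , v) ∷ es′)                     ≤⟨ length≤lengths M j ((u , v) ∷ es′) (lower-increasing {k = k} {M} ((u , v) ∷ es′)
                                                    ((above ∷ inc) , (0<k ∷ pos) , (j≤v ∷ right))) ⟩
    at (lengths M) j                           ≤⟨ at-insertLength-≥ (lengths M) k j ⟩
    at (insertLength (lengths M) k) j          ∎
    where open ℕ.≤-Reasoning

hit-sel : ∀ k h → hit k h ≡ 0 ⊎ (0 < k × hit k h ≡ suc h)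
hit-sel zero    h = inj₁ refl
hit-sel (suc k) h = inj₂ (z<s , refl)

-- Tracing the maxima to where they are attained tells `lengths-attained` whether to lift an old
-- chain or to put a cell of the new row in front of one.
at-insertLength-sel : ∀ (hs ks : Vec ℕ n) j →
  (∃[ i ] j ≤ i × at (insertLength hs ks) j ≡ at hs i) ⊎
  (∃[ v ] j ≤ toℕ v × 0 < lookup ks v × at (insertLength hs ks) j ≡ suc (at hs (suc (toℕ v))))
at-insertLength-sel []       []       j = inj₁ (j , ℕ.≤-refl , refl)
at-insertLength-sel (h ∷ hs) (k ∷ ks) (suc j) with at-insertLength-sel hs ks j
... | inj₁ (i , j≤i , eq)       = inj₁ (suc i , s≤s j≤i , eq)
... | inj₂ (v , j≤v , 0<k , eq) = inj₂ (suc v , s≤s j≤v , 0<k , eq)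
at-insertLength-sel (h ∷ hs) (k ∷ ks) zero
  with ℕ.⊔-sel (h ⊔ at (insertLength hs ks) 0) (hit k (at hs 0)) | ℕ.⊔-sel h (at (insertLength hs ks) 0)
... | inj₁ eq | inj₁ eq′ = inj₁ (0 , z≤n , trans eq eq′)
... | inj₁ eq | inj₂ eq′ with at-insertLength-sel hs ks 0
...   | inj₁ (i , _ , eq″)       = inj₁ (suc i , z≤n , trans eq (trans eq′ eq″))
...   | inj₂ (v , _ , 0<k , eq″) = inj₂ (suc v , z≤n , 0<k , trans eq (trans eq′ eq″))
at-insertLength-sel (h ∷ hs) (k ∷ ks) zero | inj₂ eq | _ with hit-sel k (at hs 0)
-- A maximum equal to `0` forces the old length `h` to be `0` as well, so the first column is a
-- witness.
...   | inj₁ hit≡0       = inj₁ (0 , z≤n , ℕ.≤-antisym (ℕ.≤-trans (ℕ.≤-reflexive (trans eq hit≡0)) z≤n)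
  (ℕ.≤-trans (ℕ.m≤m⊔n h _) (ℕ.m≤m⊔n _ (hit k (at hs 0)))))
...   | inj₂ (0<k , eq′) = inj₂ (zero , z≤n , 0<k , trans eq eq′)

lengths-attained : ∀ (M : Vec (Vec ℕ n) m) j → ∃[ es ] IncreasingCells M j es × length es ≡ at (lengths M) j
lengths-attained {n} []      j = [] , ([] , [] , []) , sym (at-∅ n j)
lengths-attained (k ∷ M) j with at-insertLength-sel (lengths M) k j
... | inj₁ (i , j≤i , eq) with lengths-attained M i
...   | es , inc , len with raise-increasing {k = k} {M} es inc
...     | inc′ , pos , right = map (map₁ suc) es , (inc′ , pos , All.map (ℕ.≤-trans j≤i) right) ,
  trans (List.length-map (map₁ suc) es) (trans len (sym eq))
lengths-attained (k ∷ M) j | inj₂ (v , j≤v , 0<k , eq) with lengths-attained M (suc (toℕ v))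
...   | es , inc , len with raise-increasing {k = k} {M} es inc
...     | inc′ , pos , right = (zero , v) ∷ map (map₁ suc) es ,
  ((All.zipWith id (All.map⁺ (All.universal (λ _ → z<s) es) , right) ∷ inc′) , (0<k ∷ pos) ,
    (j≤v ∷ All.map (λ v<v′ → ℕ.≤-trans j≤v (ℕ.<⇒≤ v<v′)) right)) ,
  trans (cong suc (trans (List.length-map (map₁ suc) es) len)) (sym eq)

-- Planar matchings in lexicographic order.

infix 4 _<ₗ_ _≤ₗ_
_<ₗ_ _≤ₗ_ : Edge n → Edge n → Set
(u , v) <ₗ (u′ , v′) = u Fin.< u′ ⊎ (u ≡ u′ × v Fin.< v′)
e ≤ₗ e′ = e ≡ e′ ⊎ e <ₗ e′

<ₗ-asym : {e e′ : Edge n} → e <ₗ e′ → ¬ (e′ <ₗ e)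
<ₗ-asym (inj₁ lt)         (inj₁ gt)         = ℕ.<-asym lt gt
<ₗ-asym (inj₁ lt)         (inj₂ (refl , _)) = ℕ.<-irrefl refl lt
<ₗ-asym (inj₂ (refl , _)) (inj₁ gt)         = ℕ.<-irrefl refl gt
<ₗ-asym (inj₂ (_ , lt))   (inj₂ (_ , gt))   = ℕ.<-asym lt gt

allPairs-resp-⊆ : ∀ {A : Set} {R : A → A → Set} {xs ys : List A} → xs ⊆ ys → AllPairs R ys → AllPairs R xs
allPairs-resp-⊆ []         []         = []
allPairs-resp-⊆ (y ∷ʳ p)   (_ ∷ rs)   = allPairs-resp-⊆ p rs
allPairs-resp-⊆ (refl ∷ p) (r ∷ rs)   = Sublist.All-resp-⊆ p r ∷ allPairs-resp-⊆ p rs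

-- If the heads differ, the head of `ys` precedes that of `xs`, and asymmetry keeps it out of the
-- rest of `xs`, so it can be skipped. This is how an increasing chain of cells becomes a sublist of
-- the list of all cells.
sorted-⊆ : ∀ {A : Set} {R : A → A → Set} → (∀ {x y} → R x y → ¬ R y x) → ∀ {xs ys : List A} →
           AllPairs R xs → AllPairs R ys → (∀ {x} → x ∈ xs → x ∈ ys) → xs ⊆ ys
sorted-⊆ asym {[]}     {ys} _ _ _ = Sublist.[]⊆-universal ys
sorted-⊆ asym {x ∷ xs} {[]} _ _ sub with sub (here refl)
... | ()
sorted-⊆ asym {x ∷ xs} {y ∷ ys} (rx ∷ rxs) (ry ∷ rys) sub with sub (here refl)
... | here refl = refl ∷ sorted-⊆ asym rxs rys sub′
  where
  sub′ : ∀ {z} → z ∈ xs → z ∈ ys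
  sub′ z∈ with sub (there z∈)
  ... | there z∈ys = z∈ys
  ... | here refl  = contradiction (All.lookup rx z∈) (λ r → asym r r)
... | there x∈ys = y ∷ʳ sorted-⊆ asym (rx ∷ rxs) rys sub′
  where
  sub′ : ∀ {z} → z ∈ x ∷ xs → z ∈ ys
  sub′ (here refl) = x∈ys
  sub′ (there z∈) with sub (there z∈)
  ... | there z∈ys = z∈ys
  ... | here refl  = contradiction (All.lookup ry x∈ys) (asym (All.lookup rx z∈))

private
  cells : ∀ n → List (Edge n)
  cells n = cartesianProduct (allFin n) (allFin n)

cartesianProduct-sorted : ∀ {us vs : List (Fin n)} → AllPairs Fin._<_ us → AllPairs Fin._<_ vs → AllPairs _<ₗ_ (cartesianProduct us vs)
cartesianProduct-sorted []         rvs = []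
cartesianProduct-sorted {us = u ∷ us} {vs} (ru ∷ rus) rvs = AllPairs.++⁺
  (AllPairs.map⁺ (AllPairs.map (λ v<v′ → inj₂ (refl , v<v′)) rvs))
  (cartesianProduct-sorted rus rvs)
  (All.map⁺ (All.universal (λ v → All.cartesianProduct⁺ (setoid _) (setoid _) us vs
    (λ u′∈ _ → inj₁ (All.lookup ru u′∈))) vs))

cells-sorted : ∀ n → AllPairs _<ₗ_ (cells n)
cells-sorted n = cartesianProduct-sorted allFin-sorted allFin-sorted
  where
  allFin-sorted : AllPairs Fin._<_ (allFin n)
  allFin-sorted = AllPairs.tabulate⁺-< id

module _ (c : Edge n → ℕ) where

  private
    copies : List (Edge n) → List (Edge n)
    copies = concatMap (λ e → replicate (c e) e)

  copies-sorted : ∀ {es} → AllPairs _<ₗ_ es → AllPairs _≤ₗ_ (copies es)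
  copies-sorted []                  = []
  copies-sorted {e ∷ es} (re ∷ res) = AllPairs.++⁺ (constant (c e)) (copies-sorted res)
    (All.replicate⁺ (c e) (All.map inj₂ (all-copies es re)))
    where
    constant : ∀ k → AllPairs _≤ₗ_ (replicate k e)
    constant zero    = []
    constant (suc k) = All.replicate⁺ k (inj₁ refl) ∷ constant k

    all-copies : ∀ {P : Edge n → Set} es → All P es → All P (copies es)
    all-copies []       []       = []
    all-copies (e ∷ es) (p ∷ ps) = All.++⁺ (All.replicate⁺ (c e) p) (all-copies es ps)

  copies-positive : ∀ es → All (λ e → 0 < c e) (copies es)
  copies-positive []       = []
  copies-positive (e ∷ es) = All.++⁺ (positive (c e) refl) (copies-positive es)
    where
    positive : ∀ k → c e ≡ k → All (λ e → 0 < c e) (replicate k e)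
    positive zero    _  = []
    positive (suc k) eq = All.replicate⁺ (suc k) (ℕ.≤-trans z<s (ℕ.≤-reflexive (sym eq)))

  ⊆-copies : ∀ {es fs} → es ⊆ fs → All (λ e → 0 < c e) es → es ⊆ copies fs
  ⊆-copies []              _         = []
  ⊆-copies (f ∷ʳ p)        pos       = Sublist.++⁺ˡ (replicate (c f) f) (⊆-copies p pos)
  ⊆-copies (_∷_ {e} refl p) (0<c ∷ pos) with c e | 0<c
  ... | suc k | _ = refl ∷ Sublist.++⁺ˡ (replicate k e) (⊆-copies p pos)

module _ (G : Multigraph n) where

  private
    ↗-of : ∀ {e e′ : Edge n} → e ≤ₗ e′ → Noncrossing e e′ → e ↗ e′
    ↗-of _                          (inj₁ e↗e′)     = e↗e′
    ↗-of (inj₁ refl)                (inj₂ (gt , _)) = contradiction gt (ℕ.<-irrefl refl)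
    ↗-of (inj₂ (inj₁ lt))           (inj₂ (gt , _)) = contradiction gt (ℕ.<-asym lt)
    ↗-of (inj₂ (inj₂ (refl , _)))   (inj₂ (gt , _)) = contradiction gt (ℕ.<-irrefl refl)

  -- The list of edges is in weak lexicographic order, and so is each of its sublists. This excludes
  -- the alternative of `Noncrossing` in which the later edge precedes the earlier one in both
  -- coordinates.
  planar⇒increasing : ∀ {M} → PlanarMatching G M → IncreasingCells G 0 M
  planar⇒increasing {M} (M⊆ , nc) =
    AllPairs.zipWith (λ (le , nc) → ↗-of le nc)
      (allPairs-resp-⊆ M⊆ (copies-sorted (entry G) (cells-sorted n)) , nc) ,
    Sublist.All-resp-⊆ M⊆ (copies-positive (entry G) (cells n)) ,
    All.universal (λ _ → z≤n) M

  increasing⇒planar : ∀ {M} → IncreasingCells G 0 M → PlanarMatching G M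
  increasing⇒planar (inc , pos , _) =
    ⊆-copies (entry G) (sorted-⊆ <ₗ-asym (AllPairs.map (λ (u<u′ , _) → inj₁ u<u′) inc) (cells-sorted n)
      (λ {(u , v)} _ → ∈.∈-cartesianProduct⁺ (∈.∈-allFin u) (∈.∈-allFin v))) pos ,
    AllPairs.map inj₁ inc

  L≡lengths : L G ≡ at (lengths G) 0
  L≡lengths with L-attained G | lengths-attained G 0
  ... | M , planar , len | M′ , inc , len′ = ℕ.≤-antisym
    (subst (_≤ at (lengths G) 0) len (length≤lengths G 0 M (planar⇒increasing planar)))
    (subst (_≤ L G) len′ (L-upper G (increasing⇒planar inc)))

-- Regular matrices and pairs of towers.

↑-injective : (μ ν : Vec ℕ d) → ↑ μ ≡ ↑ ν → μ ≡ ν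
↑-injective []      []      _  = refl
↑-injective (_ ∷ μ) (_ ∷ ν) eq = cong₂ _∷_ (ℤ.+-injective (Vec.∷-injectiveˡ eq)) (↑-injective μ ν (Vec.∷-injectiveʳ eq))

column-sum : ∀ (M : Vec (Vec ℕ n) m) v → sum (tabulate (λ u → lookup (lookup M u) v)) ≡ lookup (total M) v
column-sum []      v = sym (Vec.lookup-replicate v 0)
column-sum (k ∷ M) v = trans (cong (λ z → lookup k v + z) (column-sum M v))
  (trans (ℕ.+-comm (lookup k v) _) (sym (Vec.lookup-zipWith _+_ v (total M) k)))

all⇒map-sum : ∀ {r} (xs : Vec (Vec ℕ d) n) → VecAll.All (λ x → sum x ≡ r) xs → Vec.map sum xs ≡ Vec.replicate n r
all⇒map-sum []       []         = refl
all⇒map-sum (x ∷ xs) (eq ∷ eqs) = cong₂ _∷_ eq (all⇒map-sum xs eqs)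

map-sum⇒all : ∀ {r} (xs : Vec (Vec ℕ d) n) → Vec.map sum xs ≡ Vec.replicate n r → VecAll.All (λ x → sum x ≡ r) xs
map-sum⇒all []       _  = []
map-sum⇒all (x ∷ xs) eq = Vec.∷-injectiveˡ eq ∷ map-sum⇒all xs (Vec.∷-injectiveʳ eq)

≡replicate : ∀ {r} (xs : Vec ℕ n) → (∀ i → lookup xs i ≡ r) → xs ≡ Vec.replicate n r
≡replicate []       _  = refl
≡replicate (x ∷ xs) eq = cong₂ _∷_ (eq zero) (≡replicate xs (eq ∘ suc))

module _ {r : ℕ} (G : Multigraph n) where

  private
    degᵁ≡ : ∀ u → degᵁ G u ≡ lookup (Vec.map sum G) u
    degᵁ≡ u = trans (cong sum (Vec.tabulate∘lookup (lookup G u))) (sym (Vec.lookup-map u sum G))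

  regular⇒margins : Regular r G → total G ≡ Vec.replicate n r × Vec.map sum G ≡ Vec.replicate n r
  regular⇒margins (degᵁ≡r , degⱽ≡r) =
    ≡replicate (total G) (λ v → trans (sym (column-sum G v)) (degⱽ≡r v)) ,
    ≡replicate (Vec.map sum G) (λ u → trans (sym (degᵁ≡ u)) (degᵁ≡r u))

  margins⇒regular : total G ≡ Vec.replicate n r → Vec.map sum G ≡ Vec.replicate n r → Regular r G
  margins⇒regular cols rows =
    (λ u → trans (degᵁ≡ u) (trans (cong (λ z → lookup z u) rows) (Vec.lookup-replicate u r))) ,
    (λ v → trans (column-sum G v) (trans (cong (λ z → lookup z v) cols) (Vec.lookup-replicate v r)))

differences-sums : (μs : Vec (Vec ℕ d) n) {ss : Vec ℕ n} → Chain μs → StepSizes μs ss → Vec.map sum (differences μs) ≡ ss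
differences-sums μs chain sizes = stepSizes-unique μs
  (subst (λ νs → StepSizes νs (Vec.map sum (differences μs))) (partials-differences μs chain) (partials-stepSizes (differences μs)))
  sizes

-- A matrix goes to the successive differences along the upper and left borders of its growth
-- diagram. Regularity becomes the size `r` of all steps, the bound on `L` becomes the absence of
-- overflow, and the common corner gives the two towers the same total.
g≡towerPairs : ∀ n r d → g r n d ≡ ∣ towerPairs n r d ∣
g≡towerPairs n r d = ∣∣-bijection (graphsWithL≤ n r d) (towerPairs n r d) tableaux
  (λ {G} → tableaux-sound {G}) (λ {G} {G′} → tableaux-injective {G} {G′}) tableaux-surjective
  where
  tableaux : Multigraph n → Vec (Vec ℕ d) n × Vec (Vec ℕ d) n
  tableaux G = differences (shapes d G) , differences (firsts d G)

  fits : ∀ {G} → GraphsWithL≤ n r d G → AllFit d G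
  fits {G} (_ , L≤d) = lengths≤⇒allFit d G (subst (_≤ d) (L≡lengths G) L≤d)

  tableaux-sound : ∀ {G} → GraphsWithL≤ n r d G → let (xs , ys) = tableaux G in
    (VecAll.All (λ x → sum x ≡ r) xs × VecAll.All (λ x → sum x ≡ r) ys) × Tower xs × Tower ys × ↑ total xs ≡ ↑ total ys
  tableaux-sound {G} G∈@(regular , _) with fits G∈ | regular⇒margins G regular
  ... | all | cols , rows =
    (map-sum⇒all _ (trans (differences-sums (shapes d G) chain (shapes-stepSizes d G all)) cols) ,
     map-sum⇒all _ (trans (differences-sums (firsts d G) chain′ (firsts-stepSizes d G all)) rows)) ,
    differences-tower (shapes d G) chain , differences-tower (firsts d G) chain′ ,
    cong ↑_ (trans (total-differences (shapes d G) chain)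
      (trans (sym (first-firsts d G)) (sym (total-differences (firsts d G) chain′))))
    where
    chain  = shapes-chain d G all
    chain′ = firsts-chain d G all

  tableaux-injective : ∀ {G G′} → GraphsWithL≤ n r d G → GraphsWithL≤ n r d G′ → tableaux G ≡ tableaux G′ → G ≡ G′
  tableaux-injective {G} {G′} G∈ G′∈ eq = begin
    G                                    ≡⟨ rebuild-shapes d G (fits G∈) ⟨
    rebuild (shapes d G) (firsts d G)    ≡⟨ cong₂ rebuild
      (recover (shapes-chain d G (fits G∈)) (shapes-chain d G′ (fits G′∈)) (cong proj₁ eq))
      (recover (firsts-chain d G (fits G∈)) (firsts-chain d G′ (fits G′∈)) (cong proj₂ eq)) ⟩
    rebuild (shapes d G′) (firsts d G′)  ≡⟨ rebuild-shapes d G′ (fits G′∈) ⟩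
    G′                                   ∎
    where
    open ≡-Reasoning
    recover : {μs νs : Vec (Vec ℕ d) n} → Chain μs → Chain νs → differences μs ≡ differences νs → μs ≡ νs
    recover {μs} {νs} chain chain′ eq =
      trans (sym (partials-differences μs chain)) (trans (cong partials eq) (partials-differences νs chain′))

  tableaux-surjective : ∀ {p : Vec (Vec ℕ d) n × Vec (Vec ℕ d) n} → let (xs , ys) = p in
    (VecAll.All (λ x → sum x ≡ r) xs × VecAll.All (λ x → sum x ≡ r) ys) × Tower xs × Tower ys × ↑ total xs ≡ ↑ total ys →
    ∃[ G ] GraphsWithL≤ n r d G × tableaux G ≡ p
  tableaux-surjective {xs , ys} ((sx , sy) , tx , ty , eq)
    with shapes-rebuild (partials xs) (partials ys) (partials-chain xs tx) (partials-chain ys ty)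
           (trans (first-partials xs) (trans (↑-injective (total xs) (total ys) eq) (sym (first-partials ys))))
  ... | all , shapes≡ , firsts≡ = G ,
    (margins⇒regular G
      (trans (stepSizes-unique (shapes d G) (shapes-stepSizes d G all)
        (subst (λ μs → StepSizes μs (Vec.map sum xs)) (sym shapes≡) (partials-stepSizes xs))) (all⇒map-sum xs sx))
      (trans (stepSizes-unique (firsts d G) (firsts-stepSizes d G all)
        (subst (λ μs → StepSizes μs (Vec.map sum ys)) (sym firsts≡) (partials-stepSizes ys))) (all⇒map-sum ys sy)) ,
     subst (_≤ d) (sym (L≡lengths G)) (allFit⇒lengths≤ d G all)) ,
    cong₂ _,_ (trans (cong differences shapes≡) (differences-partials xs))
              (trans (cong differences firsts≡) (differences-partials ys))
    where G = rebuild (partials xs) (partials ys)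

theorem1 : ∀ (n r d : ℕ) → 1 ≤ n → 1 ≤ r → 1 ≤ d →
    + g r n d ≡ ∑ (S d) (λ π → sgn π * + ∣ enumerate-W′ n r d (toeplitz π) ∣)
theorem1 n r d _ _ _ = trans (cong (λ k → + k) (g≡towerPairs n r d)) (sym (signed-walks≡towerPairs n r d))
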